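{- Let $k$ be a field of characteristic different from $2$, let $d\in k$, and let $E\subset\mathbb{P}^3$ be the elliptic curve $$X_0^2+dX_3^2=X_1^2+X_2^2,\qquad X_0X_3=X_1X_2,$$ with identity $\mathrm{O}=(1:0:1:0)$ and negation $(X_0:X_1:X_2:X_3)\mapsto(X_0:-X_1:X_2:-X_3)$. Let $\mathscr{K}_1=E/\{\pm1\}\cong\mathbb{P}^1$ with quotient map $(X_0:X_1:X_2:X_3)\mapsto(X_0:X_2)=(X_1:X_3)$, and let $\mathscr{K}_2=E^2/\{\pm1\}$, where $-1$ acts diagonally on $E^2$. Write points of $E^2$ as $(P,Q)=\big((X_0:X_1:X_2:X_3),(Y_0:Y_1:Y_2:Y_3)\big)$, and coordinates on $\mathscr{K}_1^2\times\mathbb{P}^1$ as $\big((x_0:x_1),(y_0:y_1),(Z_0:Z_1)\big)$. Then: (1) The Kummer surface $\mathscr{K}_2$ has a model as the hypersurface in $\mathscr{K}_1^2\times\mathbb{P}^1$ given by $$(x_0^2-x_1^2)(y_0^2-y_1^2)Z_0^2=(x_0^2-dx_1^2)(y_0^2-dy_1^2)Z_1^2,$$ with base point $\pi(\mathrm{O})=\big((1:1),(1:1),(1:0)\big)$, and with projection $\pi:E^2\to\mathscr{K}_2$ given by $\pi_1(P,Q)=(X_0:X_2)$, $\pi_2(P,Q)=(Y_0:Y_2)$, and $$\pi_3(P,Q)=(X_0Y_0:X_1Y_1)=(X_2Y_0:X_3Y_1)=(X_0Y_2:X_1Y_3)=(X_2Y_2:X_3Y_3).$$ (2) Under the Segre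 embedding $S:\mathscr{K}_1^2\to\mathbb{P}^3$, $\big((x_0:x_1),(y_0:y_1)\big)\mapsto(U_0:U_1:U_2:U_3)=(x_0y_0:x_1y_0:x_0y_1:x_1y_1)$, whose image is the quadric $U_0U_3=U_1U_2$, this model becomes the variety in $\mathbb{P}^3\times\mathbb{P}^1$ cut out on the hypersurface $U_0U_3=U_1U_2$ by $$(U_0^2-U_1^2-U_2^2+U_3^2)Z_0^2=(U_0^2-dU_1^2-dU_2^2+d^2U_3^2)Z_1^2.$$ (3) The Segre embedding of $\mathscr{K}_2$ in $\mathbb{P}^7$ (coordinates $T_0,\dots,T_7$) is cut out by the quadratic relation $$T_0^2-T_1^2-T_2^2+T_3^2=T_4^2-dT_5^2-dT_6^2+d^2T_7^2$$ on the image of the Segre embedding $(\mathbb{P}^1)^3\to\mathbb{P}^7$, which is defined by $$T_0T_3=T_1T_2,\ T_0T_5=T_1T_4,\ T_0T_6=T_2T_4,\ T_0T_7=T_3T_4,\ T_1T_6=T_3T_4,\ T_1T_7=T_3T_5,\ T_2T_5=T_3T_4,\ T_2T_7=T_3T_6,\ T_4T_7=T_5T_6;$$ and the morphism $E^2\to S(\mathscr{K}_2)\subseteq\mathbb{P}^7$ is given by $$(P,Q)\mapsto(X_0Y_0:X_2Y_0:X_0Y_2:X_2Y_2:X_1Y_1:X_3Y_1:X_1Y_3:X_3Y_3).$$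
   Context: $\mathscr{K}_1^2\times\mathbb{P}^1$ is viewed as $(\mathbb{P}^1)^3$, the first two factors being the two copies of the Kummer curve $\mathscr{K}_1$ and the third an auxiliary $\mathbb{P}^1$; $\pi_1,\pi_2,\pi_3$ denote the three factor components of $\pi:E^2\to\mathscr{K}_2\subseteq\mathscr{K}_1^2\times\mathbb{P}^1$. The paper uses the letters $(X_0:X_1)$, $(Y_0:Y_1)$ also for the coordinates on the two copies of $\mathscr{K}_1$; here they are written $(x_0:x_1)$, $(y_0:y_1)$ to distinguish them from coordinates on $E$.
   Formalization: π is not a morphism on all of E²: its formulas vanish at 8 geometric points, e.g. P=O, Q=(0:√d:0:1). Formally it is the quotient by ±1 off these points, onto the hypersurface minus 8 lines (a birational model); the map to P^7 likewise. Equality in fields is decidable. -}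

module Defs where

open import Algebra.Bundles using (CommutativeRing; RawRing)
import Algebra.Definitions as AlgebraDefinitions
import Algebra.Definitions.RawSemiring as RawSemiringDefinitions
open import Algebra.Morphism.Structures using (module RingMorphisms)
import Algebra.Properties.Ring as RingProperties
open import Data.Fin.Base using (Fin; zero; suc; toℕ)
open import Data.List.Base as List using (List)
import Data.List.Relation.Unary.All as ListAll
import Data.List.Relation.Unary.Any as ListAny
open import Data.Nat.Base as ℕ using (ℕ)
open import Data.Product.Base using (∃; ∃-syntax; ∃₂; Σ-syntax; _×_; _,_)
open import Data.Sum.Base using (_⊎_)
open import Data.Vec.Base as Vec using (Vec; []; _∷_; lookup; replicate; zipWith; _[_]≔_)
open import Data.Vec.Relation.Binary.Pointwise.Inductive using (Pointwise)
open import Data.Vec.Relation.Unary.All using (All; []; _∷_)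
open import Data.Vec.Relation.Unary.Any using (Any; here; there)
open import Level using (Level; _⊔_) renaming (suc to lsuc)
open import Relation.Binary.Definitions using (Decidable)
open import Relation.Nullary using (¬_)

------------------------------------------------------------------------
-- Fields and their extensions

-- Discrete fields: vanishing of an element is decidable, as is tacit in
-- any case distinction on homogeneous coordinates.

record Field (c ℓ : Level) : Set (lsuc (c ⊔ ℓ)) where
  field
    commutativeRing : CommutativeRing c ℓ
  open CommutativeRing commutativeRing public
  open AlgebraDefinitions _≈_ using (Invertible)
  field
    _≟_     : Decidable _≈_
    1≉0     : 1# ≉ 0#
    inverse : ∀ {x} → x ≉ 0# → Invertible 1# _*_ x

  infix 9 _²
  _² : Carrier → Carrier
  x ² = x * x

-- Every monic polynomial of positive degree has a root.
AlgebraicallyClosed : ∀ {c ℓ : Level} → Field c ℓ → Set (c ⊔ ℓ)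
AlgebraicallyClosed K =
  ∀ n (a : Fin (ℕ.suc n) → Carrier) →
  ∃[ x ] (x ^ ℕ.suc n + sum (λ i → a i * x ^ toℕ i)) ≈ 0#
  where
  open Field K
  open RawSemiringDefinitions (RawRing.rawSemiring rawRing) using (_^_; sum)

record Extension {c ℓ : Level} (k : Field c ℓ) : Set (lsuc (c ⊔ ℓ)) where
  private module k = Field k
  field
    K : Field c ℓ
  open Field K public
  open RingMorphisms k.rawRing rawRing using (IsRingHomomorphism)
  field
    ι                  : k.Carrier → Carrier
    isRingHomomorphism : IsRingHomomorphism ι

------------------------------------------------------------------------
-- Points of projective spaces and of their products

module Projective {c ℓ : Level} (K : Field c ℓ) where
  open Field K

  Nonzero : ∀ {n : ℕ} → Vec Carrier n → Set (c ⊔ ℓ)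
  Nonzero = Any (_≉ 0#)

  record ℙ (n : ℕ) : Set (c ⊔ ℓ) where
    constructor [_∣_]
    field
      coords  : Vec Carrier (ℕ.suc n)
      nonzero : Nonzero coords
  open ℙ public

  infix 4 _∝_ _∼_
  _∝_ : ∀ {n : ℕ} → Vec Carrier n → Vec Carrier n → Set (c ⊔ ℓ)
  v ∝ w = ∃[ μ ] μ ≉ 0# × Pointwise _≈_ w (Vec.map (μ *_) v)

  -- A point of ℙ^n₁ × ⋯ × ℙ^nᵣ.
  Points : ∀ {r : ℕ} → Vec ℕ r → Set (c ⊔ ℓ)
  Points = All ℙ

  factor : ∀ {r : ℕ} {ns : Vec ℕ r} → Points ns → (j : Fin r) → ℙ (lookup ns j)
  factor (P ∷ Ps) zero    = P
  factor (P ∷ Ps) (suc j) = factor Ps j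

  _∼_ : ∀ {r : ℕ} {ns : Vec ℕ r} → Points ns → Points ns → Set (c ⊔ ℓ)
  P ∼ Q = ∀ j → coords (factor P j) ∝ coords (factor Q j)

  -- A rational map to ℙ^n is given by several tuples of forms, any of
  -- which may vanish identically at a given point.  With vs the list of
  -- values of these tuples, z IsValue vs says that the map is defined
  -- by at least one of them and that all those that make sense give z.
  Defined : ∀ {n : ℕ} → List (Vec Carrier n) → Set (c ⊔ ℓ)
  Defined = ListAny.Any Nonzero

  infix 4 _IsValue_
  _IsValue_ : ∀ {n : ℕ} → ℙ n → List (Vec Carrier (ℕ.suc n)) → Set (c ⊔ ℓ)
  z IsValue vs =
    Defined vs × ListAll.All (λ v → Nonzero v → v ∝ coords z) vs

------------------------------------------------------------------------
-- Multihomogeneous forms on ℙ^n₁ × ⋯ × ℙ^nᵣ with coefficients in k,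
-- indexed by their multidegree

module _ {c ℓ : Level} (k : Field c ℓ) where
  private module k = Field k

  infixl 6 _⊕_
  infixl 7 _⊗_
  data Form {r : ℕ} (ns : Vec ℕ r) : Vec ℕ r → Set c where
    con : k.Carrier → Form ns (replicate r 0)
    var : (j : Fin r) → Fin (ℕ.suc (lookup ns j)) → Form ns (replicate r 0 [ j ]≔ 1)
    _⊕_ : ∀ {δ} → Form ns δ → Form ns δ → Form ns δ
    _⊗_ : ∀ {δ ε} → Form ns δ → Form ns ε → Form ns (zipWith ℕ._+_ δ ε)

  module _ (L : Extension k) where
    open Extension L
    open Projective K

    eval : ∀ {r : ℕ} {ns δ : Vec ℕ r} → Form ns δ → Points ns → Carrier
    eval (con a)   P = ι a
    eval (var j i) P = lookup (coords (factor P j)) i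
    eval (f ⊕ g)   P = eval f P + eval g P
    eval (f ⊗ g)   P = eval f P * eval g P

    NonzeroAt : ∀ {r : ℕ} {ns δ : Vec ℕ r} → Form ns δ → Points ns → Set ℓ
    NonzeroAt f P = eval f P ≉ 0#

  -- Subsets of ℙ^n₁ × ⋯ × ℙ^nᵣ and relations between such products,
  -- through their points over all extensions of k.
  Locus : ∀ {r : ℕ} → Vec ℕ r → (a : Level) → Set (lsuc (c ⊔ ℓ ⊔ a))
  Locus ns a = (L : Extension k) → Projective.Points (Extension.K L) ns → Set a

  Correspondence : ∀ {r s : ℕ} → Vec ℕ r → Vec ℕ s → (a : Level) → Set (lsuc (c ⊔ ℓ ⊔ a))
  Correspondence ms ns a =
    (L : Extension k) → let open Projective (Extension.K L) in
    Points ms → Points ns → Set a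

  -- π is the geometric quotient of the variety U by the involution σ,
  -- with quotient V: it is constant on orbits, a bijection from orbits of
  -- geometric points to geometric points of V, V has the quotient topology
  -- (π is open), and the regular functions on V are the σ-invariant ones
  -- on U.  In the last two fields, D(f) = {f ≠ 0} for forms f are a basis
  -- of the Zariski topology of U, and f/g is a rational function regular
  -- at u; p/q is then regular at π(u) and pulls back to f/g.  (That p/q is
  -- determined by its pullback follows from surjectivity.)
  record IsQuotientByInvolution
    {r s : ℕ} {ms : Vec ℕ r} {ns : Vec ℕ s} {a b e : Level}
    (U : Locus ms a)
    (σ : (L : Extension k) → let open Projective (Extension.K L) in Points ms → Points ms)
    (V : Locus ns b)
    (π : Correspondence ms ns e)
    : Set (lsuc (c ⊔ ℓ) ⊔ a ⊔ b ⊔ e) where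
    field
      stable : ∀ L u → U L u → U L (σ L u)

      total : ∀ L u → U L u → ∃[ v ] V L v × π L u v

      singleValued : ∀ L u v v′ → let open Projective (Extension.K L) in
        U L u → π L u v → π L u v′ → v ∼ v′

      invariant : ∀ L u v → U L u → π L u v → π L (σ L u) v

      fibre : ∀ L u u′ v → let open Projective (Extension.K L) in
        U L u → U L u′ → π L u v → π L u′ v → u ∼ u′ ⊎ σ L u ∼ u′

      surjective : ∀ L → AlgebraicallyClosed (Extension.K L) →
        ∀ v → V L v → ∃[ u ] U L u × π L u v

      open-map : ∀ {δ} (f : Form ms δ) L u v →
        U L u → π L u v → NonzeroAt L f u →
        ∃₂ λ ε (p : Form ns ε) →
          NonzeroAt L p v ×
          (∀ L′ → AlgebraicallyClosed (Extension.K L′) →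
           ∀ v′ → V L′ v′ → NonzeroAt L′ p v′ →
           ∃[ u′ ] U L′ u′ × π L′ u′ v′ × NonzeroAt L′ f u′)

      functions : ∀ {δ} (f g : Form ms δ) →
        (∀ L u → let open Extension L in U L u →
           eval L f u * eval L g (σ L u) ≈ eval L f (σ L u) * eval L g u) →
        ∀ L u v → U L u → π L u v → NonzeroAt L g u →
        ∃[ ε ] Σ[ p ∈ Form ns ε ] Σ[ q ∈ Form ns ε ]
          NonzeroAt L q v ×
          (∀ L′ u′ v′ → let open Extension L′ in
           U L′ u′ → π L′ u′ v′ →
           eval L′ f u′ * eval L′ q v′ ≈ eval L′ g u′ * eval L′ p v′)

------------------------------------------------------------------------
-- The curve E, the map π and the models of the Kummer surface

  module Kummer (d : k.Carrier) where

    module _ (L : Extension k) where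
      open Extension L
      open Projective K
      open RingProperties ring using (-0#≈0#; -‿injective)

      private
        D : Carrier
        D = ι d

        -‿≉0 : ∀ {x} → x ≉ 0# → - x ≉ 0#
        -‿≉0 x≉0 -x≈0 = x≉0 (-‿injective (trans -x≈0 (sym -0#≈0#)))

      OnE : ℙ 3 → Set ℓ
      OnE [ X₀ ∷ X₁ ∷ X₂ ∷ X₃ ∷ [] ∣ _ ] =
        X₀ ² + D * X₃ ² ≈ X₁ ² + X₂ ² × X₀ * X₃ ≈ X₁ * X₂

      -- The gradients of the two defining equations, halved for the
      -- first one as the characteristic is not 2.
      gradient₁ gradient₂ : ℙ 3 → Vec Carrier 4
      gradient₁ [ X₀ ∷ X₁ ∷ X₂ ∷ X₃ ∷ [] ∣ _ ] = X₀ ∷ - X₁ ∷ - X₂ ∷ D * X₃ ∷ []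
      gradient₂ [ X₀ ∷ X₁ ∷ X₂ ∷ X₃ ∷ [] ∣ _ ] = X₃ ∷ - X₂ ∷ - X₁ ∷ X₀ ∷ []

      JacobianOfRank2 : ℙ 3 → Set ℓ
      JacobianOfRank2 P = ∃₂ λ i j →
        lookup (gradient₁ P) i * lookup (gradient₂ P) j ≉
        lookup (gradient₁ P) j * lookup (gradient₂ P) i

      O : ℙ 3
      O = [ 1# ∷ 0# ∷ 1# ∷ 0# ∷ [] ∣ here 1≉0 ]

      neg : ℙ 3 → ℙ 3
      neg [ X₀ ∷ X₁ ∷ X₂ ∷ X₃ ∷ [] ∣ X≠0 ] =
        [ X₀ ∷ - X₁ ∷ X₂ ∷ - X₃ ∷ [] ∣ ≠0 X≠0 ]
        where
        ≠0 : Nonzero (X₀ ∷ X₁ ∷ X₂ ∷ X₃ ∷ []) → Nonzero (X₀ ∷ - X₁ ∷ X₂ ∷ - X₃ ∷ [])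
        ≠0 (here p)                         = here p
        ≠0 (there (here p))                 = there (here (-‿≉0 p))
        ≠0 (there (there (here p)))         = there (there (here p))
        ≠0 (there (there (there (here p)))) = there (there (there (here (-‿≉0 p))))

      -- The diagonal action of -1 on E².
      neg² : Points (3 ∷ 3 ∷ []) → Points (3 ∷ 3 ∷ [])
      neg² (P ∷ Q ∷ []) = neg P ∷ neg Q ∷ []

      -- The tuples defining the quotient map E → 𝒦₁ ≅ ℙ¹.
      κ : ℙ 3 → List (Vec Carrier 2)
      κ [ X₀ ∷ X₁ ∷ X₂ ∷ X₃ ∷ [] ∣ _ ] =
        (X₀ ∷ X₂ ∷ []) List.∷ (X₁ ∷ X₃ ∷ []) List.∷ List.[]

      π₃ : ℙ 3 → ℙ 3 → List (Vec Carrier 2)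
      π₃ [ X₀ ∷ X₁ ∷ X₂ ∷ X₃ ∷ [] ∣ _ ] [ Y₀ ∷ Y₁ ∷ Y₂ ∷ Y₃ ∷ [] ∣ _ ] =
        (X₀ * Y₀ ∷ X₁ * Y₁ ∷ []) List.∷
        (X₂ * Y₀ ∷ X₃ * Y₁ ∷ []) List.∷
        (X₀ * Y₂ ∷ X₁ * Y₃ ∷ []) List.∷
        (X₂ * Y₂ ∷ X₃ * Y₃ ∷ []) List.∷ List.[]

      OnE² : Points (3 ∷ 3 ∷ []) → Set ℓ
      OnE² (P ∷ Q ∷ []) = OnE P × OnE Q

      π-defined : Points (3 ∷ 3 ∷ []) → Set (c ⊔ ℓ)
      π-defined (P ∷ Q ∷ []) = Defined (π₃ P Q)

      U : Points (3 ∷ 3 ∷ []) → Set (c ⊔ ℓ)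
      U u = OnE² u × π-defined u

      π : Points (3 ∷ 3 ∷ []) → Points (1 ∷ 1 ∷ 1 ∷ []) → Set (c ⊔ ℓ)
      π (P ∷ Q ∷ []) (x ∷ y ∷ z ∷ []) =
        x IsValue κ P × y IsValue κ Q × z IsValue π₃ P Q

      -- All tuples of π₃ vanish at the eight geometric points (P, Q) with
      -- P ∈ {X₁ = X₃ = 0} = {(±1:0:1:0)}, Q ∈ {Y₀ = Y₂ = 0} = {(0:±√d:0:1)}
      -- or conversely; these are fixed points of -1.
      Indeterminate : Points (3 ∷ 3 ∷ []) → Set ℓ
      Indeterminate
        ( [ X₀ ∷ X₁ ∷ X₂ ∷ X₃ ∷ [] ∣ _ ]
        ∷ [ Y₀ ∷ Y₁ ∷ Y₂ ∷ Y₃ ∷ [] ∣ _ ] ∷ [] ) =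
        ((X₁ ≈ 0# × X₃ ≈ 0#) × (Y₀ ≈ 0# × Y₂ ≈ 0#)) ⊎
        ((X₀ ≈ 0# × X₂ ≈ 0#) × (Y₁ ≈ 0# × Y₃ ≈ 0#))

      On𝒦₂ : Points (1 ∷ 1 ∷ 1 ∷ []) → Set ℓ
      On𝒦₂
        ( [ x₀ ∷ x₁ ∷ [] ∣ _ ]
        ∷ [ y₀ ∷ y₁ ∷ [] ∣ _ ]
        ∷ [ Z₀ ∷ Z₁ ∷ [] ∣ _ ] ∷ [] ) =
        (x₀ ² - x₁ ²) * (y₀ ² - y₁ ²) * Z₀ ² ≈
        (x₀ ² - D * x₁ ²) * (y₀ ² - D * y₁ ²) * Z₁ ²

      -- The eight lines {x} × {y} × ℙ¹ with x = (±1:1), y = (±√d:1) or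
      -- conversely.  They lie on 𝒦₂ and replace the points of E²/{±1}
      -- where π is indeterminate.
      OnExceptionalLine : Points (1 ∷ 1 ∷ 1 ∷ []) → Set ℓ
      OnExceptionalLine
        ( [ x₀ ∷ x₁ ∷ [] ∣ _ ]
        ∷ [ y₀ ∷ y₁ ∷ [] ∣ _ ] ∷ z ∷ [] ) =
        (x₀ ² ≈ x₁ ² × y₀ ² ≈ D * y₁ ²) ⊎
        (x₀ ² ≈ D * x₁ ² × y₀ ² ≈ y₁ ²)

      V : Points (1 ∷ 1 ∷ 1 ∷ []) → Set ℓ
      V v = On𝒦₂ v × ¬ OnExceptionalLine v

      basePoint : Points (1 ∷ 1 ∷ 1 ∷ [])
      basePoint =
          [ 1# ∷ 1# ∷ [] ∣ here 1≉0 ]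
        ∷ [ 1# ∷ 1# ∷ [] ∣ here 1≉0 ]
        ∷ [ 1# ∷ 0# ∷ [] ∣ here 1≉0 ] ∷ []

      segre : ℙ 1 → ℙ 1 → Vec Carrier 4
      segre [ x₀ ∷ x₁ ∷ [] ∣ _ ] [ y₀ ∷ y₁ ∷ [] ∣ _ ] =
        x₀ * y₀ ∷ x₁ * y₀ ∷ x₀ * y₁ ∷ x₁ * y₁ ∷ []

      OnQuadric : ℙ 3 → Set ℓ
      OnQuadric [ U₀ ∷ U₁ ∷ U₂ ∷ U₃ ∷ [] ∣ _ ] = U₀ * U₃ ≈ U₁ * U₂

      -- The two projections of the quadric inverting the Segre embedding.
      rulings : ℙ 3 → List (Vec Carrier 2) × List (Vec Carrier 2)
      rulings [ U₀ ∷ U₁ ∷ U₂ ∷ U₃ ∷ [] ∣ _ ] =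
        ((U₀ ∷ U₁ ∷ []) List.∷ (U₂ ∷ U₃ ∷ []) List.∷ List.[]) ,
        ((U₀ ∷ U₂ ∷ []) List.∷ (U₁ ∷ U₃ ∷ []) List.∷ List.[])

      SegreEquation : ℙ 3 → ℙ 1 → Set ℓ
      SegreEquation [ U₀ ∷ U₁ ∷ U₂ ∷ U₃ ∷ [] ∣ _ ] [ Z₀ ∷ Z₁ ∷ [] ∣ _ ] =
        (U₀ ² - U₁ ² - U₂ ² + U₃ ²) * Z₀ ² ≈
        (U₀ ² - D * U₁ ² - D * U₂ ² + D ² * U₃ ²) * Z₁ ²

      -- The Segre embedding of (ℙ¹)³: the products Uᵢ Zⱼ.
      segre₃ : Points (1 ∷ 1 ∷ 1 ∷ []) → Vec Carrier 8
      segre₃ (x ∷ y ∷ [ Z₀ ∷ Z₁ ∷ [] ∣ _ ] ∷ []) =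
        Vec.map (_* Z₀) (segre x y) Vec.++ Vec.map (_* Z₁) (segre x y)

      OnSegreThreefold : ℙ 7 → Set ℓ
      OnSegreThreefold
        [ T₀ ∷ T₁ ∷ T₂ ∷ T₃ ∷ T₄ ∷ T₅ ∷ T₆ ∷ T₇ ∷ [] ∣ _ ] =
        T₀ * T₃ ≈ T₁ * T₂ ×
        T₀ * T₅ ≈ T₁ * T₄ ×
        T₀ * T₆ ≈ T₂ * T₄ ×
        T₀ * T₇ ≈ T₃ * T₄ ×
        T₁ * T₆ ≈ T₃ * T₄ ×
        T₁ * T₇ ≈ T₃ * T₅ ×
        T₂ * T₅ ≈ T₃ * T₄ ×
        T₂ * T₇ ≈ T₃ * T₆ ×
        T₄ * T₇ ≈ T₅ * T₆

      projections : ℙ 7 →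
        List (Vec Carrier 2) × List (Vec Carrier 2) × List (Vec Carrier 2)
      projections
        [ T₀ ∷ T₁ ∷ T₂ ∷ T₃ ∷ T₄ ∷ T₅ ∷ T₆ ∷ T₇ ∷ [] ∣ _ ] =
        ((T₀ ∷ T₁ ∷ []) List.∷ (T₂ ∷ T₃ ∷ []) List.∷
         (T₄ ∷ T₅ ∷ []) List.∷ (T₆ ∷ T₇ ∷ []) List.∷ List.[]) ,
        ((T₀ ∷ T₂ ∷ []) List.∷ (T₁ ∷ T₃ ∷ []) List.∷
         (T₄ ∷ T₆ ∷ []) List.∷ (T₅ ∷ T₇ ∷ []) List.∷ List.[]) ,
        ((T₀ ∷ T₄ ∷ []) List.∷ (T₁ ∷ T₅ ∷ []) List.∷
         (T₂ ∷ T₆ ∷ []) List.∷ (T₃ ∷ T₇ ∷ []) List.∷ List.[])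

      QuadraticRelation : ℙ 7 → Set ℓ
      QuadraticRelation
        [ T₀ ∷ T₁ ∷ T₂ ∷ T₃ ∷ T₄ ∷ T₅ ∷ T₆ ∷ T₇ ∷ [] ∣ _ ] =
        T₀ ² - T₁ ² - T₂ ² + T₃ ² ≈
        T₄ ² - D * T₅ ² - D * T₆ ² + D ² * T₇ ²

      toℙ⁷ : Points (3 ∷ 3 ∷ []) → Vec Carrier 8
      toℙ⁷
        ( [ X₀ ∷ X₁ ∷ X₂ ∷ X₃ ∷ [] ∣ _ ]
        ∷ [ Y₀ ∷ Y₁ ∷ Y₂ ∷ Y₃ ∷ [] ∣ _ ] ∷ [] ) =
        X₀ * Y₀ ∷ X₂ * Y₀ ∷ X₀ * Y₂ ∷ X₂ * Y₂ ∷
        X₁ * Y₁ ∷ X₃ * Y₁ ∷ X₁ * Y₃ ∷ X₃ * Y₃ ∷ []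

    -- E is an elliptic curve when it is smooth: a smooth intersection of
    -- two quadrics in ℙ³ is a connected curve of genus 1.
    IsEllipticCurve : Set (lsuc (c ⊔ ℓ))
    IsEllipticCurve = ∀ L P → OnE L P → JacobianOfRank2 L P

{-# OPTIONS --safe #-}

-- The quadric X₀X₃ = X₁X₂ is the image of (s : t), (x₀ : x₁) ↦
-- (s x₀ : t x₀ : s x₁ : t x₁), and E is the curve s² α(x) = t² β(x) on it, where
-- α = x₀² - x₁² and β = x₀² - d x₁² have no common zero as d ≠ 1.  With (s′ : t′)
-- and y for the second factor, -1 is (t , t′) ↦ (- t , - t′), and π₃ = (s s′ : t t′).
-- Multiplying the two equations gives the equation of the Kummer surface; π₃ is
-- undefined when s = t′ = 0 or s′ = t = 0, that is over the exceptional lines.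
--
-- Off these lines the surface is covered by the charts s s′ ≠ 0 and t t′ ≠ 0.
-- In the first one put T = t / s and T′ = t′ / s′: then T² = α(x) / β(x),
-- T′² = α(y) / β(y) and T T′ = Z₁ / Z₀ are functions on the surface and determine
-- (T , T′) up to a common sign.  So every form on ℙ³ × ℙ³ becomes, up to a common
-- denominator, A + B T + C T′ with forms A, B, C on (ℙ¹)³, where A is the invariant
-- part and O = B T + C T′ changes sign under -1.  Openness of π and the description
-- of the invariant functions are read off from A and from the norm A² - O².
module Submission where

open import Algebra.Bundles using (CommutativeRing)
open import Algebra.Morphism.Structures using (module RingMorphisms)
import Algebra.Properties.AbelianGroup as AbelianGroupProperties
import Algebra.Properties.CommutativeSemigroup as CommutativeSemigroupProperties
import Algebra.Properties.Ring as RingProperties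
import Algebra.Properties.Semiring.Exp as Exp
import Algebra.Properties.Semiring.Mult.TCOptimised as Mult
import Algebra.Solver.Ring as RingSolver
open import Algebra.Solver.Ring.AlmostCommutativeRing
  using (fromCommutativeRing; _-Raw-AlmostCommutative⟶_)
open import Data.Bool.Base using (Bool; true; false; if_then_else_; not)
open import Data.Fin.Base using (Fin; zero; suc)
open import Data.Integer.Base as ℤ using (ℤ; +_; -[1+_]; _⊖_; _◃_)
import Data.Integer.Properties as ℤₚ
import Data.List.Relation.Unary.All as ListAll
import Data.List.Relation.Unary.Any as ListAny
open import Data.Maybe.Base using (Maybe; just; nothing)
open import Data.Nat.Base as ℕ using (ℕ; zero; suc)
import Data.Nat.Properties as ℕₚ
open import Data.Product.Base using (_×_; _,_; proj₁; proj₂; ∃-syntax; ∃₂; Σ-syntax)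
open import Data.Sign.Base as Sign using (Sign)
open import Data.Sum.Base as Sum using (_⊎_; inj₁; inj₂; [_,_])
open import Data.Vec.Base as Vec using (Vec; []; _∷_; lookup; replicate; zipWith; _[_]≔_)
open import Data.Vec.Properties using (zipWith-assoc; zipWith-comm)
open import Data.Vec.Relation.Binary.Pointwise.Inductive using (Pointwise; []; _∷_)
open import Data.Vec.Relation.Unary.All using ([]; _∷_)
open import Data.Vec.Relation.Unary.Any as VecAny using (here; there)
open import Function.Base using (_∘_)
open import Function.Bundles using (_⇔_; mk⇔)
open import Level as Level using (Level; _⊔_)
import Relation.Binary.Reasoning.Setoid as SetoidReasoning
open import Relation.Binary.PropositionalEquality as ≡ using (_≡_)
open import Relation.Nullary using (Dec; yes; no; ¬_; contradiction)
open import Relation.Nullary.Decidable using (¬?; decidable-stable)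
open import Defs

-- The forms `p` and `q` asked for by openness and by the description of functions must be found
-- once, over k, and then serve all points over all extensions. So the expansion A + B T + C T′ is
-- computed on the syntax of a form, not on its values: its common denominator `w` is itself a form
-- without zeros on the chart, and multidegrees are tracked because only forms of equal multidegree
-- can be added. A further factor `χ b`, nonzero exactly on chart b, makes both sides of an identity
-- vanish off the chart, so that a formula derived on one chart holds on all of `U`.
--
-- Both A and the norm A² - O² occur because either may vanish at a point where f does not. Up to
-- nonzero factors, f takes the values A + O and A - O at the two points of a fibre. If A ≠ 0, these
-- cannot both be zero, since their sum is 2 A and the characteristic is not 2. If A = 0 but f ≠ 0
-- at a point, then O ≠ 0 and the norm is - O², and a nonzero norm means that f vanishes at neither
-- point of the fibre.

-- Polynomial identities with integer coefficients in a commutative ring.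

module IntegerSolver {c ℓ} (R : CommutativeRing c ℓ) where
  open CommutativeRing R hiding (zero)
  open RingProperties ring
  open AbelianGroupProperties +-abelianGroup using (⁻¹-∙-comm)
  open Mult semiring using (×-homo-+; ×1-homo-*; 1+×) renaming (_×_ to _∙_)
  open SetoidReasoning setoid

  private
    -- Coefficients are integers because their equality test computes on literals, whereas equality
    -- in an abstract field does not reduce; cancellation in the solver's normal forms depends on
    -- this test.
    ⟦_⟧ : ℤ → Carrier
    ⟦ + n ⟧      = n ∙ 1#
    ⟦ -[1+ n ] ⟧ = - (suc n ∙ 1#)

    neg-homo : ∀ i → ⟦ ℤ.- i ⟧ ≈ - ⟦ i ⟧
    neg-homo (+ zero)   = sym -0#≈0#
    neg-homo (+ suc n)  = refl
    neg-homo (-[1+ n ]) = sym (-‿involutive _)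

    cancel-1 : ∀ x y → (1# + x) - (1# + y) ≈ x - y
    cancel-1 x y = begin
      (1# + x) - (1# + y)     ≈⟨ +-congˡ (sym (⁻¹-∙-comm 1# y)) ⟩
      (1# + x) + (- 1# - y)   ≈⟨ +-congʳ (+-comm 1# x) ⟩
      (x + 1#) + (- 1# - y)   ≈⟨ +-assoc x 1# _ ⟩
      x + (1# + (- 1# - y))   ≈⟨ +-congˡ (sym (+-assoc 1# _ _)) ⟩
      x + ((1# - 1#) - y)     ≈⟨ +-congˡ (+-congʳ (-‿inverseʳ 1#)) ⟩
      x + (0# - y)            ≈⟨ +-congˡ (+-identityˡ _) ⟩
      x - y                   ∎

    ⊖-homo : ∀ m n → ⟦ m ⊖ n ⟧ ≈ m ∙ 1# - n ∙ 1#
    ⊖-homo zero    zero    = sym (-‿inverseʳ 0#)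
    ⊖-homo zero    (suc n) = sym (+-identityˡ _)
    ⊖-homo (suc m) zero    = sym (trans (+-congˡ -0#≈0#) (+-identityʳ _))
    ⊖-homo (suc m) (suc n) = begin
      ⟦ suc m ⊖ suc n ⟧                ≡⟨ ≡.cong ⟦_⟧ (ℤₚ.[1+m]⊖[1+n]≡m⊖n m n) ⟩
      ⟦ m ⊖ n ⟧                        ≈⟨ ⊖-homo m n ⟩
      m ∙ 1# - n ∙ 1#                  ≈⟨ sym (cancel-1 _ _) ⟩
      (1# + m ∙ 1#) - (1# + n ∙ 1#)    ≈⟨ +-cong (sym (1+× m 1#)) (-‿cong (sym (1+× n 1#))) ⟩
      suc m ∙ 1# - suc n ∙ 1#          ∎

    +-homo : ∀ i j → ⟦ i ℤ.+ j ⟧ ≈ ⟦ i ⟧ + ⟦ j ⟧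
    +-homo (+ m)    (+ n)    = ×-homo-+ 1# m n
    +-homo (+ m)    -[1+ n ] = ⊖-homo m (suc n)
    +-homo -[1+ m ] (+ n)    = trans (⊖-homo n (suc m)) (+-comm _ _)
    +-homo -[1+ m ] -[1+ n ] = begin
      - (suc (suc (m ℕ.+ n)) ∙ 1#)     ≡⟨ ≡.cong (λ l → - (suc l ∙ 1#)) (ℕₚ.+-suc m n) ⟨
      - ((suc m ℕ.+ suc n) ∙ 1#)       ≈⟨ -‿cong (×-homo-+ 1# (suc m) (suc n)) ⟩
      - (suc m ∙ 1# + suc n ∙ 1#)      ≈⟨ sym (⁻¹-∙-comm _ _) ⟩
      - (suc m ∙ 1#) - (suc n ∙ 1#)    ∎

    signed : Sign → Carrier → Carrier
    signed Sign.+ x = x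
    signed Sign.- x = - x

    ◃-homo : ∀ s n → ⟦ s ◃ n ⟧ ≈ signed s (n ∙ 1#)
    ◃-homo Sign.+ zero    = refl
    ◃-homo Sign.- zero    = sym -0#≈0#
    ◃-homo Sign.+ (suc n) = refl
    ◃-homo Sign.- (suc n) = refl

    *-homo : ∀ i j → ⟦ i ℤ.* j ⟧ ≈ ⟦ i ⟧ * ⟦ j ⟧
    *-homo (+ m)    (+ n)    = trans (◃-homo Sign.+ (m ℕ.* n)) (×1-homo-* m n)
    *-homo (+ m)    -[1+ n ] = begin
      ⟦ Sign.- ◃ m ℕ.* suc n ⟧        ≈⟨ ◃-homo Sign.- (m ℕ.* suc n) ⟩
      - ((m ℕ.* suc n) ∙ 1#)          ≈⟨ -‿cong (×1-homo-* m (suc n)) ⟩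
      - ((m ∙ 1#) * (suc n ∙ 1#))     ≈⟨ -‿distribʳ-* _ _ ⟩
      (m ∙ 1#) * - (suc n ∙ 1#)       ∎
    *-homo -[1+ m ] (+ n)    = begin
      ⟦ Sign.- ◃ suc m ℕ.* n ⟧        ≈⟨ ◃-homo Sign.- (suc m ℕ.* n) ⟩
      - ((suc m ℕ.* n) ∙ 1#)          ≈⟨ -‿cong (×1-homo-* (suc m) n) ⟩
      - ((suc m ∙ 1#) * (n ∙ 1#))     ≈⟨ -‿distribˡ-* _ _ ⟩
      - (suc m ∙ 1#) * (n ∙ 1#)       ∎
    *-homo -[1+ m ] -[1+ n ] = begin
      (suc m ℕ.* suc n) ∙ 1#               ≈⟨ ×1-homo-* (suc m) (suc n) ⟩
      (suc m ∙ 1#) * (suc n ∙ 1#)          ≈⟨ sym (-‿involutive _) ⟩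
      - - ((suc m ∙ 1#) * (suc n ∙ 1#))    ≈⟨ -‿cong (-‿distribˡ-* _ _) ⟩
      - (- (suc m ∙ 1#) * (suc n ∙ 1#))    ≈⟨ -‿distribʳ-* _ _ ⟩
      - (suc m ∙ 1#) * - (suc n ∙ 1#)      ∎

    morphism : ℤ.+-*-rawRing -Raw-AlmostCommutative⟶ fromCommutativeRing R
    morphism = record
      { ⟦_⟧    = ⟦_⟧
      ; +-homo = +-homo
      ; *-homo = *-homo
      ; -‿homo = neg-homo
      ; 0-homo = refl
      ; 1-homo = refl
      }

    _coeff≟_ : ∀ i j → Maybe (⟦ i ⟧ ≈ ⟦ j ⟧)
    i coeff≟ j with i ℤₚ.≟ j
    ... | yes i≡j = just (reflexive (≡.cong ⟦_⟧ i≡j))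
    ... | no  _   = nothing

  open RingSolver ℤ.+-*-rawRing (fromCommutativeRing R) morphism _coeff≟_ public

-- Arithmetic in a discrete field.

module FieldProperties {c ℓ} (K : Field c ℓ) where
  open Field K hiding (zero)
  open RingProperties ring public
    using (-‿involutive; -‿injective; -0#≈0#; +-cancelʳ)
  open IntegerSolver commutativeRing public
    using (solve; _:=_; _:+_; _:*_; :-_; _:-_; con)
  open SetoidReasoning setoid

  _⁻¹[_] : ∀ x → x ≉ 0# → Carrier
  x ⁻¹[ x≉0 ] = proj₁ (inverse x≉0)

  *-inverseˡ : ∀ {x} (x≉0 : x ≉ 0#) → x ⁻¹[ x≉0 ] * x ≈ 1#
  *-inverseˡ x≉0 = proj₁ (proj₂ (inverse x≉0))

  *-cancelˡ : ∀ {x y z} → x ≉ 0# → x * y ≈ x * z → y ≈ z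
  *-cancelˡ {x} {y} {z} x≉0 xy≈xz = begin
    y                      ≈⟨ unit y ⟩
    x ⁻¹[ x≉0 ] * (x * y)  ≈⟨ *-congˡ xy≈xz ⟩
    x ⁻¹[ x≉0 ] * (x * z)  ≈⟨ unit z ⟨
    z                      ∎
    where
    unit : ∀ w → w ≈ x ⁻¹[ x≉0 ] * (x * w)
    unit w = begin
      w                      ≈⟨ *-identityˡ w ⟨
      1# * w                 ≈⟨ *-congʳ (*-inverseˡ x≉0) ⟨
      x ⁻¹[ x≉0 ] * x * w    ≈⟨ *-assoc _ _ _ ⟩
      x ⁻¹[ x≉0 ] * (x * w)  ∎

  *-≉0 : ∀ {x y} → x ≉ 0# → y ≉ 0# → x * y ≉ 0#
  *-≉0 x≉0 y≉0 xy≈0 = y≉0 (*-cancelˡ x≉0 (trans xy≈0 (sym (zeroʳ _))))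

  *-zero-product : ∀ {x y} → x * y ≈ 0# → x ≈ 0# ⊎ y ≈ 0#
  *-zero-product {x} xy≈0 with x ≟ 0#
  ... | yes x≈0 = inj₁ x≈0
  ... | no  x≉0 = inj₂ (*-cancelˡ x≉0 (trans xy≈0 (sym (zeroʳ x))))

  ²-zero : ∀ {x} → x * x ≈ 0# → x ≈ 0#
  ²-zero xx≈0 with *-zero-product xx≈0
  ... | inj₁ x≈0 = x≈0
  ... | inj₂ x≈0 = x≈0

  ⁻¹-≉0 : ∀ {x} (x≉0 : x ≉ 0#) → x ⁻¹[ x≉0 ] ≉ 0#
  ⁻¹-≉0 {x} x≉0 x⁻¹≈0 = 1≉0 (begin
    1#               ≈⟨ *-inverseˡ x≉0 ⟨
    x ⁻¹[ x≉0 ] * x  ≈⟨ *-congʳ x⁻¹≈0 ⟩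
    0# * x           ≈⟨ zeroˡ x ⟩
    0#               ∎)

  ≉0-resp : ∀ {x y} → x ≈ y → x ≉ 0# → y ≉ 0#
  ≉0-resp x≈y x≉0 y≈0 = x≉0 (trans x≈y y≈0)

  *-≈0ˡ : ∀ {x} y → x ≈ 0# → x * y ≈ 0#
  *-≈0ˡ y x≈0 = trans (*-congʳ x≈0) (zeroˡ y)

  *-≈0ʳ : ∀ x {y} → y ≈ 0# → x * y ≈ 0#
  *-≈0ʳ x y≈0 = trans (*-congˡ y≈0) (zeroʳ x)

  *-≉0⁻ˡ : ∀ {x y} → x * y ≉ 0# → x ≉ 0#
  *-≉0⁻ˡ xy≉0 x≈0 = xy≉0 (*-≈0ˡ _ x≈0)

  *-≉0⁻ʳ : ∀ {x y} → x * y ≉ 0# → y ≉ 0#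
  *-≉0⁻ʳ xy≉0 y≈0 = xy≉0 (*-≈0ʳ _ y≈0)

  -‿≉0 : ∀ {x} → x ≉ 0# → - x ≉ 0#
  -‿≉0 x≉0 -x≈0 = x≉0 (-‿injective (trans -x≈0 (sym -0#≈0#)))

  quotient : ∀ x {y} → y ≉ 0# → ∃[ q ] y * q ≈ x
  quotient x {y} y≉0 = y ⁻¹[ y≉0 ] * x , (begin
    y * (y ⁻¹[ y≉0 ] * x)  ≈⟨ solve 3 (λ a b c → a :* (b :* c) := b :* a :* c) refl _ _ _ ⟩
    y ⁻¹[ y≉0 ] * y * x    ≈⟨ *-congʳ (*-inverseˡ y≉0) ⟩
    1# * x                 ≈⟨ *-identityˡ x ⟩
    x                      ∎)

  -- With s ≈ t a combination of hypotheses, the second argument is an identity of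
  -- polynomials, which the solver proves.
  modulo : ∀ {e f s t} → s ≈ t → e + t ≈ f + s → e ≈ f
  modulo {e} {f} {s} {t} s≈t e+t≈f+s =
    +-cancelʳ t e f (trans e+t≈f+s (+-congˡ s≈t))

  ²-injective : ∀ {x y} → x * x ≈ y * y → x ≈ y ⊎ x ≈ - y
  ²-injective {x} {y} xx≈yy with *-zero-product (begin
    (x - y) * (x + y)  ≈⟨ modulo xx≈yy (solve 2 (λ x y →
                            (x :- y) :* (x :+ y) :+ y :* y := con (+ 0) :+ x :* x) refl x y) ⟩
    0#                 ∎)
  ... | inj₁ x-y≈0 = inj₁ (modulo x-y≈0 (solve 2 (λ x y →
          x :+ con (+ 0) := y :+ (x :- y)) refl x y))
  ... | inj₂ x+y≈0 = inj₂ (modulo x+y≈0 (solve 2 (λ x y →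
          x :+ con (+ 0) := :- y :+ (x :+ y)) refl x y))

  sqrt : AlgebraicallyClosed K → ∀ a → ∃[ x ] x * x ≈ a
  -- The degree is one more than the first argument of `closed`: this is the monic polynomial x² + 0
  -- x - a. The long right-hand side below is its unfolded power sum.
  sqrt closed a with closed 1 (λ { zero → - a ; (suc _) → 0# })
  ... | x , root = x , modulo root (solve 2 (λ x a →
          x :* x :+ con (+ 0) :=
          a :+ (x :* (x :* con (+ 1)) :+ (:- a :* con (+ 1) :+ (con (+ 0) :* (x :* con (+ 1)) :+ con (+ 0))))) refl x a)

-- Extensions of the base field.

module ExtensionProperties {c ℓ} {k : Field c ℓ} (L : Extension k) where
  private module k = Field k
  open Extension L hiding (zero)
  open FieldProperties K
  open RingMorphisms k.rawRing rawRing using (module IsRingHomomorphism)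
  open IsRingHomomorphism isRingHomomorphism public
    using () renaming (⟦⟧-cong to ι-cong; +-homo to ι-+; *-homo to ι-*;
                       -‿homo to ι-neg; 0#-homo to ι-0; 1#-homo to ι-1)

  -- A ring homomorphism sends units to units: ι (x⁻¹) ι (x) = 1.
  ι-≉0 : ∀ {x} → x k.≉ k.0# → ι x ≉ 0#
  ι-≉0 {x} x≉0 = *-≉0⁻ʳ (≉0-resp
    (trans (sym ι-1) (trans (ι-cong (k.sym (proj₁ (proj₂ (k.inverse x≉0))))) (ι-* _ _))) 1≉0)

module Arithmetic {c ℓ} {k : Field c ℓ} (L : Extension k) where
  open Extension L hiding (zero) public
  open FieldProperties K public
  open ExtensionProperties L public

-- Proportional tuples, values of rational maps, matrices of rank one.

module ProjectiveProperties {c ℓ} (K : Field c ℓ) where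
  open Field K hiding (zero)
  open FieldProperties K
  open Projective K
  open SetoidReasoning setoid

  infix 4 _≋_
  infixl 7 _·_
  infix 9 _!_

  _≋_ : ∀ {n} → Vec Carrier n → Vec Carrier n → Set _
  _≋_ = Pointwise _≈_

  _·_ : ∀ {n} → Carrier → Vec Carrier n → Vec Carrier n
  a · v = Vec.map (a *_) v

  _!_ : ∀ {n} → ℙ n → Fin (ℕ.suc n) → Carrier
  P ! i = lookup (coords P) i

  lookup-≋ : ∀ {n} {v w : Vec Carrier n} → v ≋ w → ∀ i → lookup v i ≈ lookup w i
  lookup-≋ (p ∷ _)  zero    = p
  lookup-≋ (_ ∷ ps) (suc i) = lookup-≋ ps i

  ≋-tabulate : ∀ {n} {v w : Vec Carrier n} → (∀ i → lookup v i ≈ lookup w i) → v ≋ w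
  ≋-tabulate {v = []}    {[]}    eq = []
  ≋-tabulate {v = _ ∷ _} {_ ∷ _} eq = eq zero ∷ ≋-tabulate (eq ∘ suc)

  lookup-· : ∀ {n} a (v : Vec Carrier n) i → lookup (a · v) i ≈ a * lookup v i
  lookup-· a (_ ∷ _) zero    = refl
  lookup-· a (_ ∷ v) (suc i) = lookup-· a v i

  nonzero? : ∀ {n} (v : Vec Carrier n) → Dec (Nonzero v)
  nonzero? = VecAny.any? (λ x → ¬? (x ≟ 0#))

  ¬nonzero : ∀ {n} {v : Vec Carrier n} → ¬ Nonzero v → ∀ i → lookup v i ≈ 0#
  ¬nonzero {v = x ∷ _} v≈0 zero    = decidable-stable (x ≟ 0#) (v≈0 ∘ here)
  ¬nonzero {v = _ ∷ _} v≈0 (suc i) = ¬nonzero (v≈0 ∘ there) i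

  nonzero-index : ∀ {n} {v : Vec Carrier n} → Nonzero v → ∃[ i ] lookup v i ≉ 0#
  nonzero-index (here x≉0) = zero , x≉0
  nonzero-index (there v≠0) with nonzero-index v≠0
  ... | i , vᵢ≉0 = suc i , vᵢ≉0

  scalar-≉0 : ∀ {n a} {v w : Vec Carrier n} → Nonzero w → w ≋ a · v → a ≉ 0#
  scalar-≉0 {a = a} {v} w≠0 w≋av with nonzero-index w≠0
  ... | i , wᵢ≉0 = *-≉0⁻ˡ (≉0-resp (trans (lookup-≋ w≋av i) (lookup-· a v i)) wᵢ≉0)

  ∝-sym : ∀ {n} {v w : Vec Carrier n} → v ∝ w → w ∝ v
  ∝-sym {v = v} {w} (μ , μ≉0 , w≋μv) =
    μ ⁻¹[ μ≉0 ] , ⁻¹-≉0 μ≉0 , ≋-tabulate λ i → *-cancelˡ μ≉0 (begin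
      μ * lookup v i                   ≈⟨ lookup-· μ v i ⟨
      lookup (μ · v) i                 ≈⟨ lookup-≋ w≋μv i ⟨
      lookup w i                       ≈⟨ *-identityˡ _ ⟨
      1# * lookup w i                  ≈⟨ *-congʳ (*-inverseˡ μ≉0) ⟨
      μ ⁻¹[ μ≉0 ] * μ * lookup w i     ≈⟨ solve 3 (λ a b c → a :* b :* c := b :* (a :* c)) refl _ _ _ ⟩
      μ * (μ ⁻¹[ μ≉0 ] * lookup w i)   ≈⟨ *-congˡ (lookup-· _ w i) ⟨
      μ * lookup (μ ⁻¹[ μ≉0 ] · w) i   ∎)

  ∝-trans : ∀ {n} {u v w : Vec Carrier n} → u ∝ v → v ∝ w → u ∝ w
  ∝-trans {u = u} {v} {w} (μ , μ≉0 , v≋μu) (ν , ν≉0 , w≋νv) =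
    ν * μ , *-≉0 ν≉0 μ≉0 , ≋-tabulate λ i → begin
      lookup w i               ≈⟨ lookup-≋ w≋νv i ⟩
      lookup (ν · v) i         ≈⟨ lookup-· ν v i ⟩
      ν * lookup v i           ≈⟨ *-congˡ (trans (lookup-≋ v≋μu i) (lookup-· μ u i)) ⟩
      ν * (μ * lookup u i)     ≈⟨ *-assoc _ _ _ ⟨
      ν * μ * lookup u i       ≈⟨ lookup-· _ u i ⟨
      lookup ((ν * μ) · u) i   ∎

  -- The multiplier may be 0, so vanishing tuples are included. This lets all tuples of a rational
  -- map be treated by one computation, without asking which of them vanish; `isValue` and
  -- `multiples` translate to and from `_IsValue_`.
  Multiple : ∀ {n} → ℙ n → Vec Carrier (ℕ.suc n) → Set _
  Multiple z v = ∃[ a ] v ≋ a · coords z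

  isValue : ∀ {n} {z : ℙ n} {vs} → Defined vs → ListAll.All (Multiple z) vs → z IsValue vs
  isValue def multiples =
    def , ListAll.map (λ { (a , v≋az) v≠0 → ∝-sym (a , scalar-≉0 v≠0 v≋az , v≋az) }) multiples

  multiples : ∀ {n} {z : ℙ n} {vs} → z IsValue vs → ListAll.All (Multiple z) vs
  multiples {z = z} (_ , values) = ListAll.map multiple values
    where
    multiple : ∀ {v} → (Nonzero v → v ∝ coords z) → Multiple z v
    multiple {v} value with nonzero? v
    ... | yes v≠0 with ∝-sym (value v≠0)
    ...   | a , _ , v≋az = a , v≋az
    multiple {v} value | no v≈0 = 0# , ≋-tabulate λ i →
      trans (¬nonzero v≈0 i) (sym (trans (lookup-· 0# (coords z) i) (zeroˡ _)))

  -- The nonzero tuple that witnesses definedness is proportional to both points.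
  value-unique : ∀ {n} {z z′ : ℙ n} {vs} → z IsValue vs → z′ IsValue vs → coords z ∝ coords z′
  value-unique (def , values) (_ , values′) = go def values values′
    where
    go : ∀ {n} {w w′ : Vec Carrier n} {vs} → Defined vs →
         ListAll.All (λ v → Nonzero v → v ∝ w) vs →
         ListAll.All (λ v → Nonzero v → v ∝ w′) vs → w ∝ w′
    go (ListAny.here v≠0)   (p ListAll.∷ _)  (q ListAll.∷ _)  = ∝-trans (∝-sym (p v≠0)) (q v≠0)
    go (ListAny.there rest) (_ ListAll.∷ ps) (_ ListAll.∷ qs) = go rest ps qs

  -- The matrix with rows `v₀` and `v₁` has vanishing 2 × 2 minors, hence rank one, and so is a
  -- column `z` times a row `w`. Every inversion of a Segre embedding below, for ℙ³ as for ℙ⁷, rests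
  -- on this factorisation.
  outer-product : ∀ {n} (v₀ v₁ : Vec Carrier n) →
    (∀ i j → lookup v₀ i * lookup v₁ j ≈ lookup v₀ j * lookup v₁ i) →
    Nonzero v₀ ⊎ Nonzero v₁ →
    ∃[ w ] ∃[ z ] Nonzero w × v₀ ≋ (z ! zero) · w × v₁ ≋ (z ! suc zero) · w
  outer-product v₀ v₁ minors v≠0 with nonzero? v₀
  ... | yes v₀≠0 with nonzero-index v₀≠0
  ...   | i , p with quotient (lookup v₁ i) p
  -- A nonzero entry of `v₀` serves as pivot; `q` is the ratio of the rows in that column, and the
  -- minors through it propagate this ratio to the other columns.
  ...     | q , pq≈ =
    v₀ , [ 1# ∷ q ∷ [] ∣ here 1≉0 ] , v₀≠0 ,
    ≋-tabulate (λ j → sym (trans (lookup-· 1# v₀ j) (*-identityˡ _))) ,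
    ≋-tabulate (λ j → *-cancelˡ p (begin
      lookup v₀ i * lookup v₁ j        ≈⟨ minors i j ⟩
      lookup v₀ j * lookup v₁ i        ≈⟨ *-congˡ pq≈ ⟨
      lookup v₀ j * (lookup v₀ i * q)  ≈⟨ solve 3 (λ a b c → a :* (b :* c) := b :* (c :* a)) refl _ _ _ ⟩
      lookup v₀ i * (q * lookup v₀ j)  ≈⟨ *-congˡ (lookup-· q v₀ j) ⟨
      lookup v₀ i * lookup (q · v₀) j  ∎))
  outer-product v₀ v₁ minors v≠0 | no v₀≈0 =
    v₁ , [ 0# ∷ 1# ∷ [] ∣ there (here 1≉0) ] , v₁≠0 v≠0 ,
    ≋-tabulate (λ j → trans (¬nonzero v₀≈0 j) (sym (trans (lookup-· 0# v₁ j) (zeroˡ _)))) ,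
    ≋-tabulate (λ j → sym (trans (lookup-· 1# v₁ j) (*-identityˡ _)))
    where
    v₁≠0 : Nonzero v₀ ⊎ Nonzero v₁ → Nonzero v₁
    v₁≠0 (inj₁ v₀≠0) = contradiction v₀≠0 v₀≈0
    v₁≠0 (inj₂ v₁≠0) = v₁≠0

-- Ruling coordinates on E and the graph of the projection.

module Parametrisation {c ℓ} {k : Field c ℓ}
  (2≉0 : Field._≉_ k (Field._+_ k (Field.1# k) (Field.1# k)) (Field.0# k))
  (d : Field.Carrier k) (smooth : Kummer.IsEllipticCurve k d) (L : Extension k) where

  open Kummer k d
  open Extension L hiding (zero)
  open FieldProperties K
  open ExtensionProperties L
  open Projective K
  open ProjectiveProperties K
  open SetoidReasoning setoid

  D : Carrier
  D = ι d

  -- For d = 1 the point (1:1:1:1) would lie on E, and both gradients there would be (1, -1, -1, 1),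
  -- contrary to smoothness.
  D≉1 : D ≉ 1#
  D≉1 D≈1 = let i , j , independent = smooth L P on-curve
            in independent (trans (*-congʳ (gradients i)) (trans (*-comm _ _) (*-congʳ (sym (gradients j)))))
    where
    P : ℙ 3
    P = [ 1# ∷ 1# ∷ 1# ∷ 1# ∷ [] ∣ here 1≉0 ]
    on-curve : OnE L P
    on-curve = +-congˡ (trans (*-congʳ D≈1) (*-identityˡ _)) , refl
    gradients : ∀ i → lookup (gradient₁ L P) i ≈ lookup (gradient₂ L P) i
    gradients = lookup-≋ (refl ∷ refl ∷ refl ∷ trans (*-congʳ D≈1) (*-identityˡ _) ∷ [])

  2≉0ᴷ : 1# + 1# ≉ 0#
  2≉0ᴷ = ≉0-resp (trans (ι-+ _ _) (+-cong ι-1 ι-1)) (ι-≉0 2≉0)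

  ≈-‿⇒≈0 : ∀ {x} → x ≈ - x → x ≈ 0#
  ≈-‿⇒≈0 {x} x≈-x = *-cancelˡ 2≉0ᴷ (modulo x≈-x (solve 1 (λ x →
    (con (+ 1) :+ con (+ 1)) :* x :+ :- x := (con (+ 1) :+ con (+ 1)) :* con (+ 0) :+ x) refl x))

  -- E maps to the x-line with fibre s² α(x) = t² β(x), where
  -- X = (s x₀ : t x₀ : s x₁ : t x₁).
  α β : ℙ 1 → Carrier
  α x = (x ! zero) ² - (x ! suc zero) ²
  β x = (x ! zero) ² - D * (x ! suc zero) ²

  -- The difference of α and β is (D - 1) x₁², so a common zero would have x₁ = 0, and then x₀ = 0.
  ¬α≈0≈β : ∀ x → α x ≈ 0# → ¬ β x ≈ 0#
  ¬α≈0≈β [ x₀ ∷ x₁ ∷ [] ∣ x≠0 ] α≈0 β≈0 = zeros x≠0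
    where
    x₁≈0 : x₁ ≈ 0#
    x₁≈0 = ²-zero (*-cancelˡ {D - 1#} (λ e → D≉1 (modulo e (solve 1 (λ a → a :+ con (+ 0) := con (+ 1) :+ (a :- con (+ 1))) refl D)))
      (modulo (+-cong α≈0 (-‿cong β≈0)) (solve 3 (λ x y a →
         (a :- con (+ 1)) :* (y :* y) :+ (con (+ 0) :- con (+ 0)) :=
         (a :- con (+ 1)) :* con (+ 0) :+ ((x :* x :- y :* y) :- (x :* x :- a :* (y :* y)))) refl x₀ x₁ D)))
    x₀≈0 : x₀ ≈ 0#
    x₀≈0 = ²-zero (modulo (+-cong α≈0 (*-cong x₁≈0 x₁≈0)) (solve 2 (λ x y →
         x :* x :+ (con (+ 0) :+ con (+ 0) :* con (+ 0)) :=
         con (+ 0) :+ ((x :* x :- y :* y) :+ y :* y)) refl x₀ x₁))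
    zeros : ¬ Nonzero (x₀ ∷ x₁ ∷ [])
    zeros (here p)         = p x₀≈0
    zeros (there (here p)) = p x₁≈0

  lift : Carrier → Carrier → ℙ 1 → Vec Carrier 4
  lift s t x = s * (x ! zero) ∷ t * (x ! zero) ∷ s * (x ! suc zero) ∷ t * (x ! suc zero) ∷ []

  lift-≈0 : ∀ {s t} x → s ≈ 0# → t ≈ 0# → ∀ {P} → P ≋ lift s t x → ¬ Nonzero P
  lift-≈0 x s≈0 t≈0 (p ∷ _ ∷ _ ∷ _ ∷ []) (here q) = q (trans p (*-≈0ˡ _ s≈0))
  lift-≈0 x s≈0 t≈0 (_ ∷ p ∷ _ ∷ _ ∷ []) (there (here q)) = q (trans p (*-≈0ˡ _ t≈0))
  lift-≈0 x s≈0 t≈0 (_ ∷ _ ∷ p ∷ _ ∷ []) (there (there (here q))) = q (trans p (*-≈0ˡ _ s≈0))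
  lift-≈0 x s≈0 t≈0 (_ ∷ _ ∷ _ ∷ p ∷ []) (there (there (there (here q)))) = q (trans p (*-≈0ˡ _ t≈0))

  quadric-lift : ∀ P → OnQuadric L P → ∃[ x ] ∃[ y ] coords P ≋ segre L x y
  quadric-lift [ U₀ ∷ U₁ ∷ U₂ ∷ U₃ ∷ [] ∣ U≠0 ] U₀U₃≈U₁U₂
    with outer-product (U₀ ∷ U₁ ∷ []) (U₂ ∷ U₃ ∷ []) minors (split U≠0)
    where
    minors : ∀ i j → lookup (U₀ ∷ U₁ ∷ []) i * lookup (U₂ ∷ U₃ ∷ []) j ≈
                     lookup (U₀ ∷ U₁ ∷ []) j * lookup (U₂ ∷ U₃ ∷ []) i
    minors zero       zero       = refl
    minors zero       (suc zero) = U₀U₃≈U₁U₂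
    minors (suc zero) zero       = sym U₀U₃≈U₁U₂
    minors (suc zero) (suc zero) = refl
    split : Nonzero (U₀ ∷ U₁ ∷ U₂ ∷ U₃ ∷ []) → Nonzero (U₀ ∷ U₁ ∷ []) ⊎ Nonzero (U₂ ∷ U₃ ∷ [])
    split (here p)         = inj₁ (here p)
    split (there (here p)) = inj₁ (there (here p))
    split (there (there p)) = inj₂ p
  ... | w₀ ∷ w₁ ∷ [] , [ z₀ ∷ z₁ ∷ [] ∣ z≠0 ] , w≠0 , p₀ ∷ p₁ ∷ [] , p₂ ∷ p₃ ∷ [] =
    [ w₀ ∷ w₁ ∷ [] ∣ w≠0 ] , [ z₀ ∷ z₁ ∷ [] ∣ z≠0 ] ,
    trans p₀ (*-comm _ _) ∷ trans p₁ (*-comm _ _) ∷ trans p₂ (*-comm _ _) ∷ trans p₃ (*-comm _ _) ∷ []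

  curve-lift : ∀ P → OnE L P → ∃[ s ] ∃[ t ] ∃[ x ] coords P ≋ lift s t x
  curve-lift P@([ _ ∷ _ ∷ _ ∷ _ ∷ [] ∣ _ ]) (_ , q) with quadric-lift P q
  -- `segre` of (s : t) and x is `lift s t x` on the nose: one ruling carries t / s, the other is
  -- the image of P in the Kummer curve.
  ... | [ s ∷ t ∷ [] ∣ _ ] , x@([ _ ∷ _ ∷ [] ∣ _ ]) , P≋ = s , t , x , P≋

  curve-equation : ∀ P {s t} x → coords P ≋ lift s t x → OnE L P → s * s * α x ≈ t * t * β x
  curve-equation [ _ ∷ _ ∷ _ ∷ _ ∷ [] ∣ _ ] {s} {t} [ x₀ ∷ x₁ ∷ [] ∣ _ ] (p₀ ∷ p₁ ∷ p₂ ∷ p₃ ∷ []) (e , _) =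
    modulo (trans (sym (+-cong (*-cong p₀ p₀) (*-congˡ (*-cong p₃ p₃))))
             (trans e (+-cong (*-cong p₁ p₁) (*-cong p₂ p₂))))
      (solve 5 (λ s t x y D →
         s :* s :* (x :* x :- y :* y) :+ (t :* x :* (t :* x) :+ s :* y :* (s :* y)) :=
         t :* t :* (x :* x :- D :* (y :* y)) :+ (s :* x :* (s :* x) :+ D :* (t :* y :* (t :* y))))
         refl s t x₀ x₁ D)

  curve-point : ∀ P {s t} x → coords P ≋ lift s t x → s * s * α x ≈ t * t * β x → OnE L P
  curve-point [ X₀ ∷ X₁ ∷ X₂ ∷ X₃ ∷ [] ∣ _ ] {s} {t} [ x₀ ∷ x₁ ∷ [] ∣ _ ] (p₀ ∷ p₁ ∷ p₂ ∷ p₃ ∷ []) e =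
    (begin
      X₀ * X₀ + D * (X₃ * X₃)                                ≈⟨ +-cong (*-cong p₀ p₀) (*-congˡ (*-cong p₃ p₃)) ⟩
      s * x₀ * (s * x₀) + D * (t * x₁ * (t * x₁))            ≈⟨ modulo e (solve 5 (λ s t x y D →
         s :* x :* (s :* x) :+ D :* (t :* y :* (t :* y)) :+ t :* t :* (x :* x :- D :* (y :* y)) :=
         t :* x :* (t :* x) :+ s :* y :* (s :* y) :+ s :* s :* (x :* x :- y :* y)) refl s t x₀ x₁ D) ⟩
      t * x₀ * (t * x₀) + s * x₁ * (s * x₁)                  ≈⟨ +-cong (*-cong p₁ p₁) (*-cong p₂ p₂) ⟨
      X₁ * X₁ + X₂ * X₂                                      ∎) ,
    (begin
      X₀ * X₃               ≈⟨ *-cong p₀ p₃ ⟩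
      s * x₀ * (t * x₁)     ≈⟨ solve 4 (λ s t x y → s :* x :* (t :* y) := t :* x :* (s :* y)) refl s t x₀ x₁ ⟩
      t * x₀ * (s * x₁)     ≈⟨ *-cong p₁ p₂ ⟨
      X₁ * X₂               ∎)

  -- Membership of (P, Q) in `U` and the graph of π, both in ruling coordinates, so that the tuples
  -- of κ and π₃ are needed only in the translations `over` and `over⁻¹`. The factor `ρ` absorbs the
  -- choice of representatives; that it is nonzero expresses that π₃ is defined.
  record Over (P Q : ℙ 3) (x y z : ℙ 1) : Set (c ⊔ ℓ) where
    field
      {s t s′ t′ ρ} : Carrier
      ρ≉0 : ρ ≉ 0#
      P≋  : coords P ≋ lift s t x
      Q≋  : coords Q ≋ lift s′ t′ y
      curveP : s * s * α x ≈ t * t * β x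
      curveQ : s′ * s′ * α y ≈ t′ * t′ * β y
      ss′ : s * s′ ≈ ρ * (z ! zero)
      tt′ : t * t′ ≈ ρ * (z ! suc zero)

  κ-value : ∀ P {s t} x → coords P ≋ lift s t x → x IsValue κ L P
  κ-value [ X₀ ∷ X₁ ∷ X₂ ∷ X₃ ∷ [] ∣ P≠0 ] {s} {t} x@([ _ ∷ _ ∷ [] ∣ _ ]) (p₀ ∷ p₁ ∷ p₂ ∷ p₃ ∷ []) =
    isValue {z = x} (defined P≠0) ((s , p₀ ∷ p₂ ∷ []) ListAll.∷ (t , p₁ ∷ p₃ ∷ []) ListAll.∷ ListAll.[])
    where
    defined : Nonzero (X₀ ∷ X₁ ∷ X₂ ∷ X₃ ∷ []) → Defined (κ L [ X₀ ∷ X₁ ∷ X₂ ∷ X₃ ∷ [] ∣ P≠0 ])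
    defined (here p)                         = ListAny.here (here p)
    defined (there (here p))                 = ListAny.there (ListAny.here (here p))
    defined (there (there (here p)))         = ListAny.here (there (here p))
    defined (there (there (there (here p)))) = ListAny.there (ListAny.here (there (here p)))

  κ-lift : ∀ P x → x IsValue κ L P → ∃[ s ] ∃[ t ] coords P ≋ lift s t x
  κ-lift [ _ ∷ _ ∷ _ ∷ _ ∷ [] ∣ _ ] x@([ _ ∷ _ ∷ [] ∣ _ ]) v with multiples {z = x} v
  ... | (s , p₀ ∷ p₂ ∷ []) ListAll.∷ (t , p₁ ∷ p₃ ∷ []) ListAll.∷ ListAll.[] =
    s , t , p₀ ∷ p₁ ∷ p₂ ∷ p₃ ∷ []

  -- The four tuples of π₃ are the pair (s s′, t t′) multiplied by the four products xᵢ yⱼ, at least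
  -- one of which is nonzero.
  π₃-defined : ∀ P Q {s t s′ t′} x y → coords P ≋ lift s t x → coords Q ≋ lift s′ t′ y →
    s * s′ ≉ 0# ⊎ t * t′ ≉ 0# → Defined (π₃ L P Q)
  π₃-defined P@([ _ ∷ _ ∷ _ ∷ _ ∷ [] ∣ _ ]) Q@([ _ ∷ _ ∷ _ ∷ _ ∷ [] ∣ _ ]) {s} {t} {s′} {t′}
    [ x₀ ∷ x₁ ∷ [] ∣ x≠0 ] [ y₀ ∷ y₁ ∷ [] ∣ y≠0 ]
    (p₀ ∷ p₁ ∷ p₂ ∷ p₃ ∷ []) (q₀ ∷ q₁ ∷ q₂ ∷ q₃ ∷ []) ≉0 = cases x≠0 y≠0
    where
    entry : ∀ {a b x y X Y} → X ≈ a * x → Y ≈ b * y → x ≉ 0# → y ≉ 0# → a * b ≉ 0# → X * Y ≉ 0#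
    entry p q x≉0 y≉0 ab≉0 =
      *-≉0 (≉0-resp (sym p) (*-≉0 (*-≉0⁻ˡ ab≉0) x≉0)) (≉0-resp (sym q) (*-≉0 (*-≉0⁻ʳ ab≉0) y≉0))
    pair : ∀ {x y X X′ Y Y′} → X ≈ s * x → X′ ≈ t * x → Y ≈ s′ * y → Y′ ≈ t′ * y →
           x ≉ 0# → y ≉ 0# → Nonzero (X * Y ∷ X′ * Y′ ∷ [])
    pair p p′ q q′ x≉0 y≉0 =
      [ (λ h → here (entry p q x≉0 y≉0 h)) , (λ h → there (here (entry p′ q′ x≉0 y≉0 h))) ] ≉0
    cases : Nonzero (x₀ ∷ x₁ ∷ []) → Nonzero (y₀ ∷ y₁ ∷ []) → Defined (π₃ L P Q)
    cases (here p)         (here q)         = ListAny.here (pair p₀ p₁ q₀ q₁ p q)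
    cases (there (here p)) (here q)         = ListAny.there (ListAny.here (pair p₂ p₃ q₀ q₁ p q))
    cases (here p)         (there (here q)) = ListAny.there (ListAny.there (ListAny.here (pair p₀ p₁ q₂ q₃ p q)))
    cases (there (here p)) (there (here q)) = ListAny.there (ListAny.there (ListAny.there (ListAny.here (pair p₂ p₃ q₂ q₃ p q))))

  π₃-undefined : ∀ P Q {s t s′ t′} x y → coords P ≋ lift s t x → coords Q ≋ lift s′ t′ y →
    s * s′ ≈ 0# → t * t′ ≈ 0# → ¬ Defined (π₃ L P Q)
  π₃-undefined P@([ _ ∷ _ ∷ _ ∷ _ ∷ [] ∣ _ ]) Q@([ _ ∷ _ ∷ _ ∷ _ ∷ [] ∣ _ ]) {s} {t} {s′} {t′}
    [ x₀ ∷ x₁ ∷ [] ∣ x≠0 ] [ y₀ ∷ y₁ ∷ [] ∣ y≠0 ]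
    (p₀ ∷ p₁ ∷ p₂ ∷ p₃ ∷ []) (q₀ ∷ q₁ ∷ q₂ ∷ q₃ ∷ []) ss′≈0 tt′≈0 = cases
    where
    entry : ∀ {a b x y X Y} → X ≈ a * x → Y ≈ b * y → a * b ≈ 0# → X * Y ≈ 0#
    entry {a} {b} {x} {y} p q ab≈0 = trans (*-cong p q)
      (trans (solve 4 (λ a b x y → a :* x :* (b :* y) := a :* b :* (x :* y)) refl a b x y) (*-≈0ˡ _ ab≈0))
    pair : ∀ {x y X X′ Y Y′} → X ≈ s * x → X′ ≈ t * x → Y ≈ s′ * y → Y′ ≈ t′ * y →
           ¬ Nonzero (X * Y ∷ X′ * Y′ ∷ [])
    pair p p′ q q′ (here h)         = h (entry p q ss′≈0)
    pair p p′ q q′ (there (here h)) = h (entry p′ q′ tt′≈0)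
    cases : ¬ Defined (π₃ L P Q)
    cases (ListAny.here h) = pair p₀ p₁ q₀ q₁ h
    cases (ListAny.there (ListAny.here h)) = pair p₂ p₃ q₀ q₁ h
    cases (ListAny.there (ListAny.there (ListAny.here h))) = pair p₀ p₁ q₂ q₃ h
    cases (ListAny.there (ListAny.there (ListAny.there (ListAny.here h)))) = pair p₂ p₃ q₂ q₃ h

  π₃-multiples : ∀ P Q {s t s′ t′ ρ} x y z → coords P ≋ lift s t x → coords Q ≋ lift s′ t′ y →
    s * s′ ≈ ρ * (z ! zero) → t * t′ ≈ ρ * (z ! suc zero) →
    ListAll.All (Multiple z) (π₃ L P Q)
  π₃-multiples [ _ ∷ _ ∷ _ ∷ _ ∷ [] ∣ _ ] [ _ ∷ _ ∷ _ ∷ _ ∷ [] ∣ _ ] {s} {t} {s′} {t′} {ρ}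
    [ x₀ ∷ x₁ ∷ [] ∣ x≠0 ] [ y₀ ∷ y₁ ∷ [] ∣ y≠0 ] [ z₀ ∷ z₁ ∷ [] ∣ _ ]
    (p₀ ∷ p₁ ∷ p₂ ∷ p₃ ∷ []) (q₀ ∷ q₁ ∷ q₂ ∷ q₃ ∷ []) ss′ tt′ =
    (_ , entry p₀ q₀ ss′ ∷ entry p₁ q₁ tt′ ∷ []) ListAll.∷
    (_ , entry p₂ q₀ ss′ ∷ entry p₃ q₁ tt′ ∷ []) ListAll.∷
    (_ , entry p₀ q₂ ss′ ∷ entry p₁ q₃ tt′ ∷ []) ListAll.∷
    (_ , entry p₂ q₂ ss′ ∷ entry p₃ q₃ tt′ ∷ []) ListAll.∷ ListAll.[]
    where
    entry : ∀ {a b x y X Y z} → X ≈ a * x → Y ≈ b * y → a * b ≈ ρ * z → X * Y ≈ ρ * x * y * z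
    entry {a} {b} {x} {y} {z = z} p q ab≈ρz = trans (*-cong p q)
      (modulo (*-congʳ {x * y} ab≈ρz) (solve 6 (λ a b x y z ρ →
        a :* x :* (b :* y) :+ ρ :* z :* (x :* y) := ρ :* x :* y :* z :+ a :* b :* (x :* y)) refl a b x y z ρ))

  -- The ratio s s′ : t t′ is read off a tuple with xᵢ yⱼ ≠ 0.
  π₃-ratio : ∀ P Q {s t s′ t′} x y z → coords P ≋ lift s t x → coords Q ≋ lift s′ t′ y →
    z IsValue π₃ L P Q →
    ∃[ ρ ] ρ ≉ 0# × s * s′ ≈ ρ * (z ! zero) × t * t′ ≈ ρ * (z ! suc zero)
  π₃-ratio P@([ X₀ ∷ X₁ ∷ X₂ ∷ X₃ ∷ [] ∣ _ ]) Q@([ Y₀ ∷ Y₁ ∷ Y₂ ∷ Y₃ ∷ [] ∣ _ ]) {s} {t} {s′} {t′}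
    x@([ x₀ ∷ x₁ ∷ [] ∣ x≠0 ]) y@([ y₀ ∷ y₁ ∷ [] ∣ y≠0 ]) z@([ z₀ ∷ z₁ ∷ [] ∣ _ ])
    P≋@(p₀ ∷ p₁ ∷ p₂ ∷ p₃ ∷ []) Q≋@(q₀ ∷ q₁ ∷ q₂ ∷ q₃ ∷ []) z≔ =
    finish (cases x≠0 y≠0 (multiples {z = z} z≔))
    where
    Ratio : Set _
    Ratio = ∃[ ρ ] s * s′ ≈ ρ * z₀ × t * t′ ≈ ρ * z₁
    pair : ∀ {x y X X′ Y Y′} → X ≈ s * x → X′ ≈ t * x → Y ≈ s′ * y → Y′ ≈ t′ * y →
           x ≉ 0# → y ≉ 0# → Multiple z (X * Y ∷ X′ * Y′ ∷ []) → Ratio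
    pair {x} {y} p p′ q q′ x≉0 y≉0 (a , e ∷ e′ ∷ []) = ρ , entry p q e , entry p′ q′ e′
      where
      ρ : Carrier
      ρ = proj₁ (quotient a (*-≉0 x≉0 y≉0))
      xyρ≈a : x * y * ρ ≈ a
      xyρ≈a = proj₂ (quotient a (*-≉0 x≉0 y≉0))
      entry : ∀ {u v X Y z} → X ≈ u * x → Y ≈ v * y → X * Y ≈ a * z → u * v ≈ ρ * z
      entry {u} {v} {X} {Y} {z} p q e = *-cancelˡ (*-≉0 x≉0 y≉0) (begin
        x * y * (u * v)    ≈⟨ solve 4 (λ x y u v → x :* y :* (u :* v) := u :* x :* (v :* y)) refl x y u v ⟩
        u * x * (v * y)    ≈⟨ *-cong p q ⟨
        X * Y              ≈⟨ e ⟩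
        a * z              ≈⟨ *-congʳ xyρ≈a ⟨
        x * y * ρ * z      ≈⟨ *-assoc _ _ _ ⟩
        x * y * (ρ * z)    ∎)
    cases : Nonzero (x₀ ∷ x₁ ∷ []) → Nonzero (y₀ ∷ y₁ ∷ []) → ListAll.All (Multiple z) (π₃ L P Q) → Ratio
    cases (here p)         (here q)         (m ListAll.∷ _) = pair p₀ p₁ q₀ q₁ p q m
    cases (there (here p)) (here q)         (_ ListAll.∷ m ListAll.∷ _) = pair p₂ p₃ q₀ q₁ p q m
    cases (here p)         (there (here q)) (_ ListAll.∷ _ ListAll.∷ m ListAll.∷ _) = pair p₀ p₁ q₂ q₃ p q m
    cases (there (here p)) (there (here q)) (_ ListAll.∷ _ ListAll.∷ _ ListAll.∷ m ListAll.∷ _) = pair p₂ p₃ q₂ q₃ p q m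
    finish : Ratio → ∃[ ρ ] ρ ≉ 0# × s * s′ ≈ ρ * z₀ × t * t′ ≈ ρ * z₁
    -- With ρ = 0 both s s′ and t t′ would vanish, and with them all tuples of π₃.
    finish (ρ , e , e′) = ρ , (λ ρ≈0 → π₃-undefined P Q x y P≋ Q≋
      (trans e (*-≈0ˡ _ ρ≈0)) (trans e′ (*-≈0ˡ _ ρ≈0)) (proj₁ z≔)) , e , e′

  over : ∀ P Q x y z → U L (P ∷ Q ∷ []) → π L (P ∷ Q ∷ []) (x ∷ y ∷ z ∷ []) → Over P Q x y z
  over P Q x y z ((onP , onQ) , _) (x≔ , y≔ , z≔) with κ-lift P x x≔ | κ-lift Q y y≔
  ... | _ , _ , P≋ | _ , _ , Q≋ with π₃-ratio P Q x y z P≋ Q≋ z≔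
  ...   | _ , ρ≉0 , ss′ , tt′ = record
    { ρ≉0 = ρ≉0 ; P≋ = P≋ ; Q≋ = Q≋
    ; curveP = curve-equation P x P≋ onP ; curveQ = curve-equation Q y Q≋ onQ
    ; ss′ = ss′ ; tt′ = tt′ }

  over⁻¹ : ∀ P Q x y z → Over P Q x y z → U L (P ∷ Q ∷ []) × π L (P ∷ Q ∷ []) (x ∷ y ∷ z ∷ [])
  over⁻¹ P Q x y z O = ((curve-point P x P≋ curveP , curve-point Q y Q≋ curveQ) , defined) ,
    κ-value P x P≋ , κ-value Q y Q≋ ,
    isValue {z = z} defined (π₃-multiples P Q x y z P≋ Q≋ ss′ tt′)
    where
    open Over O
    ratio-≉0 : ∀ z → s * s′ ≈ ρ * (z ! zero) → t * t′ ≈ ρ * (z ! suc zero) → s * s′ ≉ 0# ⊎ t * t′ ≉ 0#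
    ratio-≉0 [ _ ∷ _ ∷ [] ∣ here p ]         e e′ = inj₁ (≉0-resp (sym e) (*-≉0 ρ≉0 p))
    ratio-≉0 [ _ ∷ _ ∷ [] ∣ there (here p) ] e e′ = inj₂ (≉0-resp (sym e′) (*-≉0 ρ≉0 p))
    defined : Defined (π₃ L P Q)
    defined = π₃-defined P Q x y P≋ Q≋ (ratio-≉0 z ss′ tt′)

  s≈0⇒t≈0 : ∀ {s t a b} → b ≉ 0# → s * s * a ≈ t * t * b → s ≈ 0# → t ≈ 0#
  s≈0⇒t≈0 {s} {t} {a} {b} b≉0 e s≈0 = ²-zero (*-cancelˡ b≉0 (begin
    b * (t * t)   ≈⟨ *-comm _ _ ⟩
    t * t * b     ≈⟨ e ⟨
    s * s * a     ≈⟨ *-≈0ˡ a (*-≈0ˡ s s≈0) ⟩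
    0#            ≈⟨ zeroʳ b ⟨
    b * 0#        ∎))

  OnSurface : (x y z : ℙ 1) → Set ℓ
  OnSurface x y z = α x * α y * (z ! zero) ² ≈ β x * β y * (z ! suc zero) ²

  over-surface : ∀ {P Q x y z} → Over P Q x y z → OnSurface x y z
  over-surface {x = x} {y} {z} O = *-cancelˡ (*-≉0 ρ≉0 ρ≉0) (begin
    ρ * ρ * (α x * α y * (z₀ * z₀))     ≈⟨ solve 4 (λ k a b z → k :* k :* (a :* b :* (z :* z)) := a :* b :* (k :* z :* (k :* z))) refl ρ _ _ _ ⟩
    α x * α y * (ρ * z₀ * (ρ * z₀))     ≈⟨ *-congˡ (*-cong ss′ ss′) ⟨
    α x * α y * (s * s′ * (s * s′))     ≈⟨ regroup _ _ _ _ ⟩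
    (s * s * α x) * (s′ * s′ * α y)     ≈⟨ *-cong curveP curveQ ⟩
    (t * t * β x) * (t′ * t′ * β y)     ≈⟨ regroup _ _ _ _ ⟨
    β x * β y * (t * t′ * (t * t′))     ≈⟨ *-congˡ (*-cong tt′ tt′) ⟩
    β x * β y * (ρ * z₁ * (ρ * z₁))     ≈⟨ solve 4 (λ k a b z → k :* k :* (a :* b :* (z :* z)) := a :* b :* (k :* z :* (k :* z))) refl ρ _ _ _ ⟨
    ρ * ρ * (β x * β y * (z₁ * z₁))     ∎)
    where
    open Over O
    z₀ = z ! zero
    z₁ = z ! suc zero
    regroup : ∀ a b s s′ → a * b * (s * s′ * (s * s′)) ≈ (s * s * a) * (s′ * s′ * b)
    regroup = solve 4 (λ a b s s′ → a :* b :* (s :* s′ :* (s :* s′)) := s :* s :* a :* (s′ :* s′ :* b)) refl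

  Exceptional : (x y : ℙ 1) → Set ℓ
  Exceptional x y = (α x ≈ 0# × β y ≈ 0#) ⊎ (β x ≈ 0# × α y ≈ 0#)

  -- If α (x) = 0, then t² β (x) = 0 with β (x) ≠ 0, so t = 0; in the same way β (y) = 0 forces s′ =
  -- 0. Then s s′ and t t′ both vanish, and the other kind of line is symmetric.
  over-¬exceptional : ∀ {P Q x y z} → Over P Q x y z → ¬ Exceptional x y
  over-¬exceptional {P} {Q} {x} {y} {z} O exc = π₃-undefined P Q x y P≋ Q≋ (ss′≈0 exc) (tt′≈0 exc)
    (proj₂ (proj₁ (over⁻¹ P Q x y z O)))
    where
    open Over O
    double : ∀ {a b s t} → a ≈ 0# → ¬ b ≈ 0# → s * s * a ≈ t * t * b → t ≈ 0#
    double {a} {b} {s} {t} a≈0 b≉0 e = ²-zero (*-cancelˡ b≉0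
      (trans (*-comm _ _) (trans (sym e) (trans (*-≈0ʳ _ a≈0) (sym (zeroʳ b))))))
    ss′≈0 : Exceptional x y → s * s′ ≈ 0#
    ss′≈0 (inj₁ (αx≈0 , βy≈0)) = *-≈0ʳ s (double βy≈0 (λ αy≈0 → ¬α≈0≈β y αy≈0 βy≈0) (sym curveQ))
    ss′≈0 (inj₂ (βx≈0 , αy≈0)) = *-≈0ˡ s′ (double βx≈0 (λ αx≈0 → ¬α≈0≈β x αx≈0 βx≈0) (sym curveP))
    tt′≈0 : Exceptional x y → t * t′ ≈ 0#
    tt′≈0 (inj₁ (αx≈0 , βy≈0)) = *-≈0ˡ t′ (double αx≈0 (¬α≈0≈β x αx≈0) curveP)
    tt′≈0 (inj₂ (βx≈0 , αy≈0)) = *-≈0ʳ t (double αy≈0 (¬α≈0≈β y αy≈0) curveQ)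

  ∸≈0 : ∀ {a b} → a ≈ b → a - b ≈ 0#
  ∸≈0 {a} {b} a≈b = modulo a≈b (solve 2 (λ a b → a :- b :+ b := con (+ 0) :+ a) refl a b)

  ∸≈0⁻¹ : ∀ {a b} → a - b ≈ 0# → a ≈ b
  ∸≈0⁻¹ {a} {b} e = modulo e (solve 2 (λ a b → a :+ con (+ 0) := b :+ (a :- b)) refl a b)

  V⇒ : ∀ x y z → V L (x ∷ y ∷ z ∷ []) → OnSurface x y z × ¬ Exceptional x y
  V⇒ [ _ ∷ _ ∷ [] ∣ _ ] [ _ ∷ _ ∷ [] ∣ _ ] [ _ ∷ _ ∷ [] ∣ _ ] (e , ¬exc) = e ,
    λ { (inj₁ (a , b)) → ¬exc (inj₁ (∸≈0⁻¹ a , ∸≈0⁻¹ b))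
      ; (inj₂ (a , b)) → ¬exc (inj₂ (∸≈0⁻¹ a , ∸≈0⁻¹ b)) }

  ⇒V : ∀ x y z → OnSurface x y z → ¬ Exceptional x y → V L (x ∷ y ∷ z ∷ [])
  ⇒V [ _ ∷ _ ∷ [] ∣ _ ] [ _ ∷ _ ∷ [] ∣ _ ] [ _ ∷ _ ∷ [] ∣ _ ] e ¬exc = e ,
    λ { (inj₁ (a , b)) → ¬exc (inj₁ (∸≈0 a , ∸≈0 b))
      ; (inj₂ (a , b)) → ¬exc (inj₂ (∸≈0 a , ∸≈0 b)) }

-- The two charts and the slopes T, T′ of a point.

module Charts {c ℓ} {k : Field c ℓ}
  (2≉0 : Field._≉_ k (Field._+_ k (Field.1# k) (Field.1# k)) (Field.0# k))
  (d : Field.Carrier k) (smooth : Kummer.IsEllipticCurve k d) (L : Extension k) where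

  open Kummer k d
  open Extension L hiding (zero)
  open FieldProperties K
  open ExtensionProperties L
  open Projective K
  open ProjectiveProperties K
  open SetoidReasoning setoid
  open Parametrisation 2≉0 d smooth L

  -- Chart false is {s s′ ≠ 0}, with T = t / s and T′ = t′ / s′; chart true is
  -- {t t′ ≠ 0}, with T = s / t and T′ = s′ / t′.
  den num : Bool → ℙ 1 → Carrier
  den b x = if b then α x else β x
  num b x = den (not b) x

  zden znum : Bool → ℙ 1 → Carrier
  zden b z = if b then z ! suc zero else z ! zero
  znum b z = zden (not b) z

  InChart : Bool → (x y z : ℙ 1) → Set ℓ
  InChart b x y z = den b x ≉ 0# × den b y ≉ 0# × zden b z ≉ 0#

  -- The first two equations determine T and T′ only up to independent signs; `slopePQ` ties the two
  -- signs together.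
  record Slopes (b : Bool) (x y z : ℙ 1) (T T′ : Carrier) : Set ℓ where
    field
      slopeP  : T * T * den b x ≈ num b x
      slopeQ  : T′ * T′ * den b y ≈ num b y
      slopePQ : T * T′ * zden b z ≈ znum b z

  Slopes-neg : ∀ {b x y z T T′} → Slopes b x y z T T′ → Slopes b x y z (- T) (- T′)
  Slopes-neg S = record
    { slopeP  = trans (*-congʳ (neg*neg _ _)) slopeP
    ; slopeQ  = trans (*-congʳ (neg*neg _ _)) slopeQ
    ; slopePQ = trans (*-congʳ (neg*neg _ _)) slopePQ }
    where
    open Slopes S
    neg*neg : ∀ a b → - a * - b ≈ a * b
    neg*neg = solve 2 (λ a b → :- a :* :- b := a :* b) refl

  lift-nonzero : ∀ {s t} x → s ≉ 0# ⊎ t ≉ 0# → Nonzero (lift s t x)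
  lift-nonzero [ _ ∷ _ ∷ [] ∣ here p ]         (inj₁ q) = here (*-≉0 q p)
  lift-nonzero [ _ ∷ _ ∷ [] ∣ here p ]         (inj₂ q) = there (here (*-≉0 q p))
  lift-nonzero [ _ ∷ _ ∷ [] ∣ there (here p) ] (inj₁ q) = there (there (here (*-≉0 q p)))
  lift-nonzero [ _ ∷ _ ∷ [] ∣ there (here p) ] (inj₂ q) = there (there (there (here (*-≉0 q p))))

  -- The representative with s = 1 in chart false and with t = 1 in chart true, the other ruling
  -- coordinate then being T. It is unrelated to the norm A² - O² of a form.
  norm : Bool → Carrier → ℙ 1 → ℙ 3
  norm false T x = [ lift 1# T x ∣ lift-nonzero x (inj₁ 1≉0) ]
  norm true  T x = [ lift T 1# x ∣ lift-nonzero x (inj₂ 1≉0) ]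

  lift-cong : ∀ {s t s′ t′} x → s ≈ s′ → t ≈ t′ → lift s t x ≋ lift s′ t′ x
  lift-cong x p q = *-congʳ p ∷ *-congʳ q ∷ *-congʳ p ∷ *-congʳ q ∷ []

  norm-cong : ∀ b {T T′} x → T ≈ T′ → coords (norm b T x) ≋ coords (norm b T′ x)
  norm-cong false x e = lift-cong x refl e
  norm-cong true  x e = lift-cong x e refl

  ∝-≋ : ∀ {n} {u v w : Vec Carrier n} → u ∝ v → v ≋ w → u ∝ w
  ∝-≋ (μ , μ≉0 , e) f = μ , μ≉0 , ≋-tabulate λ i → trans (sym (lookup-≋ f i)) (lookup-≋ e i)

  lift-∝ : ∀ {s t a b m} x {P} → m ≉ 0# → P ≋ lift s t x → m * a ≈ s → m * b ≈ t →
           lift a b x ∝ P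
  lift-∝ {s} {t} {a} {b} {m} x m≉0 (p₀ ∷ p₁ ∷ p₂ ∷ p₃ ∷ []) ma≈s mb≈t =
    m , m≉0 , entry p₀ ma≈s ∷ entry p₁ mb≈t ∷ entry p₂ ma≈s ∷ entry p₃ mb≈t ∷ []
    where
    entry : ∀ {X s a y} → X ≈ s * y → m * a ≈ s → X ≈ m * (a * y)
    entry p e = trans p (trans (*-congʳ (sym e)) (*-assoc _ _ _))

  record NormalForm (b : Bool) (P Q : ℙ 3) (x y z : ℙ 1) : Set (c ⊔ ℓ) where
    field
      {T T′}   : Carrier
      slopes   : Slopes b x y z T T′
      P∝       : coords (norm b T x) ∝ coords P
      Q∝       : coords (norm b T′ y) ∝ coords Q
      neg-P∝   : coords (norm b (- T) x) ∝ coords (neg L P)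
      neg-Q∝   : coords (norm b (- T′) y) ∝ coords (neg L Q)

  neg-lift : ∀ P {s t} x → coords P ≋ lift s t x → coords (neg L P) ≋ lift s (- t) x
  neg-lift [ _ ∷ _ ∷ _ ∷ _ ∷ [] ∣ _ ] x (p₀ ∷ p₁ ∷ p₂ ∷ p₃ ∷ []) =
    p₀ ∷ trans (-‿cong p₁) (-‿* _ _) ∷ p₂ ∷ trans (-‿cong p₃) (-‿* _ _) ∷ []
    where
    -‿* : ∀ a b → - (a * b) ≈ - a * b
    -‿* = solve 2 (λ a b → :- (a :* b) := :- a :* b) refl

  norm-∝ : ∀ b P {s t T} x → coords P ≋ lift s t x → let m = if b then t else s in
    m ≉ 0# → m * T ≈ (if b then s else t) →
    coords (norm b T x) ∝ coords P × coords (norm b (- T) x) ∝ coords (neg L P)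
  norm-∝ false P x P≋ s≉0 sT≈t =
    lift-∝ x s≉0 P≋ (*-identityʳ _) sT≈t ,
    lift-∝ x s≉0 (neg-lift P x P≋) (*-identityʳ _)
      (trans (solve 2 (λ s T → s :* :- T := :- (s :* T)) refl _ _) (-‿cong sT≈t))
  norm-∝ true P x P≋ t≉0 tT≈s =
    lift-∝ x t≉0 P≋ tT≈s (*-identityʳ _) ,
    -- Here the coordinate normalised to 1 is t, whose sign `neg` changes; the multiplier is
    -- therefore - t, and it takes - T back to s.
    lift-∝ x (-‿≉0 t≉0) (neg-lift P x P≋)
      (trans (solve 2 (λ t T → :- t :* :- T := t :* T) refl _ _) tT≈s) (*-identityʳ _)

  slope-≈ : ∀ {m n T e f} → m ≉ 0# → m * T ≈ n → n * n * e ≈ m * m * f → T * T * e ≈ f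
  slope-≈ {m} {n} {T} {e} {f} m≉0 mT≈n eq = *-cancelˡ (*-≉0 m≉0 m≉0) (begin
    m * m * (T * T * e)    ≈⟨ solve 3 (λ m T e → m :* m :* (T :* T :* e) := m :* T :* (m :* T) :* e) refl m T e ⟩
    m * T * (m * T) * e    ≈⟨ *-congʳ (*-cong mT≈n mT≈n) ⟩
    n * n * e              ≈⟨ eq ⟩
    m * m * f              ∎)

  slopePQ-≈ : ∀ {m n m′ n′ T T′ ρ e f} → m ≉ 0# → m′ ≉ 0# → m * T ≈ n → m′ * T′ ≈ n′ →
    m * m′ ≈ ρ * e → n * n′ ≈ ρ * f → T * T′ * e ≈ f
  slopePQ-≈ {m} {n} {m′} {n′} {T} {T′} {ρ} {e} {f} m≉0 m′≉0 mT≈n m′T′≈n′ mm′ nn′ =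
    *-cancelˡ (*-≉0 m≉0 m′≉0) (begin
      m * m′ * (T * T′ * e)      ≈⟨ solve 5 (λ m n T S e → m :* n :* (T :* S :* e) := m :* T :* (n :* S) :* e) refl m m′ T T′ e ⟩
      m * T * (m′ * T′) * e      ≈⟨ *-congʳ (*-cong mT≈n m′T′≈n′) ⟩
      n * n′ * e                 ≈⟨ *-congʳ nn′ ⟩
      ρ * f * e                  ≈⟨ solve 3 (λ r f e → r :* f :* e := r :* e :* f) refl ρ f e ⟩
      ρ * e * f                  ≈⟨ *-congʳ mm′ ⟨
      m * m′ * f                 ∎)

  -- In chart false β (x) ≠ 0, so s = 0 would give t² β (x) = 0, hence t = 0, and all coordinates of
  -- P would vanish. Thus one may divide by s, and likewise by s′; chart true exchanges s with t and
  -- β with α.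
  normalForm : ∀ b {P Q x y z} → InChart b x y z → Over P Q x y z → NormalForm b P Q x y z
  normalForm b {P} {Q} {x} {y} {z} (dx≉0 , dy≉0 , dz≉0) O = go b dx≉0 dy≉0
    where
    open Over O
    go : ∀ b → den b x ≉ 0# → den b y ≉ 0# → NormalForm b P Q x y z
    go false βx≉0 βy≉0 = record
      { slopes = record
          { slopeP  = slope-≈ s≉0 (proj₂ T) (sym curveP)
          ; slopeQ  = slope-≈ s′≉0 (proj₂ T′) (sym curveQ)
          ; slopePQ = slopePQ-≈ s≉0 s′≉0 (proj₂ T) (proj₂ T′) ss′ tt′ }
      ; P∝ = proj₁ P∝± ; Q∝ = proj₁ Q∝± ; neg-P∝ = proj₂ P∝± ; neg-Q∝ = proj₂ Q∝± }
      where
      s≉0 : s ≉ 0#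
      s≉0 s≈0 = lift-≈0 x s≈0 (s≈0⇒t≈0 βx≉0 curveP s≈0) P≋ (nonzero P)
      s′≉0 : s′ ≉ 0#
      s′≉0 s′≈0 = lift-≈0 y s′≈0 (s≈0⇒t≈0 βy≉0 curveQ s′≈0) Q≋ (nonzero Q)
      T  = quotient t s≉0
      T′ = quotient t′ s′≉0
      P∝± = norm-∝ false P x P≋ s≉0 (proj₂ T)
      Q∝± = norm-∝ false Q y Q≋ s′≉0 (proj₂ T′)
    go true αx≉0 αy≉0 = record
      { slopes = record
          { slopeP  = slope-≈ t≉0 (proj₂ T) curveP
          ; slopeQ  = slope-≈ t′≉0 (proj₂ T′) curveQ
          ; slopePQ = slopePQ-≈ t≉0 t′≉0 (proj₂ T) (proj₂ T′) tt′ ss′ }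
      ; P∝ = proj₁ P∝± ; Q∝ = proj₁ Q∝± ; neg-P∝ = proj₂ P∝± ; neg-Q∝ = proj₂ Q∝± }
      where
      t≉0 : t ≉ 0#
      t≉0 t≈0 = lift-≈0 x (s≈0⇒t≈0 αx≉0 (sym curveP) t≈0) t≈0 P≋ (nonzero P)
      t′≉0 : t′ ≉ 0#
      t′≉0 t′≈0 = lift-≈0 y (s≈0⇒t≈0 αy≉0 (sym curveQ) t′≈0) t′≈0 Q≋ (nonzero Q)
      T  = quotient s t≉0
      T′ = quotient s′ t′≉0
      P∝± = norm-∝ true P x P≋ t≉0 (proj₂ T)
      Q∝± = norm-∝ true Q y Q≋ t′≉0 (proj₂ T′)

  -- If β (x) and β (y) are nonzero, then z₀ = 0 would force z₁ = 0 by the surface equation, so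
  -- chart false applies. If one of them vanishes, α is nonzero at that point because α and β have
  -- no common zero, and at the other point because (x, y) is not exceptional; then chart true
  -- applies.
  inSomeChart : ∀ x y z → OnSurface x y z → ¬ Exceptional x y → ∃[ b ] InChart b x y z
  inSomeChart x y z@([ z₀ ∷ z₁ ∷ [] ∣ z≠0 ]) surface ¬exc = cases (β x ≟ 0#) (β y ≟ 0#)
    where
    square : ∀ {a b u v} → a ≉ 0# → a * (u * u) ≈ b * (v * v) → v ≈ 0# → u ≈ 0#
    square {b = b} {v = v} a≉0 e v≈0 = ²-zero (*-cancelˡ a≉0
      (trans e (trans (*-≈0ʳ b (*-≈0ˡ v v≈0)) (sym (zeroʳ _)))))
    zeros : z₀ ≈ 0# → ¬ z₁ ≈ 0#
    zeros z₀≈0 z₁≈0 = vanish z≠0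
      where
      vanish : ¬ Nonzero (z₀ ∷ z₁ ∷ [])
      vanish (here p)         = p z₀≈0
      vanish (there (here p)) = p z₁≈0
    αs : α x ≉ 0# → α y ≉ 0# → ∃[ b ] InChart b x y z
    αs p q = true , p , q , λ z₁≈0 → zeros (square (*-≉0 p q) surface z₁≈0) z₁≈0
    cases : Dec (β x ≈ 0#) → Dec (β y ≈ 0#) → ∃[ b ] InChart b x y z
    cases (yes βx≈0) _          = αs (λ αx≈0 → ¬α≈0≈β x αx≈0 βx≈0) (λ αy≈0 → ¬exc (inj₂ (βx≈0 , αy≈0)))
    cases (no _)     (yes βy≈0) = αs (λ αx≈0 → ¬exc (inj₁ (αx≈0 , βy≈0))) (λ αy≈0 → ¬α≈0≈β y αy≈0 βy≈0)
    cases (no p)     (no q)     = false , p , q , λ z₀≈0 → zeros z₀≈0 (square (*-≉0 p q) (sym surface) z₀≈0)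

  over-denominator : ∀ {u v w} (u≉0 : u ≉ 0#) → v * u ≈ w → u * v ≈ u * (u ⁻¹[ u≉0 ] * w)
  over-denominator {u} {v} {w} u≉0 e = begin
    u * v                     ≈⟨ *-comm u v ⟩
    v * u                     ≈⟨ e ⟩
    w                         ≈⟨ *-identityˡ w ⟨
    1# * w                    ≈⟨ *-congʳ (*-inverseˡ u≉0) ⟨
    u ⁻¹[ u≉0 ] * u * w       ≈⟨ solve 3 (λ a b c → a :* b :* c := b :* (a :* c)) refl _ _ _ ⟩
    u * (u ⁻¹[ u≉0 ] * w)     ∎

  over-norm : ∀ b {x y z T T′} → zden b z ≉ 0# → Slopes b x y z T T′ →
              Over (norm b T x) (norm b T′ y) x y z
  over-norm false {x} {y} {z} {T} {T′} z₀≉0 S = record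
    -- Since s s′ = 1 has to equal ρ z₀, the factor is ρ = 1 / z₀; what remains for t t′ is
    -- `slopePQ`.
    { ρ≉0 = ⁻¹-≉0 z₀≉0
    ; P≋ = ≋-tabulate λ _ → refl ; Q≋ = ≋-tabulate λ _ → refl
    ; curveP = trans (solve 1 (λ a → con (+ 1) :* con (+ 1) :* a := a) refl _) (sym slopeP)
    ; curveQ = trans (solve 1 (λ a → con (+ 1) :* con (+ 1) :* a := a) refl _) (sym slopeQ)
    ; ss′ = trans (*-identityˡ _) (sym (*-inverseˡ z₀≉0))
    ; tt′ = *-cancelˡ z₀≉0 (over-denominator z₀≉0 slopePQ) }
    where open Slopes S
  over-norm true {x} {y} {z} {T} {T′} z₁≉0 S = record
    { ρ≉0 = ⁻¹-≉0 z₁≉0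
    ; P≋ = ≋-tabulate λ _ → refl ; Q≋ = ≋-tabulate λ _ → refl
    ; curveP = trans slopeP (solve 1 (λ a → a := con (+ 1) :* con (+ 1) :* a) refl _)
    ; curveQ = trans slopeQ (solve 1 (λ a → a := con (+ 1) :* con (+ 1) :* a) refl _)
    ; ss′ = *-cancelˡ z₁≉0 (over-denominator z₁≉0 slopePQ)
    ; tt′ = trans (*-identityˡ _) (sym (*-inverseˡ z₁≉0)) }
    where open Slopes S

  surface-slopes : ∀ b x y z → OnSurface x y z → 
    num b x * num b y * (zden b z * zden b z) ≈ den b x * den b y * (znum b z * znum b z)
  surface-slopes false x y z e = e
  surface-slopes true  x y z e = sym e

  -- Two independent square roots could have the wrong relative sign. So only T is chosen as a root,
  -- and if it is nonzero, T′ is solved from `slopePQ`. If T = 0, the surface equation gives znum =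
  -- 0, and any root T′ satisfies `slopePQ`.
  solve-slopes : AlgebraicallyClosed K → ∀ b x y z → OnSurface x y z → InChart b x y z →
    ∃[ T ] ∃[ T′ ] Slopes b x y z T T′
  solve-slopes closed b x y z surface (dx≉0 , dy≉0 , dz≉0) = cases (proj₁ T ≟ 0#)
    where
    e = surface-slopes b x y z surface
    root : ∀ {m n} → m ≉ 0# → ∃[ T ] T * T * m ≈ n
    root {m} {n} m≉0 = let q , mq≈n = quotient n m≉0
                           r , rr≈q = sqrt closed q
                       in r , trans (*-congʳ rr≈q) (trans (*-comm q m) mq≈n)
    T = root {den b x} {num b x} dx≉0
    cases : Dec (proj₁ T ≈ 0#) → ∃[ T ] ∃[ T′ ] Slopes b x y z T T′
    cases (yes T≈0) = proj₁ T , proj₁ T′ , record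
      { slopeP  = proj₂ T
      ; slopeQ  = proj₂ T′
      ; slopePQ = trans (*-≈0ˡ _ (*-≈0ˡ _ T≈0)) (sym (²-zero (*-cancelˡ (*-≉0 dx≉0 dy≉0) (begin
          den b x * den b y * (znum b z * znum b z)    ≈⟨ e ⟨
          num b x * num b y * (zden b z * zden b z)    ≈⟨ *-≈0ˡ _ (*-≈0ˡ _ (trans (sym (proj₂ T)) (*-≈0ˡ _ (*-≈0ˡ _ T≈0)))) ⟩
          0#                                           ≈⟨ zeroʳ _ ⟨
          den b x * den b y * 0#                       ∎)))) }
      where
      T′ = root {den b y} {num b y} dy≉0
    cases (no T≉0) = τ , τ′ , record
      { slopeP  = proj₂ T
      -- After multiplication by this factor the claim is the surface equation, as τ zd τ′ is znum
      -- and τ² times the denominator at x is the numerator at x.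
      ; slopeQ  = *-cancelˡ {τ * zd * (τ * zd) * den b x} (*-≉0 (*-≉0 (*-≉0 T≉0 dz≉0) (*-≉0 T≉0 dz≉0)) dx≉0) (begin
          τ * zd * (τ * zd) * den b x * (τ′ * τ′ * den b y)
            ≈⟨ solve 4 (λ a r u v → a :* a :* u :* (r :* r :* v) := u :* v :* (a :* r :* (a :* r))) refl (τ * zd) τ′ _ _ ⟩
          den b x * den b y * (τ * zd * τ′ * (τ * zd * τ′))
            ≈⟨ *-congˡ (*-cong (proj₂ T′) (proj₂ T′)) ⟩
          den b x * den b y * (znum b z * znum b z)
            ≈⟨ e ⟨
          num b x * num b y * (zd * zd)
            ≈⟨ *-congʳ (*-congʳ (proj₂ T)) ⟨
          τ * τ * den b x * num b y * (zd * zd)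
            ≈⟨ solve 4 (λ t z u v → t :* t :* u :* v :* (z :* z) := t :* z :* (t :* z) :* u :* v) refl τ zd _ _ ⟩
          τ * zd * (τ * zd) * den b x * num b y ∎)
      ; slopePQ = trans (solve 3 (λ a r z → a :* r :* z := a :* z :* r) refl τ τ′ zd) (proj₂ T′) }
      where
      zd = zden b z
      τ = proj₁ T
      T′ = quotient (znum b z) (*-≉0 T≉0 dz≉0)
      τ′ = proj₁ T′

  -- Both squares agree, so each slope agrees up to sign. Opposite sign choices would make T₂ T₂′
  -- its own negative, hence 0 in characteristic not 2; then one slope is 0 and its sign is
  -- immaterial.
  slopes-unique : ∀ {b x y z T₁ T₁′ T₂ T₂′} → InChart b x y z →
    Slopes b x y z T₁ T₁′ → Slopes b x y z T₂ T₂′ →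
    (T₁ ≈ T₂ × T₁′ ≈ T₂′) ⊎ (- T₁ ≈ T₂ × - T₁′ ≈ T₂′)
  slopes-unique {b} {x} {y} {z} {T₁} {T₁′} {T₂} {T₂′} (dx≉0 , dy≉0 , dz≉0) S₁ S₂ =
    cases (²-injective (same dx≉0 S₁.slopeP S₂.slopeP)) (²-injective (same dy≉0 S₁.slopeQ S₂.slopeQ))
    where
    module S₁ = Slopes S₁
    module S₂ = Slopes S₂
    same : ∀ {u v e f} → e ≉ 0# → u * e ≈ f → v * e ≈ f → u ≈ v
    same e≉0 p q = *-cancelˡ e≉0 (trans (*-comm _ _) (trans p (trans (sym q) (*-comm _ _))))
    products : T₁ * T₁′ ≈ T₂ * T₂′
    products = same dz≉0 S₁.slopePQ S₂.slopePQ
    flip : ∀ {u v} → u ≈ - v → - u ≈ v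
    flip e = trans (-‿cong e) (-‿involutive _)
    ≈0 : ∀ {u} → u ≈ 0# → - u ≈ u
    ≈0 u≈0 = trans (-‿cong u≈0) (trans -0#≈0# (sym u≈0))
    cases : T₁ ≈ T₂ ⊎ T₁ ≈ - T₂ → T₁′ ≈ T₂′ ⊎ T₁′ ≈ - T₂′ → 
      (T₁ ≈ T₂ × T₁′ ≈ T₂′) ⊎ (- T₁ ≈ T₂ × - T₁′ ≈ T₂′)
    cases (inj₁ p) (inj₁ q) = inj₁ (p , q)
    cases (inj₂ p) (inj₂ q) = inj₂ (flip p , flip q)
    cases (inj₁ p) (inj₂ q) with *-zero-product (≈-‿⇒≈0 (begin
      T₂ * T₂′        ≈⟨ products ⟨
      T₁ * T₁′        ≈⟨ *-cong p q ⟩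
      T₂ * - T₂′      ≈⟨ solve 2 (λ a b → a :* :- b := :- (a :* b)) refl _ _ ⟩
      - (T₂ * T₂′)    ∎))
    ... | inj₁ T₂≈0  = inj₂ (trans (-‿cong p) (≈0 T₂≈0) , flip q)
    ... | inj₂ T₂′≈0 = inj₁ (p , trans q (≈0 T₂′≈0))
    cases (inj₂ p) (inj₁ q) with *-zero-product (≈-‿⇒≈0 (begin
      T₂ * T₂′        ≈⟨ products ⟨
      T₁ * T₁′        ≈⟨ *-cong p q ⟩
      - T₂ * T₂′      ≈⟨ solve 2 (λ a b → :- a :* b := :- (a :* b)) refl _ _ ⟩
      - (T₂ * T₂′)    ∎))
    ... | inj₁ T₂≈0  = inj₁ (trans p (≈0 T₂≈0) , q)
    ... | inj₂ T₂′≈0 = inj₂ (flip p , trans (-‿cong q) (≈0 T₂′≈0))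

  ∝-via-norm : ∀ b x {T T′} {P P′ : Vec Carrier 4} → T ≈ T′ → coords (norm b T x) ∝ P → coords (norm b T′ x) ∝ P′ → P ∝ P′
  ∝-via-norm b x e p p′ = ∝-trans (∝-≋ (∝-sym p) (norm-cong b x e)) p′

  same-fibre : ∀ {b P Q P′ Q′ x y z} → InChart b x y z →
    NormalForm b P Q x y z → NormalForm b P′ Q′ x y z →
    (coords P ∝ coords P′ × coords Q ∝ coords Q′) ⊎
    (coords (neg L P) ∝ coords P′ × coords (neg L Q) ∝ coords Q′)
  same-fibre {b} {x = x} {y} inChart N N′ with slopes-unique inChart (NormalForm.slopes N) (NormalForm.slopes N′)
  ... | inj₁ (p , q) = inj₁ (∝-via-norm b x p N.P∝ N′.P∝ , ∝-via-norm b y q N.Q∝ N′.Q∝)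
    where
    module N  = NormalForm N
    module N′ = NormalForm N′
  ... | inj₂ (p , q) = inj₂ (∝-via-norm b x p N.neg-P∝ N′.P∝ , ∝-via-norm b y q N.neg-Q∝ N′.Q∝)
    where
    module N  = NormalForm N
    module N′ = NormalForm N′

-- Values of forms on rescaled representatives.

module Homogeneity {c ℓ} {k : Field c ℓ} (L : Extension k) where
  open Extension L hiding (zero)
  open FieldProperties K
  open ExtensionProperties L
  open Projective K
  open ProjectiveProperties K
  open Exp semiring using (_^_; ^-homo-*)
  open SetoidReasoning setoid

  -- The character of the torus of scalars, the product of the μⱼ to the power δⱼ, by which
  -- rescaling acts on forms of multidegree δ.
  weight : ∀ {r} → (Fin r → Carrier) → Vec ℕ r → Carrier
  weight μ []      = 1#
  weight μ (n ∷ δ) = μ zero ^ n * weight (μ ∘ suc) δ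

  weight-0 : ∀ {r} (μ : Fin r → Carrier) → weight μ (replicate r 0) ≈ 1#
  weight-0 {ℕ.zero}  μ = refl
  weight-0 {ℕ.suc r} μ = trans (*-identityˡ _) (weight-0 (μ ∘ suc))

  weight-1 : ∀ {r} (μ : Fin r → Carrier) j → weight μ (replicate r 0 [ j ]≔ 1) ≈ μ j
  weight-1 μ zero    = trans (*-congˡ (weight-0 (μ ∘ suc))) (trans (*-identityʳ _) (*-identityʳ _))
  weight-1 μ (suc j) = trans (*-identityˡ _) (weight-1 (μ ∘ suc) j)

  weight-+ : ∀ {r} (μ : Fin r → Carrier) δ ε → weight μ (zipWith ℕ._+_ δ ε) ≈ weight μ δ * weight μ ε
  weight-+ μ []      []      = sym (*-identityʳ _)
  weight-+ μ (m ∷ δ) (n ∷ ε) = trans (*-cong (^-homo-* (μ zero) m n) (weight-+ (μ ∘ suc) δ ε))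
    (solve 4 (λ a b e f → a :* b :* (e :* f) := a :* e :* (b :* f)) refl _ _ _ _)

  weight-≉0 : ∀ {r} (μ : Fin r → Carrier) δ → (∀ j → μ j ≉ 0#) → weight μ δ ≉ 0#
  weight-≉0 μ []      μ≉0 = 1≉0
  weight-≉0 μ (n ∷ δ) μ≉0 = *-≉0 (power n) (weight-≉0 (μ ∘ suc) δ (μ≉0 ∘ suc))
    where
    power : ∀ n → μ zero ^ n ≉ 0#
    power ℕ.zero    = 1≉0
    power (ℕ.suc n) = *-≉0 (μ≉0 zero) (power n)

  eval-homogeneous : ∀ {r} {ns δ : Vec ℕ r} (f : Form k ns δ) {P P′ : Points ns} (μ : Fin r → Carrier) →
    (∀ j → coords (factor P′ j) ≋ μ j · coords (factor P j)) →
    eval k L f P′ ≈ weight μ δ * eval k L f P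
  eval-homogeneous (con a) μ e = sym (trans (*-congʳ (weight-0 μ)) (*-identityˡ _))
  eval-homogeneous (var j i) {P} μ e =
    trans (lookup-≋ (e j) i) (trans (lookup-· (μ j) (coords (factor P j)) i) (*-congʳ (sym (weight-1 μ j))))
  eval-homogeneous (f ⊕ g) μ e =
    trans (+-cong (eval-homogeneous f μ e) (eval-homogeneous g μ e)) (sym (distribˡ _ _ _))
  eval-homogeneous (_⊗_ {δ} {ε} f g) μ e =
    trans (*-cong (eval-homogeneous f μ e) (eval-homogeneous g μ e))
      (trans (solve 4 (λ a b e f → a :* b :* (e :* f) := a :* e :* (b :* f)) refl _ _ _ _)
        (*-congʳ (sym (weight-+ μ δ ε))))

-- Expansion of forms as A + B T + C T′ on a chart.

module Expansions {c ℓ} {k : Field c ℓ}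
  (2≉0 : Field._≉_ k (Field._+_ k (Field.1# k) (Field.1# k)) (Field.0# k))
  (d : Field.Carrier k) (smooth : Kummer.IsEllipticCurve k d) where

  private
    module k = Field k
    module P = Parametrisation 2≉0 d smooth
    module C = Charts 2≉0 d smooth

  infixl 6 _+ᵥ_
  _+ᵥ_ : ∀ {r} → Vec ℕ r → Vec ℕ r → Vec ℕ r
  _+ᵥ_ = zipWith ℕ._+_

  Form₃ : Vec ℕ 3 → Set c
  Form₃ = Form k (1 ∷ 1 ∷ 1 ∷ [])

  denX numX : Bool → Form₃ (2 ∷ 0 ∷ 0 ∷ [])
  denX b = var zero zero ⊗ var zero zero ⊕
           con (k.- (if b then k.1# else d)) ⊗ (var zero (suc zero) ⊗ var zero (suc zero))
  numX b = denX (not b)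

  denY numY : Bool → Form₃ (0 ∷ 2 ∷ 0 ∷ [])
  denY b = var (suc zero) zero ⊗ var (suc zero) zero ⊕
           con (k.- (if b then k.1# else d)) ⊗ (var (suc zero) (suc zero) ⊗ var (suc zero) (suc zero))
  numY b = denY (not b)

  denZ numZ : Bool → Form₃ (0 ∷ 0 ∷ 1 ∷ [])
  denZ b = var (suc (suc zero)) (if b then suc zero else zero)
  numZ b = denZ (not b)

  -- Its nonvanishing locus is the chart, and it is a common denominator of T², T′² and T T′.
  χ : Bool → Form₃ (2 ∷ 2 ∷ 1 ∷ [])
  χ b = denX b ⊗ denY b ⊗ denZ b

  module _ (L : Extension k) where
    open Extension L hiding (zero)
    open ExtensionProperties L
    open FieldProperties K
    open Projective K
    open ProjectiveProperties K
    open SetoidReasoning setoid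
    open P L using (α; β; D)
    open C L using (den; num; zden; znum; InChart)

    private
      quadratic-1 : ∀ x₀ x₁ → x₀ * x₀ + ι (k.- k.1#) * (x₁ * x₁) ≈ x₀ ² - x₁ ²
      quadratic-1 x₀ x₁ = trans (+-congˡ (*-congʳ (trans (ι-neg _) (-‿cong ι-1))))
        (solve 2 (λ x y → x :* x :+ (:- con (+ 1)) :* (y :* y) := x :* x :- y :* y) refl x₀ x₁)
      quadratic-d : ∀ x₀ x₁ → x₀ * x₀ + ι (k.- d) * (x₁ * x₁) ≈ x₀ ² - D * x₁ ²
      quadratic-d x₀ x₁ = trans (+-congˡ (*-congʳ (ι-neg _)))
        (solve 3 (λ x y D → x :* x :+ (:- D) :* (y :* y) := x :* x :- D :* (y :* y)) refl x₀ x₁ D)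

    eval-denX : ∀ b x y z → eval k L (denX b) (x ∷ y ∷ z ∷ []) ≈ den b x
    eval-denX true  x y z = quadratic-1 _ _
    eval-denX false x y z = quadratic-d _ _

    eval-denY : ∀ b x y z → eval k L (denY b) (x ∷ y ∷ z ∷ []) ≈ den b y
    eval-denY true  x y z = quadratic-1 _ _
    eval-denY false x y z = quadratic-d _ _

    eval-denZ : ∀ b x y z → eval k L (denZ b) (x ∷ y ∷ z ∷ []) ≈ zden b z
    eval-denZ true  x y z = refl
    eval-denZ false x y z = refl

    eval-χ : ∀ b x y z → eval k L (χ b) (x ∷ y ∷ z ∷ []) ≈ den b x * den b y * zden b z
    eval-χ b x y z = *-cong (*-cong (eval-denX b x y z) (eval-denY b x y z)) (eval-denZ b x y z)

    χ-≉0 : ∀ b x y z → InChart b x y z → NonzeroAt k L (χ b) (x ∷ y ∷ z ∷ [])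
    χ-≉0 b x y z (p , q , r) = ≉0-resp (sym (eval-χ b x y z)) (*-≉0 (*-≉0 p q) r)

    χ-≉0⁻ : ∀ b x y z → NonzeroAt k L (χ b) (x ∷ y ∷ z ∷ []) → InChart b x y z
    χ-≉0⁻ b x y z χ≉0 = *-≉0⁻ˡ (*-≉0⁻ˡ h) , *-≉0⁻ʳ {den b x} (*-≉0⁻ˡ h) , *-≉0⁻ʳ h
      where
      h : den b x * den b y * zden b z ≉ 0#
      h = ≉0-resp (eval-χ b x y z) χ≉0

  -- The function A + B T + C T′ on a chart.
  record Triple (η : Vec ℕ 3) : Set c where
    constructor triple
    field
      A B C : Form₃ η
  open Triple

  even odd : ∀ {η} → Triple η → (L : Extension k) → let open Extension L in
    Projective.Points K (1 ∷ 1 ∷ 1 ∷ []) → Carrier → Carrier → Carrier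
  even p L v T T′ = eval k L (A p) v
  odd  p L v T T′ = let open Extension L in eval k L (B p) v * T + eval k L (C p) v * T′

  -- A product of two odd parts involves only T², T′² and T T′, which are functions on the surface;
  -- multiplying by `χ b` turns it into a form. The scalar `r` is 1 for the product of two
  -- expansions and - 1 for the norm.
  oddProduct : ∀ {η θ} → k.Carrier → Bool → Triple η → Triple θ → Form₃ (η +ᵥ θ +ᵥ (2 ∷ 2 ∷ 1 ∷ []))
  oddProduct r b p q =
    B p ⊗ B q ⊗ (con r ⊗ (numX b ⊗ denY b ⊗ denZ b)) ⊕
    C p ⊗ C q ⊗ (con r ⊗ (denX b ⊗ numY b ⊗ denZ b)) ⊕
    (B p ⊗ C q ⊕ C p ⊗ B q) ⊗ (con r ⊗ (denX b ⊗ denY b ⊗ numZ b))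

  evenProduct : ∀ {η θ} → k.Carrier → Bool → Triple η → Triple θ → Form₃ (η +ᵥ θ +ᵥ (2 ∷ 2 ∷ 1 ∷ []))
  evenProduct r b p q = A p ⊗ A q ⊗ χ b ⊕ oddProduct r b p q

  product : ∀ {η θ} → Bool → Triple η → Triple θ → Triple (η +ᵥ θ +ᵥ (2 ∷ 2 ∷ 1 ∷ []))
  product b p q = triple (evenProduct k.1# b p q)
    ((A p ⊗ B q ⊕ B p ⊗ A q) ⊗ χ b) ((A p ⊗ C q ⊕ C p ⊗ A q) ⊗ χ b)

  module _ (L : Extension k) where
    open Extension L hiding (zero)
    open ExtensionProperties L
    open FieldProperties K
    open SetoidReasoning setoid
    open C L using (den; num; zden; znum; Slopes)

    eval-oddProduct : ∀ {η θ} r b (p : Triple η) (q : Triple θ) x y z T T′ → Slopes b x y z T T′ →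
      let v = x ∷ y ∷ z ∷ [] in
      eval k L (oddProduct r b p q) v ≈ ι r * (odd p L v T T′ * odd q L v T T′ * eval k L (χ b) v)
    eval-oddProduct r b p q x y z T T′ S = begin
      B₁ * B₂ * (ι r * _) + C₁ * C₂ * (ι r * _) + (B₁ * C₂ + C₁ * B₂) * (ι r * _)
        ≈⟨ +-cong (+-cong (*-congˡ (*-congˡ nXdYdZ)) (*-congˡ (*-congˡ dXnYdZ))) (*-congˡ (*-congˡ dXdYnZ)) ⟩
      B₁ * B₂ * (ι r * (T * T * dx * dy * dz)) + C₁ * C₂ * (ι r * (dx * (T′ * T′ * dy) * dz)) +
        (B₁ * C₂ + C₁ * B₂) * (ι r * (dx * dy * (T * T′ * dz)))
        ≈⟨ identity B₁ C₁ B₂ C₂ T T′ (ι r) dx dy dz ⟩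
      ι r * ((B₁ * T + C₁ * T′) * (B₂ * T + C₂ * T′) * (dx * dy * dz))
        ≈⟨ *-congˡ (*-congˡ (eval-χ L b x y z)) ⟨
      ι r * ((B₁ * T + C₁ * T′) * (B₂ * T + C₂ * T′) * eval k L (χ b) v) ∎
      where
      open Slopes S
      v  = x ∷ y ∷ z ∷ []
      B₁ = eval k L (B p) v
      C₁ = eval k L (C p) v
      B₂ = eval k L (B q) v
      C₂ = eval k L (C q) v
      dx = den b x
      dy = den b y
      dz = zden b z
      nXdYdZ : eval k L (numX b ⊗ denY b ⊗ denZ b) v ≈ T * T * dx * dy * dz
      nXdYdZ = *-cong (*-cong (trans (eval-denX L (not b) x y z) (sym slopeP)) (eval-denY L b x y z)) (eval-denZ L b x y z)
      dXnYdZ : eval k L (denX b ⊗ numY b ⊗ denZ b) v ≈ dx * (T′ * T′ * dy) * dz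
      dXnYdZ = *-cong (*-cong (eval-denX L b x y z) (trans (eval-denY L (not b) x y z) (sym slopeQ))) (eval-denZ L b x y z)
      dXdYnZ : eval k L (denX b ⊗ denY b ⊗ numZ b) v ≈ dx * dy * (T * T′ * dz)
      dXdYnZ = *-cong (*-cong (eval-denX L b x y z) (eval-denY L b x y z)) (trans (eval-denZ L (not b) x y z) (sym slopePQ))
      identity : ∀ B₁ C₁ B₂ C₂ T T′ r dx dy dz →
        B₁ * B₂ * (r * (T * T * dx * dy * dz)) + C₁ * C₂ * (r * (dx * (T′ * T′ * dy) * dz)) +
        (B₁ * C₂ + C₁ * B₂) * (r * (dx * dy * (T * T′ * dz))) ≈
        r * ((B₁ * T + C₁ * T′) * (B₂ * T + C₂ * T′) * (dx * dy * dz))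
      identity = solve 10 (λ B₁ C₁ B₂ C₂ T T′ r dx dy dz →
        B₁ :* B₂ :* (r :* (T :* T :* dx :* dy :* dz)) :+ C₁ :* C₂ :* (r :* (dx :* (T′ :* T′ :* dy) :* dz)) :+
        (B₁ :* C₂ :+ C₁ :* B₂) :* (r :* (dx :* dy :* (T :* T′ :* dz))) :=
        r :* ((B₁ :* T :+ C₁ :* T′) :* (B₂ :* T :+ C₂ :* T′) :* (dx :* dy :* dz))) refl

    eval-product : ∀ {η θ} b (p : Triple η) (q : Triple θ) x y z T T′ → Slopes b x y z T T′ →
      let v = x ∷ y ∷ z ∷ [] in
      even (product b p q) L v T T′ + odd (product b p q) L v T T′ ≈
      (even p L v T T′ + odd p L v T T′) * (even q L v T T′ + odd q L v T T′) * eval k L (χ b) v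
    eval-product b p q x y z T T′ S = begin
      A₁ * A₂ * X + eval k L (oddProduct k.1# b p q) v +
        ((A₁ * B₂ + B₁ * A₂) * X * T + (A₁ * C₂ + C₁ * A₂) * X * T′)
        ≈⟨ +-congʳ (+-congˡ (trans (eval-oddProduct k.1# b p q x y z T T′ S) (trans (*-congʳ ι-1) (*-identityˡ _)))) ⟩
      A₁ * A₂ * X + (B₁ * T + C₁ * T′) * (B₂ * T + C₂ * T′) * X +
        ((A₁ * B₂ + B₁ * A₂) * X * T + (A₁ * C₂ + C₁ * A₂) * X * T′)
        ≈⟨ solve 9 (λ A₁ B₁ C₁ A₂ B₂ C₂ T T′ X →
             A₁ :* A₂ :* X :+ (B₁ :* T :+ C₁ :* T′) :* (B₂ :* T :+ C₂ :* T′) :* X :+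
             ((A₁ :* B₂ :+ B₁ :* A₂) :* X :* T :+ (A₁ :* C₂ :+ C₁ :* A₂) :* X :* T′) :=
             (A₁ :+ (B₁ :* T :+ C₁ :* T′)) :* (A₂ :+ (B₂ :* T :+ C₂ :* T′)) :* X) refl
             A₁ B₁ C₁ A₂ B₂ C₂ T T′ X ⟩
      (A₁ + (B₁ * T + C₁ * T′)) * (A₂ + (B₂ * T + C₂ * T′)) * X ∎
      where
      v  = x ∷ y ∷ z ∷ []
      A₁ = eval k L (A p) v
      B₁ = eval k L (B p) v
      C₁ = eval k L (C p) v
      A₂ = eval k L (A q) v
      B₂ = eval k L (B q) v
      C₂ = eval k L (C q) v
      X  = eval k L (χ b) v

  -- One `w` and one `p` serve all extensions and all slopes. In particular the pair (- T, - T′) is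
  -- allowed, and there the same data give A - O, the value on the negated normal form.
  Expands : ∀ {δ ε η} → Bool → Form k (3 ∷ 3 ∷ []) δ → Form₃ ε → Triple η → Set (Level.suc (c ⊔ ℓ))
  Expands b f w p = ∀ L x y z T T′ → let open Extension L; v = x ∷ y ∷ z ∷ [] in
    C.Slopes L b x y z T T′ →
    eval k L f (C.norm L b T x ∷ C.norm L b T′ y ∷ []) * eval k L w v ≈ even p L v T T′ + odd p L v T T′

  -- The multidegree of a form after substitution of X = (x₀ : T x₀ : x₁ : T x₁),
  -- where T has degree 0.
  pullDegree : Vec ℕ 2 → Vec ℕ 3
  pullDegree (m ∷ n ∷ []) = m ∷ n ∷ 0 ∷ []

  -- The field `degree` ensures that two forms of equal multidegree, once over a common denominator,
  -- have numerators of equal multidegree; both `_⊕_` and a fraction `p` / `q` require this.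
  record Expansion (b : Bool) {δ} (f : Form k (3 ∷ 3 ∷ []) δ) : Set (Level.suc (c ⊔ ℓ)) where
    field
      {ε η}       : Vec ℕ 3
      w           : Form₃ ε
      p           : Triple η
      degree      : η ≡ pullDegree δ +ᵥ ε
      nonvanishing : ∀ L x y z → C.InChart L b x y z → NonzeroAt k L w (x ∷ y ∷ z ∷ [])
      expands     : Expands b f w p

  scaleʳ : ∀ {η ε} → Triple η → Form₃ ε → Triple (η +ᵥ ε)
  scaleʳ (triple a b c) w = triple (a ⊗ w) (b ⊗ w) (c ⊗ w)

  castTriple : ∀ {η θ} → η ≡ θ → Triple η → Triple θ
  castTriple ≡.refl p = p

  Expands-cast : ∀ {δ ε η θ} b (f : Form k (3 ∷ 3 ∷ []) δ) (w : Form₃ ε) (p : Triple η) (e : η ≡ θ) →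
    Expands b f w p → Expands b f w (castTriple e p)
  Expands-cast b f w p ≡.refl h = h

  Expands-scaleʳ : ∀ {δ ε ε′ η} b (f : Form k (3 ∷ 3 ∷ []) δ) (w : Form₃ ε) (w′ : Form₃ ε′) (p : Triple η) →
    Expands b f w p → Expands b f (w ⊗ w′) (scaleʳ p w′)
  Expands-scaleʳ b f w w′ p h L x y z T T′ S =
    trans (sym (*-assoc _ _ _)) (trans (*-congʳ (h L x y z T T′ S))
      (solve 6 (λ a b c w T T′ → (a :+ (b :* T :+ c :* T′)) :* w := a :* w :+ (b :* w :* T :+ c :* w :* T′))
        refl _ _ _ _ T T′))
    where open Arithmetic L

  Expands-swap : ∀ {δ ε ε′ η} b (f : Form k (3 ∷ 3 ∷ []) δ) (w : Form₃ ε) (w′ : Form₃ ε′) (p : Triple η) →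
    Expands b f (w ⊗ w′) p → Expands b f (w′ ⊗ w) p
  Expands-swap b f w w′ p h L x y z T T′ S = trans (*-congˡ (*-comm _ _)) (h L x y z T T′ S)
    where open Extension L

  record CommonExpansion (b : Bool) {δ} (f g : Form k (3 ∷ 3 ∷ []) δ) : Set (Level.suc (c ⊔ ℓ)) where
    field
      {ε η}       : Vec ℕ 3
      w           : Form₃ ε
      p q         : Triple η
      degree      : η ≡ pullDegree δ +ᵥ ε
      nonvanishing : ∀ L x y z → C.InChart L b x y z → NonzeroAt k L w (x ∷ y ∷ z ∷ [])
      expandsˡ    : Expands b f w p
      expandsʳ    : Expands b g w q

  -- Cross-multiplication of the denominators. The two resulting multidegrees agree only after
  -- reassociating and commuting sums, hence the cast along `same`.
  commonExpansion : ∀ {b δ} {f g : Form k (3 ∷ 3 ∷ []) δ} → Expansion b f → Expansion b g → CommonExpansion b f g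
  commonExpansion {b} {δ} {f} {g} F G = record
    { w            = F.w ⊗ G.w
    ; p            = scaleʳ F.p G.w
    ; q            = castTriple same (scaleʳ G.p F.w)
    ; degree       = ≡.trans (≡.cong (_+ᵥ G.ε) F.degree) (assoc (pullDegree δ) F.ε G.ε)
    ; nonvanishing = λ L x y z h → FieldProperties.*-≉0 (Extension.K L) (F.nonvanishing L x y z h) (G.nonvanishing L x y z h)
    ; expandsˡ     = Expands-scaleʳ b f F.w G.w F.p F.expands
    ; expandsʳ     = Expands-cast b g (F.w ⊗ G.w) (scaleʳ G.p F.w) same
        (Expands-swap b g G.w F.w (scaleʳ G.p F.w) (Expands-scaleʳ b g G.w F.w G.p G.expands)) }
    where
    module F = Expansion F
    module G = Expansion G
    assoc : (x y z : Vec ℕ 3) → x +ᵥ y +ᵥ z ≡ x +ᵥ (y +ᵥ z)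
    assoc = zipWith-assoc ℕₚ.+-assoc
    same : G.η +ᵥ F.ε ≡ F.η +ᵥ G.ε
    same = ≡.trans (≡.cong (_+ᵥ F.ε) G.degree) (≡.trans (assoc (pullDegree δ) G.ε F.ε)
      (≡.trans (≡.cong (pullDegree δ +ᵥ_) (zipWith-comm ℕₚ.+-comm G.ε F.ε))
      (≡.trans (≡.sym (assoc (pullDegree δ) F.ε G.ε)) (≡.cong (_+ᵥ G.ε) (≡.sym F.degree)))))

  expand-⊕ : ∀ {b δ} (f g : Form k (3 ∷ 3 ∷ []) δ) → Expansion b f → Expansion b g → Expansion b (f ⊕ g)
  expand-⊕ f g F G = record
    { w = w ; p = triple (A p ⊕ A q) (B p ⊕ B q) (C p ⊕ C q) ; degree = degree ; nonvanishing = nonvanishing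
    ; expands = λ L x y z T T′ S → let open Arithmetic L in
        trans (distribʳ _ _ _) (trans (+-cong (expandsˡ L x y z T T′ S) (expandsʳ L x y z T T′ S))
          (solve 8 (λ a b c a′ b′ c′ T T′ →
             a :+ (b :* T :+ c :* T′) :+ (a′ :+ (b′ :* T :+ c′ :* T′)) :=
             a :+ a′ :+ ((b :+ b′) :* T :+ (c :+ c′) :* T′)) refl _ _ _ _ _ _ T T′)) }
    where open CommonExpansion (commonExpansion F G)

  expand-⊗ : ∀ {b δ δ′} (f : Form k (3 ∷ 3 ∷ []) δ) (g : Form k (3 ∷ 3 ∷ []) δ′) →
    Expansion b f → Expansion b g → Expansion b (f ⊗ g)
  expand-⊗ {b} {δ} {δ′} f g F G = record
    -- The additional factor `χ b` clears the denominators that T², T′² and T T′ introduce.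
    { w = F.w ⊗ G.w ⊗ χ b ; p = product b F.p G.p
    ; degree = ≡.trans (≡.cong₂ (λ η θ → η +ᵥ θ +ᵥ (2 ∷ 2 ∷ 1 ∷ [])) F.degree G.degree) (degrees δ δ′ F.ε G.ε)
    ; nonvanishing = λ L x y z h → let open FieldProperties (Extension.K L) in
        *-≉0 (*-≉0 (F.nonvanishing L x y z h) (G.nonvanishing L x y z h)) (χ-≉0 L b x y z h)
    ; expands = λ L x y z T T′ S → let open Arithmetic L in
        trans (solve 5 (λ f g v w x → f :* g :* (v :* w :* x) := f :* v :* (g :* w) :* x) refl _ _ _ _ _)
          (trans (*-congʳ (*-cong (F.expands L x y z T T′ S) (G.expands L x y z T T′ S)))
            (sym (eval-product L b F.p G.p x y z T T′ S))) }
    where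
    module F = Expansion F
    module G = Expansion G
    open CommutativeSemigroupProperties ℕₚ.+-commutativeSemigroup using (interchange)
    degrees : ∀ δ δ′ ε ε′ → pullDegree δ +ᵥ ε +ᵥ (pullDegree δ′ +ᵥ ε′) +ᵥ (2 ∷ 2 ∷ 1 ∷ []) ≡
              pullDegree (δ +ᵥ δ′) +ᵥ (ε +ᵥ ε′ +ᵥ (2 ∷ 2 ∷ 1 ∷ []))
    degrees (m ∷ n ∷ []) (m′ ∷ n′ ∷ []) (i ∷ j ∷ l ∷ []) (i′ ∷ j′ ∷ l′ ∷ []) =
      ≡.cong₂ _∷_ (component m i m′ i′ 2) (≡.cong₂ _∷_ (component n j n′ j′ 2) ≡.refl)
      where
      component : ∀ m i m′ i′ e → m ℕ.+ i ℕ.+ (m′ ℕ.+ i′) ℕ.+ e ≡ m ℕ.+ m′ ℕ.+ (i ℕ.+ i′ ℕ.+ e)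
      component m i m′ i′ e = ≡.trans (≡.cong (ℕ._+ e) (interchange m i m′ i′)) (ℕₚ.+-assoc (m ℕ.+ m′) _ e)

  expand-con : ∀ b a → Expansion b (con a)
  expand-con b a = record
    { w = con k.1# ; p = triple (con a) (con k.0#) (con k.0#) ; degree = ≡.refl
    ; nonvanishing = λ L x y z h → let open ExtensionProperties L in ι-≉0 k.1≉0
    ; expands = λ L x y z T T′ S → let open Arithmetic L in
        trans (*-congˡ ι-1) (trans
          (solve 3 (λ a T T′ → a :* con (+ 1) := a :+ (con (+ 0) :* T :+ con (+ 0) :* T′)) refl _ T T′)
          (sym (+-congˡ (+-cong (*-congʳ ι-0) (*-congʳ ι-0))))) }

  -- Every coordinate of a normal form is T or 1 times a coordinate of x: this function tells which
  -- of the two factors occurs, and `ξ` which coordinate of x.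
  isSlope : Bool → Fin 4 → Bool
  isSlope b zero                   = b
  isSlope b (suc zero)             = not b
  isSlope b (suc (suc zero))       = b
  isSlope b (suc (suc (suc zero))) = not b

  ξ : Fin 4 → Fin 2
  ξ zero                   = zero
  ξ (suc zero)             = zero
  ξ (suc (suc zero))       = suc zero
  ξ (suc (suc (suc zero))) = suc zero

  norm-! : ∀ L b T x i → let open Extension L in
    lookup (Projective.coords (C.norm L b T x)) i ≡ (if isSlope b i then T else 1#) * lookup (Projective.coords x) (ξ i)
  norm-! L false T x zero                   = ≡.refl
  norm-! L false T x (suc zero)             = ≡.refl
  norm-! L false T x (suc (suc zero))       = ≡.refl
  norm-! L false T x (suc (suc (suc zero))) = ≡.refl
  norm-! L true  T x zero                   = ≡.refl
  norm-! L true  T x (suc zero)             = ≡.refl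
  norm-! L true  T x (suc (suc zero))       = ≡.refl
  norm-! L true  T x (suc (suc (suc zero))) = ≡.refl

  expand-var : ∀ b j i → Expansion b (var j i)
  expand-var b zero i = record
    { w = con k.1# ; p = coordinate (isSlope b i) ; degree = ≡.refl
    ; nonvanishing = λ L x y z h → let open ExtensionProperties L in ι-≉0 k.1≉0
    ; expands = λ L x y z T T′ S → let open Extension L in
        trans (*-congʳ (reflexive (norm-! L b T x i))) (expands L (isSlope b i) x y z T T′) }
    where
    X = var zero (ξ i)
    coordinate : Bool → Triple (1 ∷ 0 ∷ 0 ∷ [])
    coordinate true  = triple (con k.0# ⊗ X) (con k.1# ⊗ X) (con k.0# ⊗ X)
    coordinate false = triple (con k.1# ⊗ X) (con k.0# ⊗ X) (con k.0# ⊗ X)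
    expands : ∀ L s x y z T T′ → let open Extension L; v = x ∷ y ∷ z ∷ [] in
      (if s then T else 1#) * lookup (Projective.coords x) (ξ i) * ι k.1# ≈ even (coordinate s) L v T T′ + odd (coordinate s) L v T T′
    expands L true x y z T T′ = trans (*-congˡ ι-1) (trans
      (solve 3 (λ a T T′ → T :* a :* con (+ 1) :=
         con (+ 0) :* a :+ (con (+ 1) :* a :* T :+ con (+ 0) :* a :* T′)) refl _ T T′)
      (sym (+-cong (*-congʳ ι-0) (+-cong (*-congʳ (*-congʳ ι-1)) (*-congʳ (*-congʳ ι-0))))))
      where open Arithmetic L
    expands L false x y z T T′ = trans (*-congˡ ι-1) (trans
      (solve 3 (λ a T T′ → con (+ 1) :* a :* con (+ 1) :=
         con (+ 1) :* a :+ (con (+ 0) :* a :* T :+ con (+ 0) :* a :* T′)) refl _ T T′)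
      (sym (+-cong (*-congʳ ι-1) (+-cong (*-congʳ (*-congʳ ι-0)) (*-congʳ (*-congʳ ι-0))))))
      where open Arithmetic L
  expand-var b (suc zero) i = record
    { w = con k.1# ; p = coordinate (isSlope b i) ; degree = ≡.refl
    ; nonvanishing = λ L x y z h → let open ExtensionProperties L in ι-≉0 k.1≉0
    ; expands = λ L x y z T T′ S → let open Extension L in
        trans (*-congʳ (reflexive (norm-! L b T′ y i))) (expands L (isSlope b i) x y z T T′) }
    where
    X = var (suc zero) (ξ i)
    coordinate : Bool → Triple (0 ∷ 1 ∷ 0 ∷ [])
    coordinate true  = triple (con k.0# ⊗ X) (con k.0# ⊗ X) (con k.1# ⊗ X)
    coordinate false = triple (con k.1# ⊗ X) (con k.0# ⊗ X) (con k.0# ⊗ X)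
    expands : ∀ L s x y z T T′ → let open Extension L; v = x ∷ y ∷ z ∷ [] in
      (if s then T′ else 1#) * lookup (Projective.coords y) (ξ i) * ι k.1# ≈ even (coordinate s) L v T T′ + odd (coordinate s) L v T T′
    expands L true x y z T T′ = trans (*-congˡ ι-1) (trans
      (solve 3 (λ a T T′ → T′ :* a :* con (+ 1) :=
         con (+ 0) :* a :+ (con (+ 0) :* a :* T :+ con (+ 1) :* a :* T′)) refl _ T T′)
      (sym (+-cong (*-congʳ ι-0) (+-cong (*-congʳ (*-congʳ ι-0)) (*-congʳ (*-congʳ ι-1))))))
      where open Arithmetic L
    expands L false x y z T T′ = trans (*-congˡ ι-1) (trans
      (solve 3 (λ a T T′ → con (+ 1) :* a :* con (+ 1) :=
         con (+ 1) :* a :+ (con (+ 0) :* a :* T :+ con (+ 0) :* a :* T′)) refl _ T T′)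
      (sym (+-cong (*-congʳ ι-1) (+-cong (*-congʳ (*-congʳ ι-0)) (*-congʳ (*-congʳ ι-0))))))
      where open Arithmetic L

  expansion : ∀ b {δ} (f : Form k (3 ∷ 3 ∷ []) δ) → Expansion b f
  expansion b (con a)   = expand-con b a
  expansion b (var j i) = expand-var b j i
  expansion b (f ⊕ g)   = expand-⊕ f g (expansion b f) (expansion b g)
  expansion b (f ⊗ g)   = expand-⊗ f g (expansion b f) (expansion b g)

-- The geometric quotient: fibres, openness and invariant functions.

module Quotient {c ℓ} {k : Field c ℓ}
  (2≉0 : Field._≉_ k (Field._+_ k (Field.1# k) (Field.1# k)) (Field.0# k))
  (d : Field.Carrier k) (smooth : Kummer.IsEllipticCurve k d) where

  private
    module k = Field k
    module Param = Parametrisation 2≉0 d smooth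
    module C = Charts 2≉0 d smooth
  open Kummer k d
  open Expansions 2≉0 d smooth
  open Triple

  module _ (L : Extension k) where
    open Extension L hiding (zero)
    open ExtensionProperties L
    open FieldProperties K
    open Projective K
    open ProjectiveProperties K
    open SetoidReasoning setoid
    open Param L
    open C L
    open Homogeneity L

    over-neg : ∀ {P Q x y z} → Over P Q x y z → Over (neg L P) (neg L Q) x y z
    over-neg {P} {Q} {x} {y} O = record
      { ρ≉0 = ρ≉0 ; P≋ = neg-lift P x P≋ ; Q≋ = neg-lift Q y Q≋
      ; curveP = trans curveP (solve 2 (λ t b → t :* t :* b := :- t :* :- t :* b) refl t _)
      ; curveQ = trans curveQ (solve 2 (λ t b → t :* t :* b := :- t :* :- t :* b) refl t′ _)
      ; ss′ = ss′
      ; tt′ = trans (solve 2 (λ t t′ → :- t :* :- t′ := t :* t′) refl t t′) tt′ }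
      where open Over O

    over-exists : ∀ P Q → U L (P ∷ Q ∷ []) → ∃[ x ] ∃[ y ] ∃[ z ] Over P Q x y z
    over-exists P Q ((onP , onQ) , defined) with curve-lift P onP | curve-lift Q onQ
    ... | s , t , x , P≋ | s′ , t′ , y , Q≋ =
      x , y , [ s * s′ ∷ t * t′ ∷ [] ∣ nonzero-ratio ((s * s′) ≟ 0#) ((t * t′) ≟ 0#) ] , record
        { ρ≉0 = 1≉0 ; P≋ = P≋ ; Q≋ = Q≋
        ; curveP = curve-equation P x P≋ onP ; curveQ = curve-equation Q y Q≋ onQ
        ; ss′ = sym (*-identityˡ _) ; tt′ = sym (*-identityˡ _) }
      where
      nonzero-ratio : Dec (s * s′ ≈ 0#) → Dec (t * t′ ≈ 0#) → Nonzero (s * s′ ∷ t * t′ ∷ [])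
      nonzero-ratio (no ≉0)  _        = here ≉0
      nonzero-ratio (yes _)  (no ≉0)  = there (here ≉0)
      nonzero-ratio (yes ≈0) (yes ≈0′) = contradiction defined (π₃-undefined P Q x y P≋ Q≋ ≈0 ≈0′)

    over-chart : ∀ {P Q x y z} → Over P Q x y z → ∃[ b ] InChart b x y z
    over-chart {x = x} {y} {z} O = inSomeChart x y z (over-surface O) (over-¬exceptional O)

    pair-∼ : ∀ {P Q P′ Q′ : ℙ 3} → coords P ∝ coords P′ → coords Q ∝ coords Q′ →
             (P ∷ Q ∷ []) ∼ (P′ ∷ Q′ ∷ [])
    pair-∼ p q zero       = p
    pair-∼ p q (suc zero) = q

    odd-neg : ∀ {η} (p : Triple η) v T T′ → odd p L v (- T) (- T′) ≈ - odd p L v T T′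
    odd-neg p v T T′ = solve 4 (λ a b T T′ → a :* :- T :+ b :* :- T′ := :- (a :* T :+ b :* T′)) refl _ _ T T′

    -- For p = q the bracket is the product of A + O and A - O, the values belonging to the two
    -- points of a fibre.
    eval-evenProduct : ∀ {η θ} b (p : Triple η) (q : Triple θ) x y z T T′ → Slopes b x y z T T′ →
      let v = x ∷ y ∷ z ∷ [] in
      eval k L (evenProduct (k.- k.1#) b p q) v ≈
      (even p L v T T′ * even q L v T T′ - odd p L v T T′ * odd q L v T T′) * eval k L (χ b) v
    eval-evenProduct b p q x y z T T′ S = begin
      _   ≈⟨ +-congˡ (trans (eval-oddProduct L (k.- k.1#) b p q x y z T T′ S) (*-congʳ (trans (ι-neg _) (-‿cong ι-1)))) ⟩
      _   ≈⟨ solve 5 (λ a a′ o o′ X → a :* a′ :* X :+ :- con (+ 1) :* (o :* o′ :* X) := (a :* a′ :- o :* o′) :* X) refl _ _ _ _ _ ⟩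
      _   ∎

    module _ {b P Q x y z} (N : NormalForm b P Q x y z) where
      open NormalForm N

      private
        v : Points (1 ∷ 1 ∷ 1 ∷ [])
        v = x ∷ y ∷ z ∷ []

      factor± : Fin 2 → Carrier
      factor± zero       = proj₁ P∝
      factor± (suc zero) = proj₁ Q∝

      -- Kept apart from `factor±`, as the multipliers of a point and of its negative need not
      -- agree: in chart true they differ by a sign.
      factor∓ : Fin 2 → Carrier
      factor∓ zero       = proj₁ neg-P∝
      factor∓ (suc zero) = proj₁ neg-Q∝

      scale scale-neg : Vec ℕ 2 → Carrier
      scale     = weight factor±
      scale-neg = weight factor∓

      scale-≉0 : ∀ δ → scale δ ≉ 0#
      scale-≉0 δ = weight-≉0 factor± δ λ { zero → proj₁ (proj₂ P∝) ; (suc zero) → proj₁ (proj₂ Q∝) }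

      scale-neg-≉0 : ∀ δ → scale-neg δ ≉ 0#
      scale-neg-≉0 δ = weight-≉0 factor∓ δ λ { zero → proj₁ (proj₂ neg-P∝) ; (suc zero) → proj₁ (proj₂ neg-Q∝) }

      eval-expanded : ∀ {δ ε η} (f : Form k (3 ∷ 3 ∷ []) δ) (w : Form₃ ε) (p : Triple η) → Expands b f w p →
        eval k L f (P ∷ Q ∷ []) * eval k L w v ≈ scale δ * (even p L v T T′ + odd p L v T T′)
      eval-expanded {δ} f w p h = trans (*-congʳ (eval-homogeneous f factor±
          (λ { zero → proj₂ (proj₂ P∝) ; (suc zero) → proj₂ (proj₂ Q∝) })))
        (trans (*-assoc _ _ _) (*-congˡ (h L x y z T T′ slopes)))

      eval-expanded-neg : ∀ {δ ε η} (f : Form k (3 ∷ 3 ∷ []) δ) (w : Form₃ ε) (p : Triple η) → Expands b f w p →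
        eval k L f (neg L P ∷ neg L Q ∷ []) * eval k L w v ≈ scale-neg δ * (even p L v T T′ - odd p L v T T′)
      eval-expanded-neg {δ} f w p h = trans (*-congʳ (eval-homogeneous f factor∓
          (λ { zero → proj₂ (proj₂ neg-P∝) ; (suc zero) → proj₂ (proj₂ neg-Q∝) })))
        (trans (*-assoc _ _ _) (*-congˡ (trans (h L x y z (- T) (- T′) (Slopes-neg slopes)) (+-congˡ (odd-neg p v T T′)))))

    preimage : ∀ {b δ x y z T T′} (f : Form k (3 ∷ 3 ∷ []) δ) → InChart b x y z → Slopes b x y z T T′ →
      eval k L f (norm b T x ∷ norm b T′ y ∷ []) ≉ 0# →
      ∃[ u ] U L u × π L u (x ∷ y ∷ z ∷ []) × NonzeroAt k L f u
    preimage {b} {x = x} {y} {z} f (_ , _ , dz≉0) S f≉0 =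
      let inU , inπ = over⁻¹ _ _ x y z (over-norm b {x} {y} {z} dz≉0 S) in _ , inU , inπ , f≉0

    -- The values of f on the normal forms for (T, T′) and (- T, - T′), multiplied by w, add up to 2
    -- A, so f is nonzero at one of the two.
    even-preimage : ∀ {b δ} {f : Form k (3 ∷ 3 ∷ []) δ} (E : Expansion b f) x y z → AlgebraicallyClosed K →
      V L (x ∷ y ∷ z ∷ []) → InChart b x y z → NonzeroAt k L (A (Expansion.p E)) (x ∷ y ∷ z ∷ []) →
      ∃[ u ] U L u × π L u (x ∷ y ∷ z ∷ []) × NonzeroAt k L f u
    even-preimage {b} {f = f} E x y z closed inV inChart A≉0
      with solve-slopes closed b x y z (proj₁ (V⇒ x y z inV)) inChart
    ... | T , T′ , S = cases (eval k L f (norm b T x ∷ norm b T′ y ∷ []) ≟ 0#)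
                             (eval k L f (norm b (- T) x ∷ norm b (- T′) y ∷ []) ≟ 0#)
      where
      open Expansion E
      v = x ∷ y ∷ z ∷ []
      cases : Dec (eval k L f (norm b T x ∷ norm b T′ y ∷ []) ≈ 0#) →
              Dec (eval k L f (norm b (- T) x ∷ norm b (- T′) y ∷ []) ≈ 0#) →
              ∃[ u ] U L u × π L u v × NonzeroAt k L f u
      cases (no f≉0) _        = preimage f inChart S f≉0
      cases (yes _)  (no f≉0) = preimage f inChart (Slopes-neg S) f≉0
      cases (yes e)  (yes e′) = contradiction (*-cancelˡ 2≉0ᴷ (modulo
        (+-cong (trans (sym (expands L x y z T T′ S)) (*-≈0ˡ _ e))
                (trans (sym (trans (expands L x y z _ _ (Slopes-neg S)) (+-congˡ (odd-neg p v T T′)))) (*-≈0ˡ _ e′)))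
        (solve 2 (λ a o → (con (+ 1) :+ con (+ 1)) :* a :+ (con (+ 0) :+ con (+ 0)) :=
           (con (+ 1) :+ con (+ 1)) :* con (+ 0) :+ ((a :+ o) :+ (a :- o))) refl _ (odd p L v T T′)))) A≉0

    -- A zero of f on the fibre would make the factor A + O of the norm vanish, so any choice of
    -- slopes gives a suitable preimage.
    norm-preimage : ∀ {b δ} {f : Form k (3 ∷ 3 ∷ []) δ} (E : Expansion b f) x y z → AlgebraicallyClosed K →
      V L (x ∷ y ∷ z ∷ []) → InChart b x y z →
      NonzeroAt k L (evenProduct (k.- k.1#) b (Expansion.p E) (Expansion.p E)) (x ∷ y ∷ z ∷ []) →
      ∃[ u ] U L u × π L u (x ∷ y ∷ z ∷ []) × NonzeroAt k L f u
    norm-preimage {b} {f = f} E x y z closed inV inChart N≉0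
      with solve-slopes closed b x y z (proj₁ (V⇒ x y z inV)) inChart
    ... | T , T′ , S = preimage f inChart S λ f≈0 → N≉0 (begin
      _       ≈⟨ eval-evenProduct b p p x y z T T′ S ⟩
      _       ≈⟨ *-congʳ (solve 2 (λ a o → a :* a :- o :* o := (a :+ o) :* (a :- o)) refl _ _) ⟩
      _       ≈⟨ *-≈0ˡ _ (*-≈0ˡ _ (trans (sym (expands L x y z T T′ S)) (*-≈0ˡ _ f≈0))) ⟩
      0#      ∎)
      where open Expansion E

    -- With A = 0 and f ≠ 0 the odd part must be nonzero, and the norm is - O² times `χ b`.
    norm-≉0 : ∀ {b δ P Q x y z} {f : Form k (3 ∷ 3 ∷ []) δ} {ε η} {w : Form₃ ε} {p : Triple η} →
      Expands b f w p → NonzeroAt k L w (x ∷ y ∷ z ∷ []) →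
      InChart b x y z → NormalForm b P Q x y z → NonzeroAt k L f (P ∷ Q ∷ []) →
      eval k L (A p) (x ∷ y ∷ z ∷ []) ≈ 0# →
      NonzeroAt k L (evenProduct (k.- k.1#) b p p) (x ∷ y ∷ z ∷ [])
    norm-≉0 {b} {δ} {x = x} {y} {z} {f} {w = w} {p} h w≉0 inChart N f≉0 A≈0 N≈0 =
      *-≉0 (*-≉0 o≉0 o≉0) (χ-≉0 L b x y z inChart) (begin
        o * o * X                      ≈⟨ solve 3 (λ a o X → o :* o :* X := a :* (a :* X) :- (a :* a :- o :* o) :* X) refl a o X ⟩
        a * (a * X) - (a * a - o * o) * X
          ≈⟨ +-cong (*-≈0ˡ _ A≈0) (-‿cong (trans (sym (eval-evenProduct b p p x y z T T′ slopes)) N≈0)) ⟩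
        0# - 0#                        ≈⟨ -‿inverseʳ 0# ⟩
        0#                             ∎)
      where
      open NormalForm N
      v = x ∷ y ∷ z ∷ []
      a = even p L v T T′
      o = odd p L v T T′
      X = eval k L (χ b) v
      o≉0 : odd p L v T T′ ≉ 0#
      o≉0 o≈0 = *-≉0 f≉0 w≉0 (trans (eval-expanded N f w p h) (*-≈0ʳ _ (trans (+-cong A≈0 o≈0) (+-identityˡ _))))

    -- An invariant fraction f / g equals the quotient of the even parts, as the
    -- invariance f σ(g) = σ(f) g says that A_f O_g = O_f A_g.
    module InvariantFraction {F G Fσ Gσ W M M′ a o a′ o′ : Carrier}
      (W≉0 : W ≉ 0#) (M≉0 : M ≉ 0#) (M′≉0 : M′ ≉ 0#)
      (FW : F * W ≈ M * (a + o)) (GW : G * W ≈ M * (a′ + o′))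
      (FσW : Fσ * W ≈ M′ * (a - o)) (GσW : Gσ * W ≈ M′ * (a′ - o′))
      (invariant : F * Gσ ≈ Fσ * G) where

      private
        parts-proportional : o * a′ ≈ a * o′
        -- The products (a + o)(a′ - o′) and (a - o)(a′ + o′) share the even part a a′ - o o′; their
        -- difference is 2 (o a′ - a o′).
        parts-proportional = *-cancelˡ (*-≉0 2≉0ᴷ (*-≉0 M≉0 M′≉0)) (modulo (begin
          M * (a + o) * (M′ * (a′ - o′))    ≈⟨ *-cong FW GσW ⟨
          F * W * (Gσ * W)                  ≈⟨ solve 3 (λ f w g → f :* w :* (g :* w) := f :* g :* (w :* w)) refl F W Gσ ⟩
          F * Gσ * (W * W)                  ≈⟨ *-congʳ invariant ⟩
          Fσ * G * (W * W)                  ≈⟨ solve 3 (λ f w g → f :* w :* (g :* w) := f :* g :* (w :* w)) refl Fσ W G ⟨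
          Fσ * W * (G * W)                  ≈⟨ *-cong FσW GW ⟩
          M′ * (a - o) * (M * (a′ + o′))    ∎)
          (solve 6 (λ M M′ a o a′ o′ →
            (con (+ 1) :+ con (+ 1)) :* (M :* M′) :* (o :* a′) :+ M′ :* (a :- o) :* (M :* (a′ :+ o′)) :=
            (con (+ 1) :+ con (+ 1)) :* (M :* M′) :* (a :* o′) :+ M :* (a :+ o) :* (M′ :* (a′ :- o′)))
            refl M M′ a o a′ o′))

        clear : ∀ {e e′} → M * (a + o) * e ≈ M * (a′ + o′) * e′ → F * e ≈ G * e′
        clear {e} {e′} eq = *-cancelˡ W≉0 (begin
          W * (F * e)            ≈⟨ solve 3 (λ w f e → w :* (f :* e) := f :* w :* e) refl W F e ⟩
          F * W * e              ≈⟨ *-congʳ FW ⟩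
          M * (a + o) * e        ≈⟨ eq ⟩
          M * (a′ + o′) * e′     ≈⟨ *-congʳ GW ⟨
          G * W * e′             ≈⟨ solve 3 (λ w f e → w :* (f :* e) := f :* w :* e) refl W G e′ ⟨
          W * (G * e′)           ∎)

      ratio-even : ∀ X → F * (X * a′) ≈ G * (X * a)
      ratio-even X = clear (modulo (*-congˡ {M * X} parts-proportional) (solve 6 (λ M X a o a′ o′ →
        M :* (a :+ o) :* (X :* a′) :+ M :* X :* (a :* o′) :=
        M :* (a′ :+ o′) :* (X :* a) :+ M :* X :* (o :* a′)) refl M X a o a′ o′))

      -- This is for points where a′ vanishes and `ratio-even` has no usable denominator. The
      -- fraction is extended by a′ - o′; the numerator (a + o)(a′ - o′) then reduces to a a′ - o
      -- o′, because its odd part o a′ - a o′ is 0.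
      ratio-norm : ∀ X → F * (X * ((a′ * a′ - o′ * o′) * X)) ≈ G * (X * ((a * a′ - o * o′) * X))
      ratio-norm X = clear (modulo (*-congˡ {M * X * X * (a′ + o′)} parts-proportional) (solve 6 (λ M X a o a′ o′ →
        M :* (a :+ o) :* (X :* ((a′ :* a′ :- o′ :* o′) :* X)) :+ M :* X :* X :* (a′ :+ o′) :* (a :* o′) :=
        M :* (a′ :+ o′) :* (X :* ((a :* a′ :- o :* o′) :* X)) :+ M :* X :* X :* (a′ :+ o′) :* (o :* a′))
        refl M X a o a′ o′))

    expanded-ratios : ∀ {b P Q x y z} (N : NormalForm b P Q x y z) {δ ε η} (f g : Form k (3 ∷ 3 ∷ []) δ)
      (w : Form₃ ε) (p q : Triple η) → Expands b f w p → Expands b g w q →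
      let v = x ∷ y ∷ z ∷ []; u = P ∷ Q ∷ [] in
      NonzeroAt k L w v →
      eval k L f u * eval k L g (neg² L u) ≈ eval k L f (neg² L u) * eval k L g u →
      eval k L f u * (eval k L (χ b) v * eval k L (A q) v) ≈ eval k L g u * (eval k L (χ b) v * eval k L (A p) v) ×
      eval k L f u * (eval k L (χ b) v * eval k L (evenProduct (k.- k.1#) b q q) v) ≈
      eval k L g u * (eval k L (χ b) v * eval k L (evenProduct (k.- k.1#) b p q) v)
    expanded-ratios {b} {x = x} {y} {z} N {δ} f g w p q hf hg w≉0 invariant =
      ratio-even X ,
      trans (*-congˡ (*-congˡ (eval-evenProduct b q q x y z T T′ slopes)))
        (trans (ratio-norm X) (sym (*-congˡ (*-congˡ (eval-evenProduct b p q x y z T T′ slopes)))))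
      where
      open NormalForm N using (T; T′; slopes)
      X = eval k L (χ b) (x ∷ y ∷ z ∷ [])
      open InvariantFraction w≉0 (scale-≉0 N δ) (scale-neg-≉0 N δ)
        (eval-expanded N f w p hf) (eval-expanded N g w q hg)
        (eval-expanded-neg N f w p hf) (eval-expanded-neg N g w q hg) invariant

    -- Off the chart the factor `χ b` makes both sides 0, so an identity proved from normal forms
    -- extends to all of `U`.
    ratio-everywhere : ∀ {b δ η} {f g : Form k (3 ∷ 3 ∷ []) δ} (n m : Form₃ η) P Q x y z →
      let v = x ∷ y ∷ z ∷ []; u = P ∷ Q ∷ [] in
      (InChart b x y z → NormalForm b P Q x y z →
       eval k L f u * (eval k L (χ b) v * eval k L m v) ≈ eval k L g u * (eval k L (χ b) v * eval k L n v)) →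
      U L u → π L u v → eval k L f u * eval k L (χ b ⊗ m) v ≈ eval k L g u * eval k L (χ b ⊗ n) v
    ratio-everywhere {b} n m P Q x y z h inU inπ = cases (eval k L (χ b) (x ∷ y ∷ z ∷ []) ≟ 0#)
      where
      cases : Dec (eval k L (χ b) (x ∷ y ∷ z ∷ []) ≈ 0#) → _
      cases (yes χ≈0) = trans (*-≈0ʳ _ (*-≈0ˡ _ χ≈0)) (sym (*-≈0ʳ _ (*-≈0ˡ _ χ≈0)))
      cases (no χ≉0)  = h inChart (normalForm b inChart (over P Q x y z inU inπ))
        where inChart = χ-≉0⁻ L b x y z χ≉0

  IsOpenAt : ∀ {δ} (f : Form k (3 ∷ 3 ∷ []) δ) L → Projective.Points (Extension.K L) (1 ∷ 1 ∷ 1 ∷ []) → Set _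
  IsOpenAt f L v = ∃₂ λ ε (p : Form k (1 ∷ 1 ∷ 1 ∷ []) ε) → NonzeroAt k L p v ×
    (∀ L′ → AlgebraicallyClosed (Extension.K L′) → ∀ v′ → V L′ v′ → NonzeroAt k L′ p v′ →
     ∃[ u′ ] U L′ u′ × π L′ u′ v′ × NonzeroAt k L′ f u′)

  -- The image of {f ≠ 0} contains {A ≠ 0}, and also {A² - O² ≠ 0}, the locus
  -- where f vanishes at no point of the fibre.
  isOpenAt : ∀ {b δ} {f : Form k (3 ∷ 3 ∷ []) δ} (E : Expansion b f) L P Q x y z →
    C.InChart L b x y z → C.NormalForm L b P Q x y z → NonzeroAt k L f (P ∷ Q ∷ []) →
    Dec (Extension._≈_ L (eval k L (A (Expansion.p E)) (x ∷ y ∷ z ∷ [])) (Extension.0# L)) →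
    IsOpenAt f L (x ∷ y ∷ z ∷ [])
  isOpenAt {b} E L P Q x y z inChart N f≉0 (no A≉0) =
    -- The factor `χ b` keeps the nearby points in the chart on which the expansion is valid.
    _ , χ b ⊗ A (Expansion.p E) ,
    FieldProperties.*-≉0 (Extension.K L) (χ-≉0 L b x y z inChart) A≉0 ,
    λ { L′ closed (x′ ∷ y′ ∷ z′ ∷ []) inV p≉0 →
        even-preimage L′ E x′ y′ z′ closed inV
          (χ-≉0⁻ L′ b x′ y′ z′ (FieldProperties.*-≉0⁻ˡ (Extension.K L′) p≉0))
          (FieldProperties.*-≉0⁻ʳ (Extension.K L′) p≉0) }
  isOpenAt {b} {f = f} E L P Q x y z inChart N f≉0 (yes A≈0) =
    _ , χ b ⊗ evenProduct (k.- k.1#) b (Expansion.p E) (Expansion.p E) ,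
    FieldProperties.*-≉0 (Extension.K L) (χ-≉0 L b x y z inChart)
      (norm-≉0 L {f = f} {w = Expansion.w E} {Expansion.p E} (Expansion.expands E)
        (Expansion.nonvanishing E L x y z inChart) inChart N f≉0 A≈0) ,
    λ { L′ closed (x′ ∷ y′ ∷ z′ ∷ []) inV p≉0 →
        norm-preimage L′ E x′ y′ z′ closed inV
          (χ-≉0⁻ L′ b x′ y′ z′ (FieldProperties.*-≉0⁻ˡ (Extension.K L′) p≉0))
          (FieldProperties.*-≉0⁻ʳ (Extension.K L′) p≉0) }

  IsInvariantFraction : ∀ {δ} (f g : Form k (3 ∷ 3 ∷ []) δ) → Set _
  IsInvariantFraction f g = ∀ L u → let open Extension L in U L u →
    eval k L f u * eval k L g (neg² L u) ≈ eval k L f (neg² L u) * eval k L g u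

  DescendsAt : ∀ {δ} (f g : Form k (3 ∷ 3 ∷ []) δ) L → Projective.Points (Extension.K L) (1 ∷ 1 ∷ 1 ∷ []) → Set _
  DescendsAt f g L v =
    ∃[ ε ] Σ[ p ∈ Form k (1 ∷ 1 ∷ 1 ∷ []) ε ] Σ[ q ∈ Form k (1 ∷ 1 ∷ 1 ∷ []) ε ]
      NonzeroAt k L q v ×
      (∀ L′ u′ v′ → let open Extension L′ in U L′ u′ → π L′ u′ v′ →
       eval k L′ f u′ * eval k L′ q v′ ≈ eval k L′ g u′ * eval k L′ p v′)

  -- The denominator is the even part of g if it is nonzero at v. Otherwise it is the norm of g,
  -- which is nonzero there because g is nonzero at a point above v.
  descendsAt : ∀ {b δ} {f g : Form k (3 ∷ 3 ∷ []) δ} → CommonExpansion b f g → IsInvariantFraction f g →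
    ∀ L P Q x y z → C.InChart L b x y z → C.NormalForm L b P Q x y z → NonzeroAt k L g (P ∷ Q ∷ []) →
    DescendsAt f g L (x ∷ y ∷ z ∷ [])
  descendsAt {b} {f = f} {g} E invariant L P Q x y z inChart N g≉0 =
    cases (Field._≟_ (Extension.K L) (eval k L (A q) (x ∷ y ∷ z ∷ [])) (Extension.0# L))
    where
    open CommonExpansion E
    ratios : ∀ L′ P′ Q′ x′ y′ z′ → U L′ (P′ ∷ Q′ ∷ []) → C.InChart L′ b x′ y′ z′ → C.NormalForm L′ b P′ Q′ x′ y′ z′ → _
    ratios L′ P′ Q′ x′ y′ z′ inU′ inChart′ N′ =
      expanded-ratios L′ N′ f g w p q expandsˡ expandsʳ (nonvanishing L′ x′ y′ z′ inChart′)
        (invariant L′ (P′ ∷ Q′ ∷ []) inU′)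
    cases : Dec (Extension._≈_ L (eval k L (A q) (x ∷ y ∷ z ∷ [])) (Extension.0# L)) →
      DescendsAt f g L (x ∷ y ∷ z ∷ [])
    cases (no A≉0) = _ , χ b ⊗ A p , χ b ⊗ A q ,
      FieldProperties.*-≉0 (Extension.K L) (χ-≉0 L b x y z inChart) A≉0 ,
      λ { L′ (P′ ∷ Q′ ∷ []) (x′ ∷ y′ ∷ z′ ∷ []) inU′ inπ′ →
          ratio-everywhere L′ {f = f} {g} (A p) (A q) P′ Q′ x′ y′ z′
            (λ inChart′ N′ → proj₁ (ratios L′ P′ Q′ x′ y′ z′ inU′ inChart′ N′)) inU′ inπ′ }
    cases (yes A≈0) = _ , χ b ⊗ evenProduct (k.- k.1#) b p q , χ b ⊗ evenProduct (k.- k.1#) b q q ,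
      FieldProperties.*-≉0 (Extension.K L) (χ-≉0 L b x y z inChart)
        (norm-≉0 L {f = g} {w = w} {q} expandsʳ (nonvanishing L x y z inChart) inChart N g≉0 A≈0) ,
      λ { L′ (P′ ∷ Q′ ∷ []) (x′ ∷ y′ ∷ z′ ∷ []) inU′ inπ′ →
          ratio-everywhere L′ {f = f} {g} (evenProduct (k.- k.1#) b p q) (evenProduct (k.- k.1#) b q q) P′ Q′ x′ y′ z′
            (λ inChart′ N′ → proj₂ (ratios L′ P′ Q′ x′ y′ z′ inU′ inChart′ N′)) inU′ inπ′ }

  stable : ∀ L u → U L u → U L (neg² L u)
  stable L (P ∷ Q ∷ []) inU = let x , y , z , O = over-exists L P Q inU in
    proj₁ (Param.over⁻¹ L (neg L P) (neg L Q) x y z (over-neg L O))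

  total : ∀ L u → U L u → ∃[ v ] V L v × π L u v
  total L (P ∷ Q ∷ []) inU = let x , y , z , O = over-exists L P Q inU in
    (x ∷ y ∷ z ∷ []) ,
    Param.⇒V L x y z (Param.over-surface L O) (Param.over-¬exceptional L O) ,
    proj₂ (Param.over⁻¹ L P Q x y z O)

  singleValued : ∀ L u v v′ → let open Projective (Extension.K L) in
    U L u → π L u v → π L u v′ → v ∼ v′
  singleValued L (P ∷ Q ∷ []) (x ∷ y ∷ z ∷ []) (x′ ∷ y′ ∷ z′ ∷ []) _ (p , q , r) (p′ , q′ , r′) = λ
    { zero             → ProjectiveProperties.value-unique (Extension.K L) {z = x} {x′} p p′
    ; (suc zero)       → ProjectiveProperties.value-unique (Extension.K L) {z = y} {y′} q q′
    ; (suc (suc zero)) → ProjectiveProperties.value-unique (Extension.K L) {z = z} {z′} r r′ }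

  invariant : ∀ L u v → U L u → π L u v → π L (neg² L u) v
  invariant L (P ∷ Q ∷ []) (x ∷ y ∷ z ∷ []) inU inπ =
    proj₂ (Param.over⁻¹ L (neg L P) (neg L Q) x y z (over-neg L (Param.over L P Q x y z inU inπ)))

  fibre : ∀ L u u′ v → let open Projective (Extension.K L) in
    U L u → U L u′ → π L u v → π L u′ v → u ∼ u′ ⊎ neg² L u ∼ u′
  fibre L (P ∷ Q ∷ []) (P′ ∷ Q′ ∷ []) (x ∷ y ∷ z ∷ []) inU inU′ inπ inπ′ =
    let O           = Param.over L P Q x y z inU inπ
        O′          = Param.over L P′ Q′ x y z inU′ inπ′
        b , inChart = over-chart L O
    in Sum.map (λ { (p , q) → pair-∼ L {P} {Q} {P′} {Q′} p q })
               (λ { (p , q) → pair-∼ L {neg L P} {neg L Q} {P′} {Q′} p q })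
         (C.same-fibre L inChart (C.normalForm L b inChart O) (C.normalForm L b inChart O′))

  surjective : ∀ L → AlgebraicallyClosed (Extension.K L) → ∀ v → V L v → ∃[ u ] U L u × π L u v
  surjective L closed (x ∷ y ∷ z ∷ []) inV =
    let surface , ¬exc = Param.V⇒ L x y z inV
        b , inChart    = C.inSomeChart L x y z surface ¬exc
        T , T′ , S     = C.solve-slopes L closed b x y z surface inChart
    in (C.norm L b T x ∷ C.norm L b T′ y ∷ []) ,
       Param.over⁻¹ L (C.norm L b T x) (C.norm L b T′ y) x y z
         (C.over-norm L b {x} {y} {z} (proj₂ (proj₂ inChart)) S)

  open-map : ∀ {δ} (f : Form k (3 ∷ 3 ∷ []) δ) L u v → U L u → π L u v → NonzeroAt k L f u → IsOpenAt f L v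
  open-map f L (P ∷ Q ∷ []) (x ∷ y ∷ z ∷ []) inU inπ f≉0 =
    let O           = Param.over L P Q x y z inU inπ
        b , inChart = over-chart L O
    in isOpenAt (expansion b f) L P Q x y z inChart (C.normalForm L b inChart O) f≉0
         (Field._≟_ (Extension.K L) _ _)

  functions : ∀ {δ} (f g : Form k (3 ∷ 3 ∷ []) δ) → IsInvariantFraction f g →
    ∀ L u v → U L u → π L u v → NonzeroAt k L g u → DescendsAt f g L v
  functions f g inv L (P ∷ Q ∷ []) (x ∷ y ∷ z ∷ []) inU inπ g≉0 =
    let O           = Param.over L P Q x y z inU inπ
        b , inChart = over-chart L O
    in descendsAt (commonExpansion (expansion b f) (expansion b g)) inv L P Q x y z inChart
         (C.normalForm L b inChart O) g≉0

  isQuotient : IsQuotientByInvolution k U neg² V π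
  isQuotient = record
    { stable       = stable
    ; total        = total
    ; singleValued = singleValued
    ; invariant    = invariant
    ; fibre        = fibre
    ; surjective   = surjective
    ; open-map     = open-map
    ; functions    = functions }

-- The Segre models, the locus of indeterminacy and the base point.

module SegreModels {c ℓ} {k : Field c ℓ}
  (2≉0 : Field._≉_ k (Field._+_ k (Field.1# k) (Field.1# k)) (Field.0# k))
  (d : Field.Carrier k) (smooth : Kummer.IsEllipticCurve k d) (L : Extension k) where

  open Kummer k d
  open Extension L hiding (zero)
  open FieldProperties K
  open ExtensionProperties L
  open Projective K
  open ProjectiveProperties K
  open SetoidReasoning setoid
  open Parametrisation 2≉0 d smooth L

  1·-∝ : ∀ {n} {v w : Vec Carrier n} → w ≋ v → v ∝ w
  1·-∝ {v = v} w≋v = 1# , 1≉0 , ≋-tabulate λ i →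
    trans (lookup-≋ w≋v i) (sym (trans (lookup-· 1# v i) (*-identityˡ _)))

  private
    minor : ∀ {μ a b c d A B C D} → A ≈ μ * a → B ≈ μ * b → C ≈ μ * c → D ≈ μ * d →
            a * b ≈ c * d → A * B ≈ C * D
    minor {μ} {a} {b} {c} {d} A B C D e = trans (*-cong A B) (trans (regroup μ a b)
      (trans (*-congˡ e) (trans (sym (regroup μ c d)) (sym (*-cong C D)))))
      where
      regroup : ∀ μ a b → μ * a * (μ * b) ≈ μ * μ * (a * b)
      regroup = solve 3 (λ μ a b → μ :* a :* (μ :* b) := μ :* μ :* (a :* b)) refl

  segre-quadric : ∀ x y u → segre L x y ∝ coords u → OnQuadric L u
  segre-quadric [ x₀ ∷ x₁ ∷ [] ∣ _ ] [ y₀ ∷ y₁ ∷ [] ∣ _ ] [ _ ∷ _ ∷ _ ∷ _ ∷ [] ∣ _ ]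
    (_ , _ , u₀ ∷ u₁ ∷ u₂ ∷ u₃ ∷ []) = minor u₀ u₃ u₁ u₂
      (solve 4 (λ x x′ y y′ → x :* y :* (x′ :* y′) := x′ :* y :* (x :* y′)) refl x₀ x₁ y₀ y₁)

  quadric⇔segre : ∀ u → OnQuadric L u ⇔ (∃[ x ] ∃[ y ] segre L x y ∝ coords u)
  quadric⇔segre u = mk⇔ (λ q → let x , y , e = quadric-lift u q in x , y , 1·-∝ e)
                        (λ { (x , y , e) → segre-quadric x y u e })

  segre-nonzero : ∀ x y → Nonzero (segre L x y)
  segre-nonzero [ _ ∷ _ ∷ [] ∣ here p ]         [ _ ∷ _ ∷ [] ∣ here q ]         = here (*-≉0 p q)
  segre-nonzero [ _ ∷ _ ∷ [] ∣ there (here p) ] [ _ ∷ _ ∷ [] ∣ here q ]         = there (here (*-≉0 p q))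
  segre-nonzero [ _ ∷ _ ∷ [] ∣ here p ]         [ _ ∷ _ ∷ [] ∣ there (here q) ] = there (there (here (*-≉0 p q)))
  segre-nonzero [ _ ∷ _ ∷ [] ∣ there (here p) ] [ _ ∷ _ ∷ [] ∣ there (here q) ] = there (there (there (here (*-≉0 p q))))

  -- Rows of the 2 × 2 matrix of the Uᵢ are multiples of x, and columns are multiples of y; this
  -- gives the inverse of the Segre embedding on the quadric.
  segre-rulings : ∀ x y u → segre L x y ∝ coords u →
    x IsValue proj₁ (rulings L u) × y IsValue proj₂ (rulings L u)
  segre-rulings x@([ x₀ ∷ x₁ ∷ [] ∣ _ ]) y@([ y₀ ∷ y₁ ∷ [] ∣ _ ]) u@([ _ ∷ _ ∷ _ ∷ _ ∷ [] ∣ u≠0 ])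
    (μ , _ , u₀ ∷ u₁ ∷ u₂ ∷ u₃ ∷ []) =
    isValue {z = x} (rowDefined u≠0)
      ((_ , along-x u₀ ∷ along-x u₁ ∷ []) ListAll.∷ (_ , along-x u₂ ∷ along-x u₃ ∷ []) ListAll.∷ ListAll.[]) ,
    isValue {z = y} (columnDefined u≠0)
      ((_ , along-y u₀ ∷ along-y u₂ ∷ []) ListAll.∷ (_ , along-y u₁ ∷ along-y u₃ ∷ []) ListAll.∷ ListAll.[])
    where
    along-x : ∀ {a b U} → U ≈ μ * (a * b) → U ≈ μ * b * a
    along-x e = trans e (solve 3 (λ μ a b → μ :* (a :* b) := μ :* b :* a) refl _ _ _)
    along-y : ∀ {a b U} → U ≈ μ * (a * b) → U ≈ μ * a * b
    along-y e = trans e (sym (*-assoc _ _ _))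
    rowDefined : Nonzero (coords u) → Defined (proj₁ (rulings L u))
    rowDefined (here p)                         = ListAny.here (here p)
    rowDefined (there (here p))                 = ListAny.here (there (here p))
    rowDefined (there (there (here p)))         = ListAny.there (ListAny.here (here p))
    rowDefined (there (there (there (here p)))) = ListAny.there (ListAny.here (there (here p)))
    columnDefined : Nonzero (coords u) → Defined (proj₂ (rulings L u))
    columnDefined (here p)                         = ListAny.here (here p)
    columnDefined (there (here p))                 = ListAny.there (ListAny.here (here p))
    columnDefined (there (there (here p)))         = ListAny.here (there (here p))
    columnDefined (there (there (there (here p)))) = ListAny.there (ListAny.here (there (here p)))

  scaled-⇔ : ∀ {μ a b A B} → μ ≉ 0# → A ≈ μ * a → B ≈ μ * b → (A ≈ B → a ≈ b) × (a ≈ b → A ≈ B)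
  scaled-⇔ μ≉0 e f = (λ A≈B → *-cancelˡ μ≉0 (trans (sym e) (trans A≈B f))) ,
                     (λ a≈b → trans e (trans (*-congˡ a≈b) (sym f)))

  private
    ²-cong : ∀ {a b} → a ≈ b → a ² ≈ b ²
    ²-cong e = *-cong e e

    -- For the model in ℙ³ × ℙ¹ the value of `Z` is Z₀². For the relation in ℙ⁷ it is 1, and the
    -- third coordinate is absorbed in the scalar `μ`.
    factor-α : ∀ {μ x₀ x₁ y₀ y₁ U₀ U₁ U₂ U₃ Z} →
      U₀ ≈ μ * (x₀ * y₀) → U₁ ≈ μ * (x₁ * y₀) → U₂ ≈ μ * (x₀ * y₁) → U₃ ≈ μ * (x₁ * y₁) →
      (U₀ ² - U₁ ² - U₂ ² + U₃ ²) * Z ≈ μ * μ * ((x₀ ² - x₁ ²) * (y₀ ² - y₁ ²) * Z)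
    factor-α {μ} {x₀} {x₁} {y₀} {y₁} {Z = Z} u₀ u₁ u₂ u₃ = trans
      (*-congʳ (+-cong (+-cong (+-cong (²-cong u₀) (-‿cong (²-cong u₁))) (-‿cong (²-cong u₂))) (²-cong u₃)))
      (solve 6 (λ μ x₀ x₁ y₀ y₁ Z → let sq = λ a → a :* a in
        (sq (μ :* (x₀ :* y₀)) :- sq (μ :* (x₁ :* y₀)) :- sq (μ :* (x₀ :* y₁)) :+ sq (μ :* (x₁ :* y₁))) :* Z :=
        μ :* μ :* ((sq x₀ :- sq x₁) :* (sq y₀ :- sq y₁) :* Z)) refl μ x₀ x₁ y₀ y₁ Z)

    factor-β : ∀ {μ x₀ x₁ y₀ y₁ U₀ U₁ U₂ U₃ Z} →
      U₀ ≈ μ * (x₀ * y₀) → U₁ ≈ μ * (x₁ * y₀) → U₂ ≈ μ * (x₀ * y₁) → U₃ ≈ μ * (x₁ * y₁) →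
      (U₀ ² - D * U₁ ² - D * U₂ ² + D ² * U₃ ²) * Z ≈ μ * μ * ((x₀ ² - D * x₁ ²) * (y₀ ² - D * y₁ ²) * Z)
    factor-β {μ} {x₀} {x₁} {y₀} {y₁} {Z = Z} u₀ u₁ u₂ u₃ = trans
      (*-congʳ (+-cong (+-cong (+-cong (²-cong u₀) (-‿cong (*-congˡ (²-cong u₁)))) (-‿cong (*-congˡ (²-cong u₂)))) (*-congˡ (²-cong u₃))))
      (solve 7 (λ μ x₀ x₁ y₀ y₁ Z D → let sq = λ a → a :* a in
        (sq (μ :* (x₀ :* y₀)) :- D :* sq (μ :* (x₁ :* y₀)) :- D :* sq (μ :* (x₀ :* y₁)) :+ sq D :* sq (μ :* (x₁ :* y₁))) :* Z :=
        μ :* μ :* ((sq x₀ :- D :* sq x₁) :* (sq y₀ :- D :* sq y₁) :* Z)) refl μ x₀ x₁ y₀ y₁ Z D)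

  surface⇔segreEquation : ∀ x y z u → segre L x y ∝ coords u →
    (SegreEquation L u z → On𝒦₂ L (x ∷ y ∷ z ∷ [])) × (On𝒦₂ L (x ∷ y ∷ z ∷ []) → SegreEquation L u z)
  surface⇔segreEquation [ _ ∷ _ ∷ [] ∣ _ ] [ _ ∷ _ ∷ [] ∣ _ ] [ _ ∷ _ ∷ [] ∣ _ ] [ _ ∷ _ ∷ _ ∷ _ ∷ [] ∣ _ ]
    (μ , μ≉0 , u₀ ∷ u₁ ∷ u₂ ∷ u₃ ∷ []) =
    scaled-⇔ (*-≉0 μ≉0 μ≉0) (factor-α u₀ u₁ u₂ u₃) (factor-β u₀ u₁ u₂ u₃)

  segreModel : ∀ u z → (OnQuadric L u × SegreEquation L u z) ⇔
    (∃[ x ] ∃[ y ] On𝒦₂ L (x ∷ y ∷ z ∷ []) × segre L x y ∝ coords u)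
  segreModel u z = mk⇔
    (λ { (q , e) → let x , y , u≋ = quadric-lift u q; x∝u = 1·-∝ u≋ in
         x , y , proj₁ (surface⇔segreEquation x y z u x∝u) e , x∝u })
    (λ { (x , y , onK , x∝u) → segre-quadric x y u x∝u , proj₂ (surface⇔segreEquation x y z u x∝u) onK })

  -- The coordinates form a 2 × 4 matrix with rows T₀, ..., T₃ and T₄, ..., T₇. Seven of the
  -- relations make it a column z times a row w; the relations within the rows, T₀ T₃ = T₁ T₂ and T₄
  -- T₇ = T₅ T₆, put w on the quadric, whichever of z₀ and z₁ is nonzero.
  segre₃-lift : ∀ t → OnSegreThreefold L t → ∃[ h ] segre₃ L h ∝ coords t
  segre₃-lift t@([ T₀ ∷ T₁ ∷ T₂ ∷ T₃ ∷ T₄ ∷ T₅ ∷ T₆ ∷ T₇ ∷ [] ∣ t≠0 ])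
    (e₀₃ , e₀₅ , e₀₆ , e₀₇ , e₁₆ , e₁₇ , e₂₅ , e₂₇ , e₄₇) = finish (outer-product R₀ R₁ minors (split t≠0))
    where
    R₀ R₁ : Vec Carrier 4
    R₀ = T₀ ∷ T₁ ∷ T₂ ∷ T₃ ∷ []
    R₁ = T₄ ∷ T₅ ∷ T₆ ∷ T₇ ∷ []
    minors : ∀ i j → lookup R₀ i * lookup R₁ j ≈ lookup R₀ j * lookup R₁ i
    minors zero                   zero                   = refl
    minors zero                   (suc zero)             = e₀₅
    minors zero                   (suc (suc zero))       = e₀₆
    minors zero                   (suc (suc (suc zero))) = e₀₇
    minors (suc zero)             zero                   = sym e₀₅
    minors (suc zero)             (suc zero)             = refl
    -- T₁ T₆ = T₂ T₅ is not among the nine relations, but both sides equal T₃ T₄.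
    minors (suc zero)             (suc (suc zero))       = trans e₁₆ (sym e₂₅)
    minors (suc zero)             (suc (suc (suc zero))) = e₁₇
    minors (suc (suc zero))       zero                   = sym e₀₆
    minors (suc (suc zero))       (suc zero)             = trans e₂₅ (sym e₁₆)
    minors (suc (suc zero))       (suc (suc zero))       = refl
    minors (suc (suc zero))       (suc (suc (suc zero))) = e₂₇
    minors (suc (suc (suc zero))) zero                   = sym e₀₇
    minors (suc (suc (suc zero))) (suc zero)             = sym e₁₇
    minors (suc (suc (suc zero))) (suc (suc zero))       = sym e₂₇
    minors (suc (suc (suc zero))) (suc (suc (suc zero))) = refl
    split : Nonzero (coords t) → Nonzero R₀ ⊎ Nonzero R₁
    split (here p)                          = inj₁ (here p)
    split (there (here p))                  = inj₁ (there (here p))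
    split (there (there (here p)))          = inj₁ (there (there (here p)))
    split (there (there (there (here p))))  = inj₁ (there (there (there (here p))))
    split (there (there (there (there p)))) = inj₂ p
    unscale : ∀ {z A B C D a b c d} → z ≉ 0# → A ≈ z * a → B ≈ z * b → C ≈ z * c → D ≈ z * d →
              A * D ≈ B * C → a * d ≈ b * c
    unscale {z} z≉0 A B C D e = *-cancelˡ (*-≉0 z≉0 z≉0)
      (trans (regroup _ _) (trans (sym (*-cong A D)) (trans e (trans (*-cong B C) (sym (regroup _ _))))))
      where
      regroup : ∀ a d → z * z * (a * d) ≈ z * a * (z * d)
      regroup a d = solve 3 (λ z a d → z :* z :* (a :* d) := z :* a :* (z :* d)) refl z a d
    finish : ∃[ w ] ∃[ z ] Nonzero w × R₀ ≋ (z ! zero) · w × R₁ ≋ (z ! suc zero) · w →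
             ∃[ h ] segre₃ L h ∝ coords t
    finish (w@(w₀ ∷ w₁ ∷ w₂ ∷ w₃ ∷ []) , z@([ z₀ ∷ z₁ ∷ [] ∣ z≠0 ]) , w≠0 ,
            p₀ ∷ p₁ ∷ p₂ ∷ p₃ ∷ [] , p₄ ∷ p₅ ∷ p₆ ∷ p₇ ∷ []) =
      assemble (quadric-lift [ w ∣ w≠0 ] (quadric z≠0))
      where
      quadric : Nonzero (z₀ ∷ z₁ ∷ []) → w₀ * w₃ ≈ w₁ * w₂
      quadric (here z₀≉0)         = unscale z₀≉0 p₀ p₁ p₂ p₃ e₀₃
      quadric (there (here z₁≉0)) = unscale z₁≉0 p₄ p₅ p₆ p₇ e₄₇
      entry : ∀ {T z w u} → T ≈ z * w → w ≈ u → T ≈ u * z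
      entry p e = trans p (trans (*-comm _ _) (*-congʳ e))
      assemble : ∃[ x ] ∃[ y ] w ≋ segre L x y → ∃[ h ] segre₃ L h ∝ coords t
      assemble (x@([ _ ∷ _ ∷ [] ∣ _ ]) , y@([ _ ∷ _ ∷ [] ∣ _ ]) , q₀ ∷ q₁ ∷ q₂ ∷ q₃ ∷ []) =
        (x ∷ y ∷ z ∷ []) , 1·-∝
          (entry p₀ q₀ ∷ entry p₁ q₁ ∷ entry p₂ q₂ ∷ entry p₃ q₃ ∷
           entry p₄ q₀ ∷ entry p₅ q₁ ∷ entry p₆ q₂ ∷ entry p₇ q₃ ∷ [])

  segre₃-threefold : ∀ h t → segre₃ L h ∝ coords t → OnSegreThreefold L t
  segre₃-threefold ([ x₀ ∷ x₁ ∷ [] ∣ _ ] ∷ [ y₀ ∷ y₁ ∷ [] ∣ _ ] ∷ [ z₀ ∷ z₁ ∷ [] ∣ _ ] ∷ [])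
    [ _ ∷ _ ∷ _ ∷ _ ∷ _ ∷ _ ∷ _ ∷ _ ∷ [] ∣ _ ]
    (_ , _ , t₀ ∷ t₁ ∷ t₂ ∷ t₃ ∷ t₄ ∷ t₅ ∷ t₆ ∷ t₇ ∷ []) =
    -- Each relation exchanges coordinates between two monomials: those of the first factor by `s₁`,
    -- of the second by `s₂`, of both by `s₃`.
    minor t₀ t₃ t₁ t₂ (s₁ x₀ x₁ y₀ y₁ z₀ z₀) ,
    minor t₀ t₅ t₁ t₄ (s₁ x₀ x₁ y₀ y₀ z₀ z₁) ,
    minor t₀ t₆ t₂ t₄ (s₂ x₀ x₀ y₀ y₁ z₀ z₁) ,
    minor t₀ t₇ t₃ t₄ (s₃ x₀ x₁ y₀ y₁ z₀ z₁) ,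
    minor t₁ t₆ t₃ t₄ (s₂ x₁ x₀ y₀ y₁ z₀ z₁) ,
    minor t₁ t₇ t₃ t₅ (s₂ x₁ x₁ y₀ y₁ z₀ z₁) ,
    minor t₂ t₅ t₃ t₄ (s₁ x₀ x₁ y₁ y₀ z₀ z₁) ,
    minor t₂ t₇ t₃ t₆ (s₁ x₀ x₁ y₁ y₁ z₀ z₁) ,
    minor t₄ t₇ t₅ t₆ (s₁ x₀ x₁ y₀ y₁ z₁ z₁)
    where
    s₁ : ∀ x x′ y y′ z z′ → x * y * z * (x′ * y′ * z′) ≈ x′ * y * z * (x * y′ * z′)
    s₁ = solve 6 (λ x x′ y y′ z z′ → x :* y :* z :* (x′ :* y′ :* z′) := x′ :* y :* z :* (x :* y′ :* z′)) refl
    s₂ : ∀ x x′ y y′ z z′ → x * y * z * (x′ * y′ * z′) ≈ x * y′ * z * (x′ * y * z′)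
    s₂ = solve 6 (λ x x′ y y′ z z′ → x :* y :* z :* (x′ :* y′ :* z′) := x :* y′ :* z :* (x′ :* y :* z′)) refl
    s₃ : ∀ x x′ y y′ z z′ → x * y * z * (x′ * y′ * z′) ≈ x′ * y′ * z * (x * y * z′)
    s₃ = solve 6 (λ x x′ y y′ z z′ → x :* y :* z :* (x′ :* y′ :* z′) := x′ :* y′ :* z :* (x :* y :* z′)) refl

  threefold⇔segre₃ : ∀ t → OnSegreThreefold L t ⇔ (∃[ h ] segre₃ L h ∝ coords t)
  threefold⇔segre₃ t = mk⇔ (segre₃-lift t) (λ { (h , e) → segre₃-threefold h t e })

  segre₃-nonzero : ∀ x y z → Nonzero (segre₃ L (x ∷ y ∷ z ∷ []))
  segre₃-nonzero x@([ _ ∷ _ ∷ [] ∣ _ ]) y@([ _ ∷ _ ∷ [] ∣ _ ]) [ _ ∷ _ ∷ [] ∣ z≠0 ] with segre-nonzero x y | z≠0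
  ... | here p                         | here r         = here (*-≉0 p r)
  ... | there (here p)                 | here r         = there (here (*-≉0 p r))
  ... | there (there (here p))         | here r         = there (there (here (*-≉0 p r)))
  ... | there (there (there (here p))) | here r         = there (there (there (here (*-≉0 p r))))
  ... | here p                         | there (here r) = there (there (there (there (here (*-≉0 p r)))))
  ... | there (here p)                 | there (here r) = there (there (there (there (there (here (*-≉0 p r))))))
  ... | there (there (here p))         | there (here r) = there (there (there (there (there (there (here (*-≉0 p r)))))))
  ... | there (there (there (here p))) | there (here r) = there (there (there (there (there (there (there (here (*-≉0 p r))))))))

  segre₃-projections : ∀ x y z t → segre₃ L (x ∷ y ∷ z ∷ []) ∝ coords t →
    x IsValue proj₁ (projections L t) ×
    y IsValue proj₁ (proj₂ (projections L t)) ×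
    z IsValue proj₂ (proj₂ (projections L t))
  segre₃-projections x@([ _ ∷ _ ∷ [] ∣ _ ]) y@([ _ ∷ _ ∷ [] ∣ _ ]) z@([ _ ∷ _ ∷ [] ∣ _ ])
    t@([ _ ∷ _ ∷ _ ∷ _ ∷ _ ∷ _ ∷ _ ∷ _ ∷ [] ∣ t≠0 ]) (μ , _ , t₀ ∷ t₁ ∷ t₂ ∷ t₃ ∷ t₄ ∷ t₅ ∷ t₆ ∷ t₇ ∷ []) =
    isValue {z = x} (definedX t≠0)
      ((_ , X t₀ ∷ X t₁ ∷ []) ListAll.∷ (_ , X t₂ ∷ X t₃ ∷ []) ListAll.∷
       (_ , X t₄ ∷ X t₅ ∷ []) ListAll.∷ (_ , X t₆ ∷ X t₇ ∷ []) ListAll.∷ ListAll.[]) ,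
    isValue {z = y} (definedY t≠0)
      ((_ , Y t₀ ∷ Y t₂ ∷ []) ListAll.∷ (_ , Y t₁ ∷ Y t₃ ∷ []) ListAll.∷
       (_ , Y t₄ ∷ Y t₆ ∷ []) ListAll.∷ (_ , Y t₅ ∷ Y t₇ ∷ []) ListAll.∷ ListAll.[]) ,
    isValue {z = z} (definedZ t≠0)
      ((_ , Z t₀ ∷ Z t₄ ∷ []) ListAll.∷ (_ , Z t₁ ∷ Z t₅ ∷ []) ListAll.∷
       (_ , Z t₂ ∷ Z t₆ ∷ []) ListAll.∷ (_ , Z t₃ ∷ Z t₇ ∷ []) ListAll.∷ ListAll.[])
    where
    X : ∀ {a b c T} → T ≈ μ * (a * b * c) → T ≈ μ * b * c * a
    X e = trans e (solve 4 (λ μ a b c → μ :* (a :* b :* c) := μ :* b :* c :* a) refl _ _ _ _)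
    Y : ∀ {a b c T} → T ≈ μ * (a * b * c) → T ≈ μ * a * c * b
    Y e = trans e (solve 4 (λ μ a b c → μ :* (a :* b :* c) := μ :* a :* c :* b) refl _ _ _ _)
    Z : ∀ {a b c T} → T ≈ μ * (a * b * c) → T ≈ μ * a * b * c
    Z e = trans e (solve 4 (λ μ a b c → μ :* (a :* b :* c) := μ :* a :* b :* c) refl _ _ _ _)
    definedX : Nonzero (coords t) → Defined (proj₁ (projections L t))
    definedX (here p)                                                                 = ListAny.here (here p)
    definedX (there (here p))                                                         = ListAny.here (there (here p))
    definedX (there (there (here p)))                                                 = ListAny.there (ListAny.here (here p))
    definedX (there (there (there (here p))))                                         = ListAny.there (ListAny.here (there (here p)))
    definedX (there (there (there (there (here p)))))                                 = ListAny.there (ListAny.there (ListAny.here (here p)))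
    definedX (there (there (there (there (there (here p))))))                         = ListAny.there (ListAny.there (ListAny.here (there (here p))))
    definedX (there (there (there (there (there (there (here p)))))))                 = ListAny.there (ListAny.there (ListAny.there (ListAny.here (here p))))
    definedX (there (there (there (there (there (there (there (here p))))))))         = ListAny.there (ListAny.there (ListAny.there (ListAny.here (there (here p)))))
    definedY : Nonzero (coords t) → Defined (proj₁ (proj₂ (projections L t)))
    definedY (here p)                                                                 = ListAny.here (here p)
    definedY (there (here p))                                                         = ListAny.there (ListAny.here (here p))
    definedY (there (there (here p)))                                                 = ListAny.here (there (here p))
    definedY (there (there (there (here p))))                                         = ListAny.there (ListAny.here (there (here p)))
    definedY (there (there (there (there (here p)))))                                 = ListAny.there (ListAny.there (ListAny.here (here p)))
    definedY (there (there (there (there (there (here p))))))                         = ListAny.there (ListAny.there (ListAny.there (ListAny.here (here p))))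
    definedY (there (there (there (there (there (there (here p)))))))                 = ListAny.there (ListAny.there (ListAny.here (there (here p))))
    definedY (there (there (there (there (there (there (there (here p))))))))         = ListAny.there (ListAny.there (ListAny.there (ListAny.here (there (here p)))))
    definedZ : Nonzero (coords t) → Defined (proj₂ (proj₂ (projections L t)))
    definedZ (here p)                                                                 = ListAny.here (here p)
    definedZ (there (here p))                                                         = ListAny.there (ListAny.here (here p))
    definedZ (there (there (here p)))                                                 = ListAny.there (ListAny.there (ListAny.here (here p)))
    definedZ (there (there (there (here p))))                                         = ListAny.there (ListAny.there (ListAny.there (ListAny.here (here p))))
    definedZ (there (there (there (there (here p)))))                                 = ListAny.here (there (here p))
    definedZ (there (there (there (there (there (here p))))))                         = ListAny.there (ListAny.here (there (here p)))
    definedZ (there (there (there (there (there (there (here p)))))))                 = ListAny.there (ListAny.there (ListAny.here (there (here p))))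
    definedZ (there (there (there (there (there (there (there (here p))))))))         = ListAny.there (ListAny.there (ListAny.there (ListAny.here (there (here p)))))

  surface⇔quadraticRelation : ∀ h t → segre₃ L h ∝ coords t →
    (QuadraticRelation L t → On𝒦₂ L h) × (On𝒦₂ L h → QuadraticRelation L t)
  surface⇔quadraticRelation ([ _ ∷ _ ∷ [] ∣ _ ] ∷ [ _ ∷ _ ∷ [] ∣ _ ] ∷ [ _ ∷ _ ∷ [] ∣ _ ] ∷ [])
    [ _ ∷ _ ∷ _ ∷ _ ∷ _ ∷ _ ∷ _ ∷ _ ∷ [] ∣ _ ] (μ , μ≉0 , t₀ ∷ t₁ ∷ t₂ ∷ t₃ ∷ t₄ ∷ t₅ ∷ t₆ ∷ t₇ ∷ []) =
    scaled-⇔ (*-≉0 μ≉0 μ≉0)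
      (trans (sym (*-identityʳ _)) (trans (factor-α (r t₀) (r t₁) (r t₂) (r t₃)) square))
      (trans (sym (*-identityʳ _)) (trans (factor-β (r t₄) (r t₅) (r t₆) (r t₇)) square))
    where
    r : ∀ {T a z} → T ≈ μ * (a * z) → T ≈ μ * z * a
    r e = trans e (solve 3 (λ μ a z → μ :* (a :* z) := μ :* z :* a) refl _ _ _)
    square : ∀ {z a} → μ * z * (μ * z) * (a * 1#) ≈ μ * μ * (a * z ²)
    square = solve 3 (λ μ z a → μ :* z :* (μ :* z) :* (a :* con (+ 1)) := μ :* μ :* (a :* (z :* z))) refl _ _ _

  segre₃Model : ∀ t → (OnSegreThreefold L t × QuadraticRelation L t) ⇔ (∃[ h ] On𝒦₂ L h × segre₃ L h ∝ coords t)
  segre₃Model t = mk⇔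
    (λ { (on , e) → let h , h∝t = segre₃-lift t on in h , proj₁ (surface⇔quadraticRelation h t h∝t) e , h∝t })
    (λ { (h , onK , h∝t) → segre₃-threefold h t h∝t , proj₂ (surface⇔quadraticRelation h t h∝t) onK })

  -- The eight coordinates are the entries of the four tuples of π₃ in another order.
  nonzero⇔π-defined : ∀ u → (Nonzero (toℙ⁷ L u) → π-defined L u) × (π-defined L u → Nonzero (toℙ⁷ L u))
  nonzero⇔π-defined u@([ _ ∷ _ ∷ _ ∷ _ ∷ [] ∣ _ ] ∷ [ _ ∷ _ ∷ _ ∷ _ ∷ [] ∣ _ ] ∷ []) = to , from
    where
    to : Nonzero (toℙ⁷ L u) → π-defined L u
    to (here p)                                                         = ListAny.here (here p)
    to (there (here p))                                                 = ListAny.there (ListAny.here (here p))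
    to (there (there (here p)))                                         = ListAny.there (ListAny.there (ListAny.here (here p)))
    to (there (there (there (here p))))                                 = ListAny.there (ListAny.there (ListAny.there (ListAny.here (here p))))
    to (there (there (there (there (here p)))))                         = ListAny.here (there (here p))
    to (there (there (there (there (there (here p))))))                 = ListAny.there (ListAny.here (there (here p)))
    to (there (there (there (there (there (there (here p)))))))         = ListAny.there (ListAny.there (ListAny.here (there (here p))))
    to (there (there (there (there (there (there (there (here p)))))))) = ListAny.there (ListAny.there (ListAny.there (ListAny.here (there (here p)))))
    from : π-defined L u → Nonzero (toℙ⁷ L u)
    from (ListAny.here (here p))                                                         = here p
    from (ListAny.here (there (here p)))                                                 = there (there (there (there (here p))))
    from (ListAny.there (ListAny.here (here p)))                                         = there (here p)
    from (ListAny.there (ListAny.here (there (here p))))                                 = there (there (there (there (there (here p)))))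
    from (ListAny.there (ListAny.there (ListAny.here (here p))))                         = there (there (here p))
    from (ListAny.there (ListAny.there (ListAny.here (there (here p)))))                 = there (there (there (there (there (there (here p))))))
    from (ListAny.there (ListAny.there (ListAny.there (ListAny.here (here p)))))         = there (there (there (here p)))
    from (ListAny.there (ListAny.there (ListAny.there (ListAny.here (there (here p)))))) = there (there (there (there (there (there (there (here p)))))))

  indeterminate : ∀ P Q {s t s′ t′} x y → coords P ≋ lift s t x → coords Q ≋ lift s′ t′ y →
    (t ≈ 0# × s′ ≈ 0#) ⊎ (s ≈ 0# × t′ ≈ 0#) → Indeterminate L (P ∷ Q ∷ [])
  indeterminate [ _ ∷ _ ∷ _ ∷ _ ∷ [] ∣ _ ] [ _ ∷ _ ∷ _ ∷ _ ∷ [] ∣ _ ] x y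
    (p₀ ∷ p₁ ∷ p₂ ∷ p₃ ∷ []) (q₀ ∷ q₁ ∷ q₂ ∷ q₃ ∷ []) = λ
    { (inj₁ (a , b)) → inj₁ ((zero-entry p₁ a , zero-entry p₃ a) , (zero-entry q₀ b , zero-entry q₂ b))
    ; (inj₂ (a , b)) → inj₂ ((zero-entry p₀ a , zero-entry p₂ a) , (zero-entry q₁ b , zero-entry q₃ b)) }
    where
    zero-entry : ∀ {X s a} → X ≈ s * a → s ≈ 0# → X ≈ 0#
    zero-entry e s≈0 = trans e (*-≈0ˡ _ s≈0)

  defined⇒¬indeterminate : ∀ u → π-defined L u → ¬ Indeterminate L u
  defined⇒¬indeterminate ([ _ ∷ _ ∷ _ ∷ _ ∷ [] ∣ _ ] ∷ [ _ ∷ _ ∷ _ ∷ _ ∷ [] ∣ _ ] ∷ []) defined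
    (inj₁ ((x₁ , x₃) , (y₀ , y₂))) = case defined
    where
    case : ¬ Defined _
    case (ListAny.here (here p))                                                         = p (*-≈0ʳ _ y₀)
    case (ListAny.here (there (here p)))                                                 = p (*-≈0ˡ _ x₁)
    case (ListAny.there (ListAny.here (here p)))                                         = p (*-≈0ʳ _ y₀)
    case (ListAny.there (ListAny.here (there (here p))))                                 = p (*-≈0ˡ _ x₃)
    case (ListAny.there (ListAny.there (ListAny.here (here p))))                         = p (*-≈0ʳ _ y₂)
    case (ListAny.there (ListAny.there (ListAny.here (there (here p)))))                 = p (*-≈0ˡ _ x₁)
    case (ListAny.there (ListAny.there (ListAny.there (ListAny.here (here p)))))         = p (*-≈0ʳ _ y₂)
    case (ListAny.there (ListAny.there (ListAny.there (ListAny.here (there (here p)))))) = p (*-≈0ˡ _ x₃)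
  defined⇒¬indeterminate ([ _ ∷ _ ∷ _ ∷ _ ∷ [] ∣ _ ] ∷ [ _ ∷ _ ∷ _ ∷ _ ∷ [] ∣ _ ] ∷ []) defined
    (inj₂ ((x₀ , x₂) , (y₁ , y₃))) = case defined
    where
    case : ¬ Defined _
    case (ListAny.here (here p))                                                         = p (*-≈0ˡ _ x₀)
    case (ListAny.here (there (here p)))                                                 = p (*-≈0ʳ _ y₁)
    case (ListAny.there (ListAny.here (here p)))                                         = p (*-≈0ˡ _ x₂)
    case (ListAny.there (ListAny.here (there (here p))))                                 = p (*-≈0ʳ _ y₁)
    case (ListAny.there (ListAny.there (ListAny.here (here p))))                         = p (*-≈0ˡ _ x₀)
    case (ListAny.there (ListAny.there (ListAny.here (there (here p)))))                 = p (*-≈0ʳ _ y₃)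
    case (ListAny.there (ListAny.there (ListAny.there (ListAny.here (here p)))))         = p (*-≈0ˡ _ x₂)
    case (ListAny.there (ListAny.there (ListAny.there (ListAny.here (there (here p)))))) = p (*-≈0ʳ _ y₃)

  -- If s s′ = t t′ = 0, then s = t = 0 and s′ = t′ = 0 are excluded since P and Q have nonzero
  -- coordinates; the two mixed cases are the two kinds of indeterminate points.
  ¬indeterminate⇒defined : ∀ u → OnE² L u → ¬ Indeterminate L u → π-defined L u
  ¬indeterminate⇒defined (P ∷ Q ∷ []) (onP , onQ) ¬ind with curve-lift P onP | curve-lift Q onQ
  ... | s , t , x , P≋ | s′ , t′ , y , Q≋ = cases ((s * s′) ≟ 0#) ((t * t′) ≟ 0#)
    where
    vanishing : s * s′ ≈ 0# → t * t′ ≈ 0# → (t ≈ 0# × s′ ≈ 0#) ⊎ (s ≈ 0# × t′ ≈ 0#)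
    vanishing e e′ with *-zero-product e | *-zero-product e′
    ... | inj₁ s≈0  | inj₁ t≈0  = contradiction (nonzero P) (lift-≈0 x s≈0 t≈0 P≋)
    ... | inj₁ s≈0  | inj₂ t′≈0 = inj₂ (s≈0 , t′≈0)
    ... | inj₂ s′≈0 | inj₁ t≈0  = inj₁ (t≈0 , s′≈0)
    ... | inj₂ s′≈0 | inj₂ t′≈0 = contradiction (nonzero Q) (lift-≈0 y s′≈0 t′≈0 Q≋)
    cases : Dec (s * s′ ≈ 0#) → Dec (t * t′ ≈ 0#) → Defined (π₃ L P Q)
    cases (no p)  _       = π₃-defined P Q x y P≋ Q≋ (inj₁ p)
    cases (yes _) (no p)  = π₃-defined P Q x y P≋ Q≋ (inj₂ p)
    cases (yes e) (yes e′) = contradiction (indeterminate P Q x y P≋ Q≋ (vanishing e e′)) ¬ind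

  defined⇔¬indeterminate : ∀ u → OnE² L u → π-defined L u ⇔ (¬ Indeterminate L u)
  defined⇔¬indeterminate u on = mk⇔ (defined⇒¬indeterminate u) (¬indeterminate⇒defined u on)

  nonzero⇔¬indeterminate : ∀ u → OnE² L u → Nonzero (toℙ⁷ L u) ⇔ (¬ Indeterminate L u)
  nonzero⇔¬indeterminate u on = mk⇔
    (λ nz → defined⇒¬indeterminate u (proj₁ (nonzero⇔π-defined u) nz))
    (λ ¬ind → proj₂ (nonzero⇔π-defined u) (¬indeterminate⇒defined u on ¬ind))

  -- The first four coordinates are s s′ xᵢ yⱼ and the last four t t′ xᵢ yⱼ, so `ρ` is the common
  -- factor.
  toℙ⁷-over : ∀ P Q x y z → Over P Q x y z → toℙ⁷ L (P ∷ Q ∷ []) ∝ segre₃ L (x ∷ y ∷ z ∷ [])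
  toℙ⁷-over [ _ ∷ _ ∷ _ ∷ _ ∷ [] ∣ _ ] [ _ ∷ _ ∷ _ ∷ _ ∷ [] ∣ _ ]
    [ _ ∷ _ ∷ [] ∣ _ ] [ _ ∷ _ ∷ [] ∣ _ ] [ _ ∷ _ ∷ [] ∣ _ ]
    record { ρ = ρ ; ρ≉0 = ρ≉0 ; P≋ = p₀ ∷ p₁ ∷ p₂ ∷ p₃ ∷ [] ; Q≋ = q₀ ∷ q₁ ∷ q₂ ∷ q₃ ∷ [] ; ss′ = ss′ ; tt′ = tt′ } =
    ∝-sym (ρ , ρ≉0 ,
      entry p₀ q₀ ss′ ∷ entry p₂ q₀ ss′ ∷ entry p₀ q₂ ss′ ∷ entry p₂ q₂ ss′ ∷
      entry p₁ q₁ tt′ ∷ entry p₃ q₁ tt′ ∷ entry p₁ q₃ tt′ ∷ entry p₃ q₃ tt′ ∷ [])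
    where
    entry : ∀ {X Y s s′ a b z} → X ≈ s * a → Y ≈ s′ * b → s * s′ ≈ ρ * z → X * Y ≈ ρ * (a * b * z)
    entry {s = s} {s′} {a} {b} {z} p q e = trans (*-cong p q)
      (trans (solve 4 (λ s s′ a b → s :* a :* (s′ :* b) := s :* s′ :* (a :* b)) refl s s′ a b)
      (trans (*-congʳ e) (solve 3 (λ ρ c z → ρ :* z :* c := ρ :* (c :* z)) refl ρ (a * b) z)))

  toℙ⁷-segre₃ : ∀ u v → U L u → π L u v → toℙ⁷ L u ∝ segre₃ L v
  toℙ⁷-segre₃ (P ∷ Q ∷ []) (x ∷ y ∷ z ∷ []) inU inπ = toℙ⁷-over P Q x y z (over P Q x y z inU inπ)

  over-basePoint : Over (O L) (O L) [ 1# ∷ 1# ∷ [] ∣ here 1≉0 ] [ 1# ∷ 1# ∷ [] ∣ here 1≉0 ] [ 1# ∷ 0# ∷ [] ∣ here 1≉0 ]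
  over-basePoint = record
    -- The identity (1:0:1:0) lies over x = (1:1) with t / s = 0, whence (s s′ : t t′) = (1:0).
    { s = 1# ; t = 0# ; s′ = 1# ; t′ = 0# ; ρ≉0 = 1≉0
    ; P≋ = O≋ ; Q≋ = O≋ ; curveP = curve ; curveQ = curve
    ; ss′ = refl ; tt′ = solve 0 (con (+ 0) :* con (+ 0) := con (+ 1) :* con (+ 0)) refl }
    where
    O≋ : coords (O L) ≋ lift 1# 0# [ 1# ∷ 1# ∷ [] ∣ here 1≉0 ]
    O≋ = sym (*-identityʳ _) ∷ sym (*-identityʳ _) ∷ sym (*-identityʳ _) ∷ sym (*-identityʳ _) ∷ []
    curve : 1# * 1# * (1# ² - 1# ²) ≈ 0# * 0# * (1# ² - D * 1# ²)
    curve = solve 1 (λ D → con (+ 1) :* con (+ 1) :* (con (+ 1) :* con (+ 1) :- con (+ 1) :* con (+ 1)) :=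
      con (+ 0) :* con (+ 0) :* (con (+ 1) :* con (+ 1) :- D :* (con (+ 1) :* con (+ 1)))) refl D

  base : U L (O L ∷ O L ∷ []) × π L (O L ∷ O L ∷ []) (basePoint L)
  base = over⁻¹ (O L) (O L) _ _ _ over-basePoint

theorem5p1 :
  ∀ {c ℓ : Level} (k : Field c ℓ) → let open Field k in
  1# + 1# ≉ 0# →
  (d : Field.Carrier k) → let open Kummer k d in
  IsEllipticCurve →
  -- (1)
  ( (∀ L u → OnE² L u → π-defined L u ⇔ (¬ Indeterminate L u))
  × (∀ L → U L (O L ∷ O L ∷ []) × π L (O L ∷ O L ∷ []) (basePoint L))
  × IsQuotientByInvolution k U neg² V π )
  ×
  -- (2)
  ( (∀ L → let open Projective (Extension.K L) in
       (u : ℙ 3) → OnQuadric L u ⇔ (∃[ x ] ∃[ y ] segre L x y ∝ coords u))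
  × (∀ L → let open Projective (Extension.K L) in
       (x y : ℙ 1) → Nonzero (segre L x y) ×
         ((u : ℙ 3) → segre L x y ∝ coords u →
          x IsValue proj₁ (rulings L u) × y IsValue proj₂ (rulings L u)))
  × (∀ L → let open Projective (Extension.K L) in
       (u : ℙ 3) (z : ℙ 1) →
       (OnQuadric L u × SegreEquation L u z) ⇔
       (∃[ x ] ∃[ y ] On𝒦₂ L (x ∷ y ∷ z ∷ []) × segre L x y ∝ coords u)) )
  ×
  -- (3)
  ( (∀ L → let open Projective (Extension.K L) in
       (t : ℙ 7) → OnSegreThreefold L t ⇔ (∃[ h ] segre₃ L h ∝ coords t))
  × (∀ L → let open Projective (Extension.K L) in
       (x y z : ℙ 1) → Nonzero (segre₃ L (x ∷ y ∷ z ∷ [])) ×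
         ((t : ℙ 7) → segre₃ L (x ∷ y ∷ z ∷ []) ∝ coords t →
          x IsValue proj₁ (projections L t) ×
          y IsValue proj₁ (proj₂ (projections L t)) ×
          z IsValue proj₂ (proj₂ (projections L t))))
  × (∀ L → let open Projective (Extension.K L) in
       (t : ℙ 7) →
       (OnSegreThreefold L t × QuadraticRelation L t) ⇔
       (∃[ h ] On𝒦₂ L h × segre₃ L h ∝ coords t))
  × (∀ L u → let open Projective (Extension.K L) in
       OnE² L u →
       (Nonzero (toℙ⁷ L u) ⇔ (¬ Indeterminate L u)) ×
       (∀ v → U L u → π L u v → toℙ⁷ L u ∝ segre₃ L v)) )
theorem5p1 k 2≉0 d smooth =
  ( (λ L → defined⇔¬indeterminate L)
  , (λ L → base L)
  , Quotient.isQuotient 2≉0 d smooth ) ,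
  ( (λ L → quadric⇔segre L)
  , (λ L x y → segre-nonzero L x y , segre-rulings L x y)
  , (λ L → segreModel L) ) ,
  ( (λ L → threefold⇔segre₃ L)
  , (λ L x y z → segre₃-nonzero L x y z , segre₃-projections L x y z)
  , (λ L → segre₃Model L)
  , (λ L u onE² → nonzero⇔¬indeterminate L u onE² , toℙ⁷-segre₃ L u) )
  where open SegreModels 2≉0 d smooth
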